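{- Let $\mathcal{F}$ be the smallest family of finite posets that contains every $X$-free finite poset and that is closed under the two operations $(\mathcal{P},\mathcal{Q}) \mapsto \mathcal{P} < \mathcal{Q}$ and $(\mathcal{P},\mathcal{Q}) \mapsto \mathcal{P} \sqcup \mathcal{Q}$ (applied to posets on disjoint ground sets). Then for every poset $\mathcal{P} \in \mathcal{F}$, $$f_{\mathcal{O}(\mathcal{P})} \le f_{\mathcal{C}(\mathcal{P})},$$ that is, for every $i$ the number of $i$-dimensional faces of the order polytope $\mathcal{O}(\mathcal{P})$ is at most the number of $i$-dimensional faces of the chain polytope $\mathcal{C}(\mathcal{P})$.
   Context: All posets are finite. For a finite poset $\mathcal{P}$, the order polytope $\mathcal{O}(\mathcal{P}) \subseteq \mathbb{R}^{\mathcal{P}}$ is defined by $0 \le x_i \le 1$ for all $i \in \mathcal{P}$ and $x_i \le x_j$ for all $i \le j$ in $\mathcal{P}$. The chain polytope $\mathcal{C}(\mathcal{P}) \subseteq \mathbb{R}^{\mathcal{P}}$ is defined by $x_i \ge 0$ for all $i \in \mathcal{P}$ and $\sum_{i \in C} x_i \le 1$ for every chain $C$ of $\mathcal{P}$. For posets $A,B$ on disjoint sets, the ordinal sum $A<B$ is the poset on $A \cup B$ with $x \le y$ iff $x \le y$ in $A$, or $x\le y$ in $B$, or $x \in A$ and $y \in B$; the disjoint union $A \sqcup B$ is the poset on $A\cup B$ with $x \le y$ iff $x \le y$ in $A$ or $x \le y$ in $B$. The $X$-poset is the 5-element poset with elements $a,b,c,d,e$ whose cover relations are $a<c$, $b<c$,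 $c<d$, $c<e$ (two minimal elements below a middle element, which is below two maximal elements). A poset is $X$-free if it has no induced subposet isomorphic to the $X$-poset. For a polytope $P$ of dimension $d$, its $f$-polynomial is $f_P = \sum_{i=-1}^{d} f_i x^{i+1}$, where $f_i$ is the number of $i$-dimensional faces of $P$ (the empty face has dimension $-1$ and $P$ itself counts as a face). For polynomials $f,g$ with nonnegative integer coefficients, $f \le g$ means that every coefficient of $f$ is at most the corresponding coefficient of $g$.
   Formalization: The order and chain polytopes are taken as sets of points with rational coordinates instead of real ones, and their faces are those cut out by valid linear inequalities with rational coefficients, with affine independence over the rationals. -}

module Defs where

open import Data.Bool using (Bool; true; false; T)
open import Data.Nat as ℕ using (ℕ; zero; suc)
open import Data.Fin using (Fin; zero; suc; splitAt)
open import Data.Sum using (_⊎_; inj₁; inj₂)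
open import Data.Product using (Σ; _×_; _,_; ∃)
open import Data.Rational using (ℚ; 0ℚ; 1ℚ; _+_; _*_; _≤_)
open import Relation.Binary.PropositionalEquality using (_≡_; _≢_)
open import Relation.Nullary using (¬_)
open import Function.Bundles using (_⇔_)

BRel : ℕ → Set
BRel n = Fin n → Fin n → Bool

record IsPoset {n : ℕ} (R : BRel n) : Set where
  field
    refl    : ∀ i → T (R i i)
    antisym : ∀ i j → T (R i j) → T (R j i) → i ≡ j
    trans   : ∀ i j k → T (R i j) → T (R j k) → T (R i k)

ordinalSum : ∀ {m n} → BRel m → BRel n → BRel (m ℕ.+ n)
ordinalSum {m} P Q i j with splitAt m i | splitAt m j
... | inj₁ a | inj₁ b = P a b
... | inj₂ a | inj₂ b = Q a b
... | inj₁ _ | inj₂ _ = true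
... | inj₂ _ | inj₁ _ = false

disjointUnion : ∀ {m n} → BRel m → BRel n → BRel (m ℕ.+ n)
disjointUnion {m} P Q i j with splitAt m i | splitAt m j
... | inj₁ a | inj₁ b = P a b
... | inj₂ a | inj₂ b = Q a b
... | inj₁ _ | inj₂ _ = false
... | inj₂ _ | inj₁ _ = false

-- The X-poset on {a,b,c,d,e} = {0,1,2,3,4}: a<c, b<c, c<d, c<e (and transitive closure)
XPoset : BRel 5
XPoset zero zero = true
XPoset zero (suc zero) = false
XPoset zero (suc (suc _)) = true
XPoset (suc zero) zero = false
XPoset (suc zero) (suc zero) = true
XPoset (suc zero) (suc (suc _)) = true
XPoset (suc (suc zero)) zero = false
XPoset (suc (suc zero)) (suc zero) = false
XPoset (suc (suc zero)) (suc (suc _)) = true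
XPoset (suc (suc (suc zero))) (suc (suc (suc zero))) = true
XPoset (suc (suc (suc (suc zero)))) (suc (suc (suc (suc zero)))) = true
XPoset (suc (suc (suc _))) _ = false

HasInducedX : ∀ {n} → BRel n → Set
HasInducedX {n} R =
  Σ (Fin 5 → Fin n) λ e →
    (∀ a b → e a ≡ e b → a ≡ b) × (∀ a b → R (e a) (e b) ≡ XPoset a b)

XFree : ∀ {n} → BRel n → Set
XFree R = ¬ HasInducedX R

-- Order isomorphism via a bijection (injective self-map of Fin n)
Iso : ∀ {n} → BRel n → BRel n → Set
Iso {n} R S =
  Σ (Fin n → Fin n) λ σ →
    (∀ i j → σ i ≡ σ j → i ≡ j) × (∀ i j → S (σ i) (σ j) ≡ R i j)

-- The smallest family containing all X-free posets, closed under ordinal sum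
-- and disjoint union (on disjoint ground sets; hence also closed under isomorphism)
data InF : ∀ {n} → BRel n → Set where
  xfree  : ∀ {n} {R : BRel n} → IsPoset R → XFree R → InF R
  ordsum : ∀ {m n} {P : BRel m} {Q : BRel n} → InF P → InF Q → InF (ordinalSum P Q)
  disj   : ∀ {m n} {P : BRel m} {Q : BRel n} → InF P → InF Q → InF (disjointUnion P Q)
  iso    : ∀ {n} {R S : BRel n} → InF R → Iso R S → InF S

Point : ℕ → Set
Point n = Fin n → ℚ

sumℚ : ∀ {n} → (Fin n → ℚ) → ℚ
sumℚ {zero}  f = 0ℚ
sumℚ {suc n} f = f zero + sumℚ (λ i → f (suc i))

dot : ∀ {n} → Point n → Point n → ℚ
dot c x = sumℚ (λ i → c i * x i)

PointSet : ℕ → Set₁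
PointSet n = Point n → Set

OrderPolytope : ∀ {n} → BRel n → PointSet n
OrderPolytope R x =
  (∀ i → 0ℚ ≤ x i) × (∀ i → x i ≤ 1ℚ) × (∀ i j → T (R i j) → x i ≤ x j)

IsChain : ∀ {n} → BRel n → (Fin n → Bool) → Set
IsChain R C = ∀ i j → C i ≡ true → C j ≡ true → T (R i j) ⊎ T (R j i)

indicatorSum : ∀ {n} → (Fin n → Bool) → Point n → ℚ
indicatorSum C x = sumℚ (λ i → sel (C i) (x i))
  where
  sel : Bool → ℚ → ℚ
  sel true  q = q
  sel false _ = 0ℚ

ChainPolytope : ∀ {n} → BRel n → PointSet n
ChainPolytope R x =
  (∀ i → 0ℚ ≤ x i) × (∀ C → IsChain R C → indicatorSum C x ≤ 1ℚ)

-- A face of a polytope S: {x ∈ S | c·x = δ} for a valid inequality c·x ≤ δ.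
-- (c = 0, δ = 0 gives S itself; c = 0, δ = 1 gives the empty face.)
record Face {n : ℕ} (S : PointSet n) : Set where
  constructor face
  field
    normal : Point n
    rhs    : ℚ
    valid  : ∀ x → S x → dot normal x ≤ rhs

faceSet : ∀ {n} {S : PointSet n} → Face S → PointSet n
faceSet {S = S} F x = S x × (dot (Face.normal F) x ≡ Face.rhs F)

SameSet : ∀ {n} → PointSet n → PointSet n → Set
SameSet A B = ∀ x → A x ⇔ B x

AffinelyIndependent : ∀ {n k} → (Fin k → Point n) → Set
AffinelyIndependent {n} {k} p =
  ∀ (λs : Fin k → ℚ) →
    sumℚ λs ≡ 0ℚ →
    (∀ i → sumℚ (λ j → λs j * p j i) ≡ 0ℚ) →
    ∀ j → λs j ≡ 0ℚ

-- AffRank A k : the maximal number of affinely independent points of A is k,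
-- i.e. dim A = k - 1 (so the empty set has AffRank 0, dimension -1).
AffRank : ∀ {n} → PointSet n → ℕ → Set
AffRank {n} A k =
  (Σ (Fin k → Point n) λ p → (∀ j → A (p j)) × AffinelyIndependent p) ×
  (∀ (p : Fin (suc k) → Point n) → (∀ j → A (p j)) → ¬ AffinelyIndependent p)

-- A list of m pairwise distinct faces of S, all of dimension k - 1
-- (i.e. contributing to the coefficient of x^k in the f-polynomial)
DistinctFaces : ∀ {n} → PointSet n → ℕ → ℕ → Set
DistinctFaces S k m =
  Σ (Fin m → Face S) λ fs →
    (∀ j → AffRank (faceSet (fs j)) k) ×
    (∀ i j → i ≢ j → ¬ SameSet (faceSet (fs i)) (faceSet (fs j)))

-- coefficientwise f-polynomial comparison f_A ≤ f_B:
-- for each k, (#faces of A of dim k-1) ≤ (#faces of B of dim k-1)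
FPolyLe : ∀ {n} → PointSet n → PointSet n → Set
FPolyLe A B = ∀ k m → DistinctFaces A k m → DistinctFaces B k m

{-# OPTIONS --safe #-}
-- A rank-preserving injection from the faces of O(P) to the faces of C(P) is built by induction
-- over the family.  For X-free P the two polytopes are affinely equivalent (Hibi and Li), and a
-- disjoint union gives products.  For an ordinal sum both polytopes are, up to a reflection, wedges:
-- convex hulls of two polytopes in complementary spaces that share the origin as a vertex.  A face of
-- a wedge is either a pair of faces through the origin, with rank one less than the sum of the ranks,
-- or a join of two faces that avoid the origin, with rank the sum of the ranks.
--
-- The faces of C(P) at the origin are the 2ⁿ coordinate faces, and O(P) has matching faces ι T at the
-- origin, one of rank |T| + 1 for every T ⊆ P.  Subtracting both families, the injection can be
-- rearranged so that all faces other than the ι T go to faces that avoid the origin.  In an ordinal sum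
-- the pairs (ι T, ι T′) go to coordinate faces.  In any other pair through the origin one of the two
-- faces is not an ι T; the other one is replaced by a facet of it that avoids the origin and from which
-- it can be recovered, and the images are joined.
module Submission where

open import Defs
open import Data.Bool using (Bool; true; false; T; _∧_; _∨_; not)
import Data.Bool.Properties as Bool
open import Data.Empty using (⊥; ⊥-elim)
open import Data.Fin using (Fin; zero; suc; toℕ; fromℕ<; join; splitAt; _↑ˡ_; _↑ʳ_; punchIn; punchOut)
open import Data.Fin.Induction using (spo-wellFounded)
import Data.Fin.Properties as Fin
open import Data.List using (List; []; _∷_; _++_; map; allFin)
open import Data.List.Membership.Propositional using (_∈_)
import Data.List.Membership.Propositional.Properties as ∈
open import Data.List.Relation.Unary.All using (All; []; _∷_)
import Data.List.Relation.Unary.All as All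
open import Data.List.Relation.Unary.Any using (here; there)
open import Data.List.Relation.Unary.Unique.Propositional using (Unique)
open import Data.List.Relation.Unary.AllPairs using ([]; _∷_)
import Data.List.Relation.Unary.Unique.Propositional.Properties as Unique
open import Data.Maybe using (just; nothing)
open import Data.Nat as ℕ using (ℕ; zero; suc; z≤n; s≤s)
import Data.Nat.Properties as ℕ
open import Data.Product using (Σ; _×_; _,_; ∃; proj₁; proj₂)
open import Data.Rational using (ℚ; 0ℚ; 1ℚ; _+_; _*_; -_; _-_; _≤_; _<_; 1/_)
import Data.Rational as ℚ
import Data.Rational.Properties as ℚ
open import Data.Sum using (_⊎_; inj₁; inj₂)
open import Data.Unit using (⊤; tt)
open import Data.Vec using (Vec; []; _∷_; lookup; tabulate)
import Data.Vec as Vec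
import Data.Vec.Properties as Vec
open import Function using (_∘_; id)
open import Function.Bundles using (mk⇔; Equivalence)
open import Induction.WellFounded using (Acc; acc; WellFounded)
open import Level using (0ℓ)
open import Relation.Binary.PropositionalEquality
  using (_≡_; _≢_; refl; sym; trans; cong; cong₂; subst; module ≡-Reasoning)
import Relation.Binary.PropositionalEquality.Properties as ≡
open import Relation.Binary.Definitions using (tri<; tri≈; tri>)
open import Relation.Nullary using (¬_; Dec; yes; no; does; ¬?; contradiction)
open import Relation.Nullary.Decidable using (_×-dec_; _⊎-dec_; _→-dec_; map′; does-⇔; from-yes)
open import Tactic.RingSolver using (solve-∀)
open import Tactic.RingSolver.Core.AlmostCommutativeRing using (AlmostCommutativeRing; fromCommutativeRing)

-- The obstacle is the shared vertex. A pair of faces through the origin loses one in rank and a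
-- pair avoiding it does not, so embeddings of the two summands combine well only if faces avoiding
-- the origin go to faces avoiding the origin. C(P) has exactly 2ⁿ faces at its origin while O(P)
-- has at least that many and in general more. The surplus has to land among the faces that avoid
-- the origin, and there a facet taken in one component makes up for the rank lost at the shared
-- vertex.
--
-- The argument runs by case distinctions, so equality of faces must be decidable although a face is
-- given only by an inequality. Faces are therefore carried together with an affine basis, and
-- inclusion is tested at its finitely many points. Bases of arbitrary faces are computed for order
-- polytopes, from chains of filters; on the chain side a basis is delivered along with each image.

ringℚ : AlmostCommutativeRing 0ℓ 0ℓ
ringℚ = fromCommutativeRing ℚ.+-*-commutativeRing isZero
  where
  isZero : ∀ x → _
  isZero x with 0ℚ ℚ.≟ x
  ... | yes p = just p
  ... | no _  = nothing

-- Ordered field arithmetic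

-- Inequalities are proved throughout by exhibiting the difference as a visibly nonnegative
-- expression, with the ring solver supplying the identity; `≤-add` and `≤-sub` pass between the two
-- forms.
≤-add : ∀ {a b} → 0ℚ ≤ b - a → a ≤ b
≤-add {a} {b} p = begin
  a            ≡⟨ sym (ℚ.+-identityʳ a) ⟩
  a + 0ℚ       ≤⟨ ℚ.+-monoʳ-≤ a p ⟩
  a + (b - a)  ≡⟨ eq a b ⟩
  b            ∎
  where
  open ℚ.≤-Reasoning
  eq : ∀ a b → a + (b - a) ≡ b
  eq = solve-∀ ringℚ

≤-sub : ∀ {a b} → a ≤ b → 0ℚ ≤ b - a
≤-sub {a} {b} p = begin
  0ℚ     ≡⟨ sym (ℚ.+-inverseʳ a) ⟩
  a - a  ≤⟨ ℚ.+-monoˡ-≤ (- a) p ⟩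
  b - a  ∎
  where open ℚ.≤-Reasoning

0≤+ : ∀ {a b} → 0ℚ ≤ a → 0ℚ ≤ b → 0ℚ ≤ a + b
0≤+ {a} {b} p q = subst (_≤ a + b) (ℚ.+-identityʳ 0ℚ) (ℚ.+-mono-≤ p q)

*-monoˡ : ∀ {a b c} → 0ℚ ≤ a → b ≤ c → a * b ≤ a * c
*-monoˡ {a} p q = ℚ.*-monoˡ-≤-nonNeg a {{ℚ.nonNegative p}} q

0≤* : ∀ {a b} → 0ℚ ≤ a → 0ℚ ≤ b → 0ℚ ≤ a * b
0≤* {a} {b} p q = subst (_≤ a * b) (ℚ.*-zeroʳ a) (*-monoˡ p q)

0≤1 : 0ℚ ≤ 1ℚ
0≤1 = ℚ.nonNegative⁻¹ 1ℚ

0<1 : 0ℚ < 1ℚ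
0<1 = ℚ.positive⁻¹ 1ℚ

inverse : ∀ {a} → a ≢ 0ℚ → Σ ℚ λ b → b * a ≡ 1ℚ
inverse {a} a≢0 = (1/ a) {{nz}} , ℚ.*-inverseˡ a {{nz}}
  where nz = ℚ.≢-nonZero a≢0

*-cancel-0 : ∀ {a b} → a ≢ 0ℚ → a * b ≡ 0ℚ → b ≡ 0ℚ
*-cancel-0 {a} {b} a≢0 ab≡0 with inverse a≢0
... | c , ca≡1 = begin
  b            ≡⟨ sym (ℚ.*-identityˡ b) ⟩
  1ℚ * b       ≡⟨ cong (_* b) (sym ca≡1) ⟩
  c * a * b    ≡⟨ ℚ.*-assoc c a b ⟩
  c * (a * b)  ≡⟨ cong (c *_) ab≡0 ⟩
  c * 0ℚ       ≡⟨ ℚ.*-zeroʳ c ⟩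
  0ℚ           ∎
  where open ≡-Reasoning

0≤1/ : ∀ {a b} → 0ℚ < a → b * a ≡ 1ℚ → 0ℚ ≤ b
0≤1/ {a} {b} 0<a ba≡1 with 0ℚ ℚ.≤? b
... | yes p = p
... | no ¬p = contradiction 1≤0 (λ le → ℚ.<-irrefl refl (ℚ.<-≤-trans 0<1 le))
  where
  1≤0 : 1ℚ ≤ 0ℚ
  1≤0 = begin
    1ℚ      ≡⟨ sym ba≡1 ⟩
    b * a   ≡⟨ ℚ.*-comm b a ⟩
    a * b   ≤⟨ *-monoˡ (ℚ.<⇒≤ 0<a) (ℚ.<⇒≤ (ℚ.≰⇒> ¬p)) ⟩
    a * 0ℚ  ≡⟨ ℚ.*-zeroʳ a ⟩
    0ℚ      ∎
    where open ℚ.≤-Reasoning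

<-of-≤≢ : ∀ {a b} → a ≤ b → a ≢ b → a < b
<-of-≤≢ {a} {b} a≤b a≢b with ℚ.<-cmp a b
... | tri< a<b _ _ = a<b
... | tri≈ _ a≡b _ = contradiction a≡b a≢b
... | tri> _ _ b<a = contradiction (ℚ.≤-antisym a≤b (ℚ.<⇒≤ b<a)) a≢b

+-zero-l : ∀ {a b} → 0ℚ ≤ a → 0ℚ ≤ b → a + b ≡ 0ℚ → a ≡ 0ℚ
+-zero-l {a} {b} 0≤a 0≤b ab≡0 = ℚ.≤-antisym a≤0 0≤a
  where
  open ℚ.≤-Reasoning
  a≤0 : a ≤ 0ℚ
  a≤0 = begin
    a       ≡⟨ sym (ℚ.+-identityʳ a) ⟩
    a + 0ℚ  ≤⟨ ℚ.+-monoʳ-≤ a 0≤b ⟩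
    a + b   ≡⟨ ab≡0 ⟩
    0ℚ      ∎

+-zero-r : ∀ {a b} → 0ℚ ≤ a → 0ℚ ≤ b → a + b ≡ 0ℚ → b ≡ 0ℚ
+-zero-r {a} {b} 0≤a 0≤b ab≡0 = +-zero-l 0≤b 0≤a (trans (ℚ.+-comm b a) ab≡0)

-- Finite sums

sum-cong : ∀ {n} {f g : Fin n → ℚ} → (∀ i → f i ≡ g i) → sumℚ f ≡ sumℚ g
sum-cong {zero}  eq = refl
sum-cong {suc n} eq = cong₂ _+_ (eq zero) (sum-cong (eq ∘ suc))

sum-+ : ∀ {n} (f g : Fin n → ℚ) → sumℚ (λ i → f i + g i) ≡ sumℚ f + sumℚ g
sum-+ {zero}  f g = sym (ℚ.+-identityʳ 0ℚ)
sum-+ {suc n} f g = trans (cong (f zero + g zero +_) (sum-+ (f ∘ suc) (g ∘ suc)))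
  (lem (f zero) (g zero) (sumℚ (f ∘ suc)) (sumℚ (g ∘ suc)))
  where
  lem : ∀ a b c d → a + b + (c + d) ≡ a + c + (b + d)
  lem = solve-∀ ringℚ

sum-*ˡ : ∀ {n} a (f : Fin n → ℚ) → sumℚ (λ i → a * f i) ≡ a * sumℚ f
sum-*ˡ {zero}  a f = sym (ℚ.*-zeroʳ a)
sum-*ˡ {suc n} a f = trans (cong (a * f zero +_) (sum-*ˡ a (f ∘ suc)))
  (sym (ℚ.*-distribˡ-+ a (f zero) (sumℚ (f ∘ suc))))

sum-zero : ∀ {n} {f : Fin n → ℚ} → (∀ i → f i ≡ 0ℚ) → sumℚ f ≡ 0ℚ
sum-zero {zero}  eq = refl
sum-zero {suc n} eq = trans (cong₂ _+_ (eq zero) (sum-zero (eq ∘ suc))) (ℚ.+-identityʳ 0ℚ)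

sum-swap : ∀ {m n} (f : Fin m → Fin n → ℚ) →
  sumℚ (λ i → sumℚ (f i)) ≡ sumℚ (λ j → sumℚ (λ i → f i j))
sum-swap {zero} {n} f = sym (sum-zero {n} (λ _ → refl))
sum-swap {suc m} f = trans (cong (sumℚ (f zero) +_) (sum-swap (f ∘ suc)))
  (sym (sum-+ (f zero) (λ j → sumℚ (λ i → f (suc i) j))))

sum-split : ∀ m {n} (f : Fin (m ℕ.+ n) → ℚ) →
  sumℚ f ≡ sumℚ (λ i → f (i ↑ˡ n)) + sumℚ (λ j → f (m ↑ʳ j))
sum-split zero    f = sym (ℚ.+-identityˡ _)
sum-split (suc m) f = trans (cong (f zero +_) (sum-split m (f ∘ suc))) (sym (ℚ.+-assoc (f zero) _ _))

sum-punchIn : ∀ {n} (f : Fin (suc n) → ℚ) i → sumℚ f ≡ f i + sumℚ (f ∘ punchIn i)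
sum-punchIn f zero = refl
sum-punchIn {suc n} f (suc i) = trans (cong (f zero +_) (sum-punchIn (f ∘ suc) i))
  (lem (f zero) (f (suc i)) _)
  where
  lem : ∀ a b c → a + (b + c) ≡ b + (a + c)
  lem = solve-∀ ringℚ

sum-mono : ∀ {n} {f g : Fin n → ℚ} → (∀ i → f i ≤ g i) → sumℚ f ≤ sumℚ g
sum-mono {zero}  le = ℚ.≤-refl
sum-mono {suc n} le = ℚ.+-mono-≤ (le zero) (sum-mono (le ∘ suc))

sum-nonneg : ∀ {n} {f : Fin n → ℚ} → (∀ i → 0ℚ ≤ f i) → 0ℚ ≤ sumℚ f
sum-nonneg {n} {f} le = subst (_≤ sumℚ f) (sum-zero {n} (λ _ → refl)) (sum-mono le)

sum-nonneg-zero : ∀ {n} {f : Fin n → ℚ} → (∀ i → 0ℚ ≤ f i) → sumℚ f ≡ 0ℚ → ∀ i → f i ≡ 0ℚ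
sum-nonneg-zero le eq zero    = +-zero-l (le zero) (sum-nonneg (le ∘ suc)) eq
sum-nonneg-zero le eq (suc i) =
  sum-nonneg-zero (le ∘ suc) (+-zero-r (le zero) (sum-nonneg (le ∘ suc)) eq) i

sum-single : ∀ {n} (f : Fin n → ℚ) i → (∀ j → j ≢ i → f j ≡ 0ℚ) → sumℚ f ≡ f i
sum-single {suc n} f i eq = trans (sum-punchIn f i)
  (trans (cong (f i +_) (sum-zero (λ j → eq (punchIn i j) (Fin.punchInᵢ≢i i j)))) (ℚ.+-identityʳ (f i)))

-- Linear combinations and the dot product

comb : ∀ {n k} → (Fin k → ℚ) → (Fin k → Point n) → Point n
comb μ p i = sumℚ (λ j → μ j * p j i)

dot-congʳ : ∀ {n} (c : Point n) {x y} → (∀ i → x i ≡ y i) → dot c x ≡ dot c y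
dot-congʳ c eq = sum-cong (λ i → cong (c i *_) (eq i))

dot-congˡ : ∀ {n} {c d : Point n} x → (∀ i → c i ≡ d i) → dot c x ≡ dot d x
dot-congˡ x eq = sum-cong (λ i → cong (_* x i) (eq i))

dot-comm : ∀ {n} (c x : Point n) → dot c x ≡ dot x c
dot-comm c x = sum-cong (λ i → ℚ.*-comm (c i) (x i))

dot-+ʳ : ∀ {n} (c x y : Point n) → dot c (λ i → x i + y i) ≡ dot c x + dot c y
dot-+ʳ c x y = trans (sum-cong (λ i → ℚ.*-distribˡ-+ (c i) (x i) (y i)))
  (sum-+ (λ i → c i * x i) (λ i → c i * y i))

dot-*ʳ : ∀ {n} (c x : Point n) a → dot c (λ i → a * x i) ≡ a * dot c x
dot-*ʳ c x a = trans (sum-cong (λ i → lem (c i) a (x i))) (sum-*ˡ a (λ i → c i * x i))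
  where
  lem : ∀ u v w → u * (v * w) ≡ v * (u * w)
  lem = solve-∀ ringℚ

dot-+ˡ : ∀ {n} (c d x : Point n) → dot (λ i → c i + d i) x ≡ dot c x + dot d x
dot-+ˡ c d x = trans (dot-comm (λ i → c i + d i) x)
  (trans (dot-+ʳ x c d) (cong₂ _+_ (dot-comm x c) (dot-comm x d)))

dot-*ˡ : ∀ {n} (c x : Point n) a → dot (λ i → a * c i) x ≡ a * dot c x
dot-*ˡ c x a = trans (dot-comm (λ i → a * c i) x) (trans (dot-*ʳ x c a) (cong (a *_) (dot-comm x c)))

dot-0ʳ : ∀ {n} (c : Point n) {x} → (∀ i → x i ≡ 0ℚ) → dot c x ≡ 0ℚ
dot-0ʳ c eq = sum-zero (λ i → trans (cong (c i *_) (eq i)) (ℚ.*-zeroʳ (c i)))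

dot-0ˡ : ∀ {n} {c : Point n} x → (∀ i → c i ≡ 0ℚ) → dot c x ≡ 0ℚ
dot-0ˡ {c = c} x eq = trans (dot-comm c x) (dot-0ʳ x eq)

dot-comb : ∀ {n k} (c : Point n) (μ : Fin k → ℚ) (p : Fin k → Point n) →
  dot c (comb μ p) ≡ sumℚ (λ j → μ j * dot c (p j))
dot-comb c μ p = begin
  sumℚ (λ i → c i * sumℚ (λ j → μ j * p j i))
    ≡⟨ sum-cong (λ i → sym (sum-*ˡ (c i) (λ j → μ j * p j i))) ⟩
  sumℚ (λ i → sumℚ (λ j → c i * (μ j * p j i)))
    ≡⟨ sum-swap (λ i j → c i * (μ j * p j i)) ⟩
  sumℚ (λ j → sumℚ (λ i → c i * (μ j * p j i)))
    ≡⟨ sum-cong (λ j → dot-*ʳ c (p j) (μ j)) ⟩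
  sumℚ (λ j → μ j * dot c (p j)) ∎
  where open ≡-Reasoning

dot-comb-const : ∀ {n k} (c : Point n) δ (μ : Fin k → ℚ) (p : Fin k → Point n) →
  (∀ j → dot c (p j) ≡ δ) → dot c (comb μ p) ≡ δ * sumℚ μ
dot-comb-const c δ μ p eq = trans (dot-comb c μ p)
  (trans (sum-cong (λ j → trans (cong (μ j *_) (eq j)) (ℚ.*-comm (μ j) δ))) (sum-*ˡ δ μ))

unit : ∀ {n} → Fin n → Point n
unit i j with i Fin.≟ j
... | yes _ = 1ℚ
... | no _  = 0ℚ

unit-diag : ∀ {n} (i : Fin n) → unit i i ≡ 1ℚ
unit-diag i with i Fin.≟ i
... | yes _  = refl
... | no i≢i = contradiction refl i≢i

unit-off : ∀ {n} {i j : Fin n} → i ≢ j → unit i j ≡ 0ℚ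
unit-off {i = i} {j} i≢j with i Fin.≟ j
... | yes i≡j = contradiction i≡j i≢j
... | no _    = refl

dot-unitʳ : ∀ {n} (c : Point n) i → dot c (unit i) ≡ c i
dot-unitʳ c i = trans (sum-single (λ j → c j * unit i j) i
    (λ j j≢i → trans (cong (c j *_) (unit-off (j≢i ∘ sym))) (ℚ.*-zeroʳ (c j))))
  (trans (cong (c i *_) (unit-diag i)) (ℚ.*-identityʳ (c i)))

dot-unitˡ : ∀ {n} i (x : Point n) → dot (unit i) x ≡ x i
dot-unitˡ i x = trans (dot-comm (unit i) x) (dot-unitʳ x i)

-- Ranks

hom : ∀ {n} → Point n → Point (suc n)
hom x zero    = 1ℚ
hom x (suc i) = x i

LinIndep : ∀ {n k} → (Fin k → Point n) → Set
LinIndep {k = k} v = ∀ (μ : Fin k → ℚ) → (∀ i → comb μ v i ≡ 0ℚ) → ∀ j → μ j ≡ 0ℚ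

Combination : ∀ {n k} → (Fin k → Point n) → Point n → Set
Combination {k = k} v x = Σ (Fin k → ℚ) λ μ → ∀ i → comb μ v i ≡ x i

-- Points are homogenised, so that affine independence and affine hulls become linear.
record Basis {n : ℕ} (A : PointSet n) (k : ℕ) : Set where
  field
    pt    : Fin k → Point n
    mem   : ∀ j → A (pt j)
    indep : LinIndep (hom ∘ pt)
    span  : ∀ x → A x → Combination (hom ∘ pt) (hom x)

open Basis

sum-*1 : ∀ {k} (μ : Fin k → ℚ) → sumℚ (λ j → μ j * 1ℚ) ≡ sumℚ μ
sum-*1 μ = sum-cong (λ j → ℚ.*-identityʳ (μ j))

comb-comb : ∀ {n k l} (μ : Fin k → ℚ) (M : Fin k → Fin l → ℚ) (v : Fin l → Point n) i →
  sumℚ (λ j → μ j * comb (M j) v i) ≡ comb (λ r → sumℚ (λ j → μ j * M j r)) v i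
comb-comb μ M v i = begin
  sumℚ (λ j → μ j * sumℚ (λ r → M j r * v r i))
    ≡⟨ sum-cong (λ j → sym (sum-*ˡ (μ j) (λ r → M j r * v r i))) ⟩
  sumℚ (λ j → sumℚ (λ r → μ j * (M j r * v r i)))
    ≡⟨ sum-swap (λ j r → μ j * (M j r * v r i)) ⟩
  sumℚ (λ r → sumℚ (λ j → μ j * (M j r * v r i)))
    ≡⟨ sum-cong (λ r → trans (sum-cong (λ j → lem (μ j) (M j r) (v r i)))
         (trans (sum-*ˡ (v r i) (λ j → μ j * M j r)) (ℚ.*-comm (v r i) _))) ⟩
  sumℚ (λ r → sumℚ (λ j → μ j * M j r) * v r i) ∎
  where
  open ≡-Reasoning
  lem : ∀ a b c → a * (b * c) ≡ c * (a * b)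
  lem = solve-∀ ringℚ

-- Gaussian elimination without division. If the first row is zero it is a relation by itself;
-- otherwise a nonzero entry serves as pivot, its column is cleared from the other rows and dropped,
-- and a relation among the reduced rows is lifted back.
kernel : ∀ k (M : Fin (suc k) → Fin k → ℚ) →
  Σ (Fin (suc k) → ℚ) λ μ →
    (∃ λ j → μ j ≢ 0ℚ) × (∀ l → sumℚ (λ j → μ j * M j l) ≡ 0ℚ)
kernel zero M = (λ _ → 1ℚ) , (zero , λ ()) , λ ()
kernel (suc k) M with Fin.any? (λ l → ¬? (M zero l ℚ.≟ 0ℚ))
... | no row-zero = unit zero , (zero , λ ()) , λ l → trans (dot-unitˡ zero (λ j → M j l)) (zero-entry l)
  where
  zero-entry : ∀ l → M zero l ≡ 0ℚ
  zero-entry l with M zero l ℚ.≟ 0ℚ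
  ... | yes p = p
  ... | no ¬p = contradiction (l , ¬p) row-zero
... | yes (l , pivot≢0) with kernel k (λ r c → M zero l * M (suc r) (punchIn l c) - M (suc r) l * M zero (punchIn l c))
... | μ , (r , μr≢0) , vanish = ν , (suc r , νr≢0) , column
  where
  a = M zero l
  ν : Fin (suc (suc k)) → ℚ
  -- Chosen so that the pivot column cancels once the other rows are weighted by `a * μ r`.
  ν zero    = - sumℚ (λ r → μ r * M (suc r) l)
  ν (suc r) = a * μ r
  νr≢0 : a * μ r ≢ 0ℚ
  νr≢0 eq = μr≢0 (*-cancel-0 pivot≢0 eq)
  lem : ∀ a b m x y → m * (a * x - y * b) ≡ a * m * x + (- b) * (m * y)
  lem = solve-∀ ringℚ
  lem₂ : ∀ u b v → u + (- b) * v ≡ (- v) * b + u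
  lem₂ = solve-∀ ringℚ
  eliminated : ∀ c → sumℚ (λ r → μ r * (a * M (suc r) c - M (suc r) l * M zero c)) ≡ sumℚ (λ j → ν j * M j c)
  eliminated c = trans (sum-cong (λ r → lem a (M zero c) (μ r) (M (suc r) c) (M (suc r) l)))
    (trans (sum-+ (λ r → a * μ r * M (suc r) c) (λ r → (- M zero c) * (μ r * M (suc r) l)))
    (trans (cong (sumℚ (λ r → a * μ r * M (suc r) c) +_) (sum-*ˡ (- M zero c) (λ r → μ r * M (suc r) l)))
      (lem₂ (sumℚ (λ r → a * μ r * M (suc r) c)) (M zero c) (sumℚ (λ r → μ r * M (suc r) l)))))
  lem₃ : ∀ m x y → m * (x * y - y * x) ≡ 0ℚ
  lem₃ = solve-∀ ringℚ
  column : ∀ c → sumℚ (λ j → ν j * M j c) ≡ 0ℚ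
  column c with l Fin.≟ c
  ... | yes refl = trans (sym (eliminated l)) (sum-zero (λ r → lem₃ (μ r) a (M (suc r) l)))
  ... | no l≢c   = trans (sym (eliminated c))
    (trans (sum-cong (λ r → cong (λ c → μ r * (a * M (suc r) c - M (suc r) l * M zero c)) (sym (Fin.punchIn-punchOut l≢c))))
      (vanish (punchOut l≢c)))

-- The coefficients of the points with respect to the basis form a matrix with one more row than
-- columns, and a relation between its rows is a relation between the points.
too-many : ∀ {n} {A : PointSet n} {k} → Basis A k →
  (q : Fin (suc k) → Point n) → (∀ j → A (q j)) → ¬ LinIndep (hom ∘ q)
too-many {k = k} B q q∈A q-indep with kernel k (λ j → proj₁ (span B (q j) (q∈A j)))
... | μ , (j , μj≢0) , vanish = μj≢0 (q-indep μ dependent j)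
  where
  M = λ j → proj₁ (span B (q j) (q∈A j))
  dependent : ∀ i → comb μ (hom ∘ q) i ≡ 0ℚ
  dependent i = trans (sum-cong (λ j → cong (μ j *_) (sym (proj₂ (span B (q j) (q∈A j)) i))))
    (trans (comb-comb μ M (hom ∘ pt B) i)
      (sum-zero (λ r → trans (cong (_* hom (pt B r) i) (vanish r)) (ℚ.*-zeroˡ (hom (pt B r) i)))))

affine⇒linear : ∀ {n k} (p : Fin k → Point n) → AffinelyIndependent p → LinIndep (hom ∘ p)
affine⇒linear p ind μ eq = ind μ (trans (sym (sum-*1 μ)) (eq zero)) (eq ∘ suc)

linear⇒affine : ∀ {n k} (p : Fin k → Point n) → LinIndep (hom ∘ p) → AffinelyIndependent p
linear⇒affine p ind μ s eq = ind μ λ where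
  zero    → trans (sum-*1 μ) s
  (suc i) → eq i

Basis⇒AffRank : ∀ {n} {A : PointSet n} {k} → Basis A k → AffRank A k
Basis⇒AffRank B = (pt B , mem B , linear⇒affine (pt B) (indep B)) ,
  λ p p∈A ind → too-many B p p∈A (affine⇒linear p ind)

extendZero : ∀ {m} d → (Fin m → ℚ) → Fin (m ℕ.+ d) → ℚ
extendZero {m} d μ j with splitAt m j
... | inj₁ i = μ i
... | inj₂ _ = 0ℚ

extendZero-↑ˡ : ∀ {m} d (μ : Fin m → ℚ) j → extendZero d μ (j ↑ˡ d) ≡ μ j
extendZero-↑ˡ {m} d μ j rewrite Fin.splitAt-↑ˡ m j d = refl

extendZero-↑ʳ : ∀ {m} d (μ : Fin m → ℚ) j → extendZero d μ (m ↑ʳ j) ≡ 0ℚ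
extendZero-↑ʳ {m} d μ j rewrite Fin.splitAt-↑ʳ m d j = refl

indep-↑ˡ : ∀ {n m} d (v : Fin (m ℕ.+ d) → Point n) → LinIndep v → LinIndep (v ∘ (_↑ˡ d))
indep-↑ˡ {m = m} d v ind μ eq j = trans (sym (extendZero-↑ˡ d μ j)) (ind (extendZero d μ) zero-comb (j ↑ˡ d))
  where
  zero-comb : ∀ i → comb (extendZero d μ) v i ≡ 0ℚ
  zero-comb i = trans (sum-split m (λ j → extendZero d μ j * v j i))
    (trans (cong₂ _+_
      (trans (sum-cong (λ j → cong (_* v (j ↑ˡ d) i) (extendZero-↑ˡ d μ j))) (eq i))
      (sum-zero (λ j → trans (cong (_* v (m ↑ʳ j) i) (extendZero-↑ʳ d μ j)) (ℚ.*-zeroˡ (v (m ↑ʳ j) i)))))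
    (ℚ.+-identityʳ 0ℚ))

indep-≤ : ∀ {n} (A : PointSet n) {k l} → AffRank A k → AffRank A l → k ℕ.≤ l
indep-≤ A {k} {l} ((p , p∈A , ind) , _) (_ , max) with k ℕ.≤? l
... | yes k≤l = k≤l
... | no k≰l with ℕ.m≤n⇒∃[o]m+o≡n (ℕ.≰⇒> k≰l)
...   | d , refl = contradiction
          (linear⇒affine (p ∘ (_↑ˡ d)) (indep-↑ˡ d (hom ∘ p) (affine⇒linear p ind)))
          (max (p ∘ (_↑ˡ d)) (p∈A ∘ (_↑ˡ d)))

AffRank-unique : ∀ {n} (A : PointSet n) {k l} → AffRank A k → AffRank A l → k ≡ l
AffRank-unique A a b = ℕ.≤-antisym (indep-≤ A a b) (indep-≤ A b a)

Basis-cong : ∀ {n} (A B : PointSet n) {k} → SameSet A B → Basis A k → Basis B k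
Basis-cong A B same b = record
  { pt = pt b ; mem = λ j → Equivalence.to (same (pt b j)) (mem b j) ; indep = indep b
  ; span = λ x x∈B → span b x (Equivalence.from (same x) x∈B) }

Basis-unique : ∀ {n} (A B : PointSet n) {k l} → SameSet A B → Basis A k → Basis B l → k ≡ l
Basis-unique A B same a b = AffRank-unique B (Basis⇒AffRank (Basis-cong A B same a)) (Basis⇒AffRank b)

span-sum : ∀ {n k} {p : Fin k → Point n} {x : Point n} (s : Combination (hom ∘ p) (hom x)) → sumℚ (proj₁ s) ≡ 1ℚ
span-sum (μ , eq) = trans (sym (sum-*1 μ)) (eq zero)

-- The coefficients of an affine combination sum to 1, so an affine equation passes from the basis
-- to its whole hull. This is what makes inclusion between faces decidable.
hyperplane-hull : ∀ {n} {A : PointSet n} {k} (B : Basis A k) (c : Point n) δ →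
  (∀ j → dot c (pt B j) ≡ δ) → ∀ x → A x → dot c x ≡ δ
hyperplane-hull B c δ eq x x∈A with span B x x∈A
... | s@(μ , comb≡x) = begin
  dot c x                ≡⟨ dot-congʳ c (λ i → sym (comb≡x (suc i))) ⟩
  dot c (comb μ (pt B))  ≡⟨ dot-comb-const c δ μ (pt B) eq ⟩
  δ * sumℚ μ             ≡⟨ cong (δ *_) (span-sum {p = pt B} {x} s) ⟩
  δ * 1ℚ                 ≡⟨ ℚ.*-identityʳ δ ⟩
  δ                      ∎
  where open ≡-Reasoning

insert : ∀ {X : Set} {k} → Fin (suc k) → X → (Fin k → X) → Fin (suc k) → X
insert l a μ j with l Fin.≟ j
... | yes _  = a
... | no l≢j = μ (punchOut l≢j)

insert-same : ∀ {X : Set} {k} l (a : X) (μ : Fin k → X) → insert l a μ l ≡ a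
insert-same l a μ with l Fin.≟ l
... | yes _  = refl
... | no l≢l = contradiction refl l≢l

insert-punchIn : ∀ {X : Set} {k} l (a : X) (μ : Fin k → X) j → insert l a μ (punchIn l j) ≡ μ j
insert-punchIn l a μ j with l Fin.≟ punchIn l j
... | yes eq = contradiction (sym eq) (Fin.punchInᵢ≢i l j)
... | no l≢j = cong μ (trans (Fin.punchOut-cong l refl) (Fin.punchOut-punchIn l))

comb-insert : ∀ {n k} l a (μ : Fin k → ℚ) (v : Fin (suc k) → Point n) i →
  comb (insert l a μ) v i ≡ a * v l i + comb μ (v ∘ punchIn l) i
comb-insert l a μ v i = trans (sum-punchIn (λ j → insert l a μ j * v j i) l)
  (cong₂ _+_ (cong (_* v l i) (insert-same l a μ))
    (sum-cong (λ j → cong (_* v (punchIn l j) i) (insert-punchIn l a μ j))))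

_▸_ : ∀ {k} {X : Set} → X → (Fin k → X) → Fin (suc k) → X
(x ▸ f) zero    = x
(x ▸ f) (suc i) = f i

-- Steinitz exchange: the coefficients of `a` sum to 1, so one of them is nonzero and its basis
-- point can give way to `a`. It supplies bases that start at the origin.
exchange : ∀ {n} {A : PointSet n} {k} → Basis A k → ∀ a → A a →
  Σ ℕ λ l → k ≡ suc l × Σ (Basis A (suc l)) λ B → pt B zero ≡ a
exchange {k = zero} B a a∈A = contradiction (proj₂ (span B a a∈A) zero) (λ ())
exchange {n} {A} {suc k} B a a∈A with span B a a∈A
... | ν , ν-eq with Fin.any? (λ l → ¬? (ν l ℚ.≟ 0ℚ))
...   | no all-zero = contradiction (trans (sym (ν-eq zero)) (trans (sum-*1 ν) (sum-zero zeros))) (λ ())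
  where
  zeros : ∀ l → ν l ≡ 0ℚ
  zeros l with ν l ℚ.≟ 0ℚ
  ... | yes p = p
  ... | no ¬p = contradiction (l , ¬p) all-zero
...   | yes (l , νl≢0) = k , refl , record
  { pt = q ; mem = λ { zero → a∈A ; (suc j) → mem B (punchIn l j) }
  ; indep = q-indep ; span = q-span } , refl
  where
  q = a ▸ (pt B ∘ punchIn l)
  v = hom ∘ pt B
  q-indep : LinIndep (hom ∘ q)
  q-indep μ eq = λ { zero → μ₀≡0 ; (suc j) → rest j }
    where
    ρ : Fin (suc k) → ℚ
    ρ j = μ zero * ν j + insert l 0ℚ (μ ∘ suc) j
    lem : ∀ a b c d → (a * b + c) * d ≡ a * (b * d) + c * d
    lem = solve-∀ ringℚ
    ρ-comb : ∀ i → comb ρ v i ≡ 0ℚ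
    ρ-comb i = begin
      comb ρ v i
        ≡⟨ sum-cong (λ j → lem (μ zero) (ν j) (insert l 0ℚ (μ ∘ suc) j) (v j i)) ⟩
      sumℚ (λ j → μ zero * (ν j * v j i) + insert l 0ℚ (μ ∘ suc) j * v j i)
        ≡⟨ sum-+ (λ j → μ zero * (ν j * v j i)) (λ j → insert l 0ℚ (μ ∘ suc) j * v j i) ⟩
      sumℚ (λ j → μ zero * (ν j * v j i)) + comb (insert l 0ℚ (μ ∘ suc)) v i
        ≡⟨ cong₂ _+_ (trans (sum-*ˡ (μ zero) (λ j → ν j * v j i)) (cong (μ zero *_) (ν-eq i)))
             (trans (comb-insert l 0ℚ (μ ∘ suc) v i) (trans (cong (_+ comb (μ ∘ suc) (v ∘ punchIn l) i) (ℚ.*-zeroˡ (v l i)))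
               (ℚ.+-identityˡ _))) ⟩
      μ zero * hom a i + comb (μ ∘ suc) (v ∘ punchIn l) i
        ≡⟨ eq i ⟩
      0ℚ ∎
      where open ≡-Reasoning
    ρ-zero = indep B ρ ρ-comb
    μ₀≡0 : μ zero ≡ 0ℚ
    μ₀≡0 = *-cancel-0 νl≢0 (trans (ℚ.*-comm (ν l) (μ zero)) (trans (sym (ℚ.+-identityʳ _))
      (trans (cong (μ zero * ν l +_) (sym (insert-same l 0ℚ (μ ∘ suc)))) (ρ-zero l))))
    rest : ∀ j → μ (suc j) ≡ 0ℚ
    rest j = begin
      μ (suc j)                                  ≡⟨ sym (ℚ.+-identityˡ _) ⟩
      0ℚ + μ (suc j)                             ≡⟨ cong₂ _+_
        (sym (trans (cong (_* ν (punchIn l j)) μ₀≡0) (ℚ.*-zeroˡ (ν (punchIn l j))))) (sym (insert-punchIn l 0ℚ (μ ∘ suc) j)) ⟩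
      ρ (punchIn l j)                            ≡⟨ ρ-zero (punchIn l j) ⟩
      0ℚ                                         ∎
      where open ≡-Reasoning
  b = proj₁ (inverse νl≢0)
  q-span : ∀ x → A x → Combination (hom ∘ q) (hom x)
  q-span x x∈A with span B x x∈A
  ... | μ , μ-eq = μ′ , λ i → trans (eq i) (μ-eq i)
    where
    t = μ l * b
    μ′ : Fin (suc k) → ℚ
    μ′ zero    = t
    μ′ (suc j) = μ (punchIn l j) + (- t) * ν (punchIn l j)
    lem : ∀ m t n w → (m + (- t) * n) * w ≡ m * w + (- t) * (n * w)
    lem = solve-∀ ringℚ
    lem₂ : ∀ m b n w x y → m * b * (n * w + y) + (x + (- (m * b)) * y) ≡ m * (b * n) * w + x
    lem₂ = solve-∀ ringℚ
    eq : ∀ i → comb μ′ (hom ∘ q) i ≡ comb μ v i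
    eq i = begin
      t * hom a i + comb (μ′ ∘ suc) w i
        ≡⟨ cong₂ _+_ (cong (t *_) (trans (sym (ν-eq i)) (sum-punchIn (λ j → ν j * v j i) l)))
           (trans (sum-cong (λ j → lem (μ (punchIn l j)) t (ν (punchIn l j)) (w j i)))
           (trans (sum-+ (λ j → μ (punchIn l j) * w j i) (λ j → (- t) * (ν (punchIn l j) * w j i)))
             (cong (comb (μ ∘ punchIn l) w i +_) (sum-*ˡ (- t) (λ j → ν (punchIn l j) * w j i))))) ⟩
      t * (ν l * v l i + comb (ν ∘ punchIn l) w i) + (comb (μ ∘ punchIn l) w i + (- t) * comb (ν ∘ punchIn l) w i)
        ≡⟨ lem₂ (μ l) b (ν l) (v l i) (comb (μ ∘ punchIn l) w i) (comb (ν ∘ punchIn l) w i) ⟩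
      μ l * (b * ν l) * v l i + comb (μ ∘ punchIn l) w i
        ≡⟨ cong (λ z → z * v l i + comb (μ ∘ punchIn l) w i) (trans (cong (μ l *_) (proj₂ (inverse νl≢0))) (ℚ.*-identityʳ (μ l))) ⟩
      μ l * v l i + comb (μ ∘ punchIn l) w i
        ≡⟨ sym (sum-punchIn (λ j → μ j * v j i) l) ⟩
      comb μ v i ∎
      where
      open ≡-Reasoning
      w = v ∘ punchIn l

-- Faces with a rank

record RankedFace {n : ℕ} (S : PointSet n) : Set where
  constructor ranked
  field
    fc    : Face S
    rank  : ℕ
    basis : Basis (faceSet fc) rank

open RankedFace
open Face

points : ∀ {n} {S : PointSet n} → RankedFace S → PointSet n
points F = faceSet (fc F)

infix 4 _≋_ _⊑_

_⊑_ _≋_ : ∀ {n} {S : PointSet n} → RankedFace S → RankedFace S → Set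
F ⊑ G = ∀ x → points F x → points G x
F ≋ G = SameSet (points F) (points G)

≋-intro : ∀ {n} {S : PointSet n} {F G : RankedFace S} → F ⊑ G → G ⊑ F → F ≋ G
≋-intro F⊑G G⊑F x = mk⇔ (F⊑G x) (G⊑F x)

≋⇒⊑ : ∀ {n} {S : PointSet n} {F G : RankedFace S} → F ≋ G → F ⊑ G
≋⇒⊑ F≋G x = Equivalence.to (F≋G x)

≋-sym : ∀ {n} {S : PointSet n} (F G : RankedFace S) → F ≋ G → G ≋ F
≋-sym F G F≋G x = mk⇔ (Equivalence.from (F≋G x)) (Equivalence.to (F≋G x))

≋-trans : ∀ {n} {S : PointSet n} (F G H : RankedFace S) → F ≋ G → G ≋ H → F ≋ H
≋-trans F G H F≋G G≋H x =
  mk⇔ (Equivalence.to (G≋H x) ∘ Equivalence.to (F≋G x)) (Equivalence.from (F≋G x) ∘ Equivalence.from (G≋H x))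

≋-rank : ∀ {n} {S : PointSet n} (F G : RankedFace S) → F ≋ G → rank F ≡ rank G
≋-rank F G F≋G = Basis-unique (points F) (points G) F≋G (basis F) (basis G)

⊑-by-basis : ∀ {n} {S : PointSet n} (F G : RankedFace S) →
  (∀ j → dot (normal (fc G)) (pt (basis F) j) ≡ rhs (fc G)) → F ⊑ G
⊑-by-basis F G on x x∈F = proj₁ x∈F , hyperplane-hull (basis F) (normal (fc G)) (rhs (fc G)) on x x∈F

_⊑?_ : ∀ {n} {S : PointSet n} (F G : RankedFace S) → Dec (F ⊑ G)
F ⊑? G = map′ (⊑-by-basis F G) (λ F⊑G j → proj₂ (F⊑G (pt (basis F) j) (mem (basis F) j)))
  (Fin.all? (λ j → dot (normal (fc G)) (pt (basis F) j) ℚ.≟ rhs (fc G)))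

_≋?_ : ∀ {n} {S : PointSet n} (F G : RankedFace S) → Dec (F ≋ G)
F ≋? G = map′ (λ { (a , b) → ≋-intro {F = F} {G} a b })
  (λ e → ≋⇒⊑ {F = F} {G} e , ≋⇒⊑ {F = G} {F} (≋-sym F G e)) (F ⊑? G ×-dec G ⊑? F)

-- Counting only requires that distinct faces have distinct images, so equality of faces is
-- reflected; two inequalities for the same face are allowed different images.
record Embedding {n : ℕ} (S T : PointSet n) : Set where
  field
    embed      : RankedFace S → RankedFace T
    embed-rank : ∀ F → rank (embed F) ≡ rank F
    embed-inj  : ∀ F G → embed F ≋ embed G → F ≋ G

open Embedding

_⨾_ : ∀ {n} {S T U : PointSet n} → Embedding S T → Embedding T U → Embedding S U
e ⨾ f = record
  { embed      = embed f ∘ embed e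
  ; embed-rank = λ F → trans (embed-rank f (embed e F)) (embed-rank e F)
  ; embed-inj  = λ F G eq → embed-inj e F G (embed-inj f (embed e F) (embed e G) eq) }

Embedding⇒FPolyLe : ∀ {n} {S T : PointSet n} → (∀ F → Σ ℕ (Basis (faceSet {S = S} F))) →
  Embedding S T → FPolyLe S T
Embedding⇒FPolyLe {S = S} {T} hasBasis e k m (fs , rk , distinct) =
  (λ j → fc (embed e (F j))) ,
  (λ j → subst (AffRank (points (embed e (F j)))) (trans (embed-rank e (F j))
      (AffRank-unique (faceSet (fs j)) (Basis⇒AffRank (basis (F j))) (rk j)))
    (Basis⇒AffRank (basis (embed e (F j))))) ,
  λ i j i≢j same → distinct i j i≢j (embed-inj e (F i) (F j) same)
  where
  F : Fin m → RankedFace S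
  F j = ranked (fs j) (proj₁ (hasBasis (fs j))) (proj₂ (hasBasis (fs j)))

-- Affine equivalences

AffineForm : ∀ {n} → (Point n → ℚ) → Set
AffineForm {n} h = Σ (Point n) λ a → Σ ℚ λ b → ∀ x → h x ≡ b + dot a x

coord-affine : ∀ {n} (i : Fin n) → AffineForm (λ x → x i)
coord-affine i = unit i , 0ℚ , λ x → sym (trans (ℚ.+-identityˡ _) (dot-unitˡ i x))

const-affine : ∀ {n} b → AffineForm {n} (λ _ → b)
const-affine b = (λ _ → 0ℚ) , b , λ x → sym (trans (cong (b +_) (dot-0ˡ x (λ _ → refl))) (ℚ.+-identityʳ b))

+-affine : ∀ {n} {g h : Point n → ℚ} → AffineForm g → AffineForm h → AffineForm (λ x → g x + h x)
+-affine (a , b , eq) (a′ , b′ , eq′) = (λ i → a i + a′ i) , b + b′ , λ x →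
  trans (cong₂ _+_ (eq x) (eq′ x))
    (trans (lem b b′ (dot a x) (dot a′ x)) (cong (b + b′ +_) (sym (dot-+ˡ a a′ x))))
  where
  lem : ∀ b b′ u v → b + u + (b′ + v) ≡ b + b′ + (u + v)
  lem = solve-∀ ringℚ

*-affine : ∀ {n} {h : Point n → ℚ} t → AffineForm h → AffineForm (λ x → t * h x)
*-affine t (a , b , eq) = (λ i → t * a i) , t * b , λ x →
  trans (cong (t *_) (eq x)) (trans (ℚ.*-distribˡ-+ t b (dot a x)) (cong (t * b +_) (sym (dot-*ˡ a x t))))

affine-cong : ∀ {n} {g h : Point n → ℚ} → (∀ x → h x ≡ g x) → AffineForm g → AffineForm h
affine-cong e (a , b , eq) = a , b , λ x → trans (e x) (eq x)

sub-affine : ∀ {n} {g h : Point n → ℚ} → AffineForm g → AffineForm h → AffineForm (λ x → g x - h x)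
sub-affine {g = g} {h} p q = affine-cong (λ x → lem (g x) (h x)) (+-affine p (*-affine (- 1ℚ) q))
  where
  lem : ∀ u v → u - v ≡ u + (- 1ℚ) * v
  lem = solve-∀ ringℚ

sum-affine : ∀ {n k} {h : Fin k → Point n → ℚ} → (∀ j → AffineForm (h j)) → AffineForm (λ x → sumℚ (λ j → h j x))
sum-affine {k = zero}  p = const-affine 0ℚ
sum-affine {k = suc k} p = +-affine (p zero) (sum-affine (p ∘ suc))

-- The constant term is multiplied by the sum of the coefficients, which is the homogenising
-- coordinate: 1 for affine combinations, as in `affine-span`, and 0 for dependencies, as in
-- `affine-indep`.
affine-comb : ∀ {n k} {h : Point n → ℚ} (H : AffineForm h) (μ : Fin k → ℚ) (p : Fin k → Point n) →
  sumℚ (λ j → μ j * h (p j)) ≡ proj₁ (proj₂ H) * comb μ (hom ∘ p) zero + dot (proj₁ H) (comb μ p)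
affine-comb (a , b , eq) μ p = trans (sum-cong (λ j → trans (cong (μ j *_) (eq (p j))) (lem (μ j) b (dot a (p j)))))
  (trans (sum-+ (λ j → b * (μ j * 1ℚ)) (λ j → μ j * dot a (p j)))
    (cong₂ _+_ (sum-*ˡ b (λ j → μ j * 1ℚ)) (sym (dot-comb a μ p))))
  where
  lem : ∀ m b d → m * (b + d) ≡ b * (m * 1ℚ) + m * d
  lem = solve-∀ ringℚ

affine-span : ∀ {n k} {h : Point n → ℚ} → AffineForm h → {p : Fin k → Point n} {x : Point n} →
  (s : Combination (hom ∘ p) (hom x)) → sumℚ (λ j → proj₁ s j * h (p j)) ≡ h x
affine-span {h = h} H@(a , b , eq) {p} {x} (μ , μ-eq) = trans (affine-comb H μ p)
  (trans (cong₂ _+_ (trans (cong (b *_) (μ-eq zero)) (ℚ.*-identityʳ b)) (dot-congʳ a (μ-eq ∘ suc))) (sym (eq x)))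

affine-indep : ∀ {n k} {h : Point n → ℚ} → AffineForm h → (p : Fin k → Point n) (μ : Fin k → ℚ) →
  (∀ i → comb μ (hom ∘ p) i ≡ 0ℚ) → sumℚ (λ j → μ j * h (p j)) ≡ 0ℚ
affine-indep {h = h} H@(a , b , eq) p μ eq0 = trans (affine-comb H μ p)
  (trans (cong₂ _+_ (trans (cong (b *_) (eq0 zero)) (ℚ.*-zeroʳ b)) (dot-0ʳ a (eq0 ∘ suc))) (ℚ.+-identityʳ 0ℚ))

record AffineEquiv {n : ℕ} (S T : PointSet n) : Set where
  field
    to from     : Point n → Point n
    to-affine   : ∀ i → AffineForm (λ x → to x i)
    from-affine : ∀ i → AffineForm (λ y → from y i)
    to-mem      : ∀ x → S x → T (to x)
    from-mem    : ∀ y → T y → S (from y)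
    from-to     : ∀ x → S x → ∀ i → from (to x) i ≡ x i
    to-from     : ∀ y → T y → ∀ i → to (from y) i ≡ y i

dot-affine : ∀ {n m} (c : Point m) {f : Point n → Point m} → (∀ i → AffineForm (λ x → f x i)) →
  AffineForm (λ x → dot c (f x))
dot-affine c fa = sum-affine (λ i → *-affine (c i) (fa i))

formFace : ∀ {n} {S : PointSet n} {h : Point n → ℚ} → AffineForm h → ∀ δ → (∀ x → S x → h x ≤ δ) → Face S
formFace {h = h} (a , b , eq) δ v = face a (δ - b) λ x x∈S → ≤-add (subst (0ℚ ≤_)
  (trans (cong (λ z → δ - z) (eq x)) (lem δ b (dot a x))) (≤-sub (v x x∈S)))
  where
  lem : ∀ x y z → x - (y + z) ≡ x - y - z
  lem = solve-∀ ringℚ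

formFace-on : ∀ {n} {S : PointSet n} {h : Point n → ℚ} (H : AffineForm h) δ (v : ∀ x → S x → h x ≤ δ) x →
  S x → h x ≡ δ → faceSet (formFace H δ v) x
formFace-on (a , b , eq) δ v x x∈S hx≡δ = x∈S , trans (lem b (dot a x)) (cong (_- b) (trans (sym (eq x)) hx≡δ))
  where
  lem : ∀ b d → d ≡ b + d - b
  lem = solve-∀ ringℚ

formFace-form : ∀ {n} {S : PointSet n} {h : Point n → ℚ} (H : AffineForm h) δ (v : ∀ x → S x → h x ≤ δ) x →
  faceSet (formFace H δ v) x → h x ≡ δ
formFace-form (a , b , eq) δ v x (_ , on) = trans (eq x) (trans (cong (b +_) on) (lem b δ))
  where
  lem : ∀ b d → b + (d - b) ≡ d
  lem = solve-∀ ringℚ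

-- The inequality is pulled back along `from` and the basis pushed forward along `to`. Dependencies
-- and affine combinations survive affine maps, so the same number of points remains a basis.
transport : ∀ {n} {S T : PointSet n} → AffineEquiv S T → Embedding S T
transport {n} {S} {T} e = record { embed = image ; embed-rank = λ _ → refl ; embed-inj = inj }
  where
  open AffineEquiv e
  form : (F : Face S) → AffineForm (λ y → dot (normal F) (from y))
  form F = dot-affine (normal F) from-affine
  form-valid : ∀ F y → T y → dot (normal F) (from y) ≤ rhs F
  form-valid F y y∈T = valid F (from y) (from-mem y y∈T)
  img : Face S → Face T
  img F = formFace (form F) (rhs F) (form-valid F)
  push : ∀ F x → faceSet F x → faceSet (img F) (to x)
  push F x (x∈S , on) = formFace-on (form F) (rhs F) (form-valid F) (to x) (to-mem x x∈S)
    (trans (dot-congʳ (normal F) (from-to x x∈S)) on)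
  pull : ∀ F y → faceSet (img F) y → faceSet F (from y)
  pull F y y∈ = from-mem y (proj₁ y∈) , formFace-form (form F) (rhs F) (form-valid F) y y∈
  image : RankedFace S → RankedFace T
  image (ranked F k B) = ranked (img F) k record
    { pt    = to ∘ pt B
    ; mem   = λ j → push F (pt B j) (mem B j)
    ; indep = λ μ eq → indep B μ λ where
        zero    → eq zero
        (suc i) → trans (sum-cong (λ j → cong (μ j *_) (sym (from-to (pt B j) (proj₁ (mem B j)) i))))
                    (affine-indep (from-affine i) (to ∘ pt B) μ eq)
    ; span  = λ y y∈ → let s = span B (from y) (pull F y y∈) in proj₁ s , λ where
        zero    → proj₂ s zero
        (suc i) → trans (affine-span (to-affine i) {pt B} {from y} s) (to-from y (proj₁ y∈) i) }
  half : ∀ F G → image F ⊑ image G → F ⊑ G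
  half F G sub x x∈F = proj₁ x∈F , trans (sym (dot-congʳ (normal (fc G)) (from-to x (proj₁ x∈F))))
    (proj₂ (pull (fc G) (to x) (sub (to x) (push (fc F) x x∈F))))
  inj : ∀ F G → image F ≋ image G → F ≋ G
  inj F G eq = ≋-intro {F = F} {G} (half F G (≋⇒⊑ {F = image F} {image G} eq))
    (half G F (≋⇒⊑ {F = image G} {image F} (≋-sym (image F) (image G) eq)))

-- Subtracting matched families

-- A stage of the subtraction at which the values `κ x` with `x` in `xs` are free. The values at the
-- corresponding `ι x` may by then have been handed to other faces, so injectivity is claimed only
-- away from these.
record Avoiding {n : ℕ} {S T : PointSet n} {X : Set}
    (ι : X → RankedFace S) (κ : X → RankedFace T) (xs : List X) : Set where
  field
    embed      : RankedFace S → RankedFace T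
    embed-rank : ∀ F → rank (embed F) ≡ rank F
    embed-inj  : ∀ F G → All (λ x → ¬ F ≋ ι x) xs → All (λ x → ¬ G ≋ ι x) xs → embed F ≋ embed G → F ≋ G
    avoids     : ∀ F → All (λ x → ¬ F ≋ ι x) xs → All (λ x → ¬ embed F ≋ κ x) xs

-- To free one more value κ x, the face that was sent to it takes over the image of ι x,
-- which is no longer needed.
avoid-one : ∀ {n} {S T : PointSet n} {X : Set} (ι : X → RankedFace S) (κ : X → RankedFace T) {xs x} →
  rank (ι x) ≡ rank (κ x) → All (λ y → ¬ ι x ≋ ι y) xs → Avoiding ι κ xs → Avoiding ι κ (x ∷ xs)
avoid-one {S = S} {T} ι κ {xs} {x} rk ιx-free prev = record
  { embed      = λ F → ψ F (φ F ≋? κ x)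
  ; embed-rank = λ F → ψ-rank F (φ F ≋? κ x)
  ; embed-inj  = λ { F G (F≢x ∷ F-free) (G≢x ∷ G-free) →
      ψ-inj F G F≢x F-free G≢x G-free (φ F ≋? κ x) (φ G ≋? κ x) }
  ; avoids     = λ { F (F≢x ∷ F-free) → ψ-avoids F F≢x F-free (φ F ≋? κ x) } }
  where
  open Avoiding prev renaming (embed to φ; embed-rank to φ-rank; embed-inj to φ-inj; avoids to φ-avoids)
  ψ : (F : RankedFace S) → Dec (φ F ≋ κ x) → RankedFace T
  ψ F (yes _) = φ (ι x)
  ψ F (no _)  = φ F
  ψ-rank : ∀ F d → rank (ψ F d) ≡ rank F
  ψ-rank F (yes eq) = trans (φ-rank (ι x)) (trans rk (trans (sym (≋-rank (φ F) (κ x) eq)) (φ-rank F)))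
  ψ-rank F (no _)   = φ-rank F
  ψ-inj : ∀ F G → ¬ F ≋ ι x → All (λ y → ¬ F ≋ ι y) xs → ¬ G ≋ ι x → All (λ y → ¬ G ≋ ι y) xs →
    ∀ d d′ → ψ F d ≋ ψ G d′ → F ≋ G
  ψ-inj F G _ F-free _ G-free (yes p) (yes q) _ =
    φ-inj F G F-free G-free (≋-trans (φ F) (κ x) (φ G) p (≋-sym (φ G) (κ x) q))
  ψ-inj F G _ _ G≢x G-free (yes _) (no _) eq =
    contradiction (≋-sym (ι x) G (φ-inj (ι x) G ιx-free G-free eq)) G≢x
  ψ-inj F G F≢x F-free _ _ (no _) (yes _) eq = contradiction (φ-inj F (ι x) F-free ιx-free eq) F≢x
  ψ-inj F G _ F-free _ G-free (no _) (no _) eq = φ-inj F G F-free G-free eq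
  ψ-avoids : ∀ F → ¬ F ≋ ι x → All (λ y → ¬ F ≋ ι y) xs → ∀ d → All (λ y → ¬ ψ F d ≋ κ y) (x ∷ xs)
  ψ-avoids F _ F-free (no ¬p) = ¬p ∷ φ-avoids F F-free
  ψ-avoids F F≢x F-free (yes p) = (λ q → F≢x (φ-inj F (ι x) F-free ιx-free
      (≋-trans (φ F) (κ x) (φ (ι x)) p (≋-sym (φ (ι x)) (κ x) q)))) ∷ φ-avoids (ι x) ιx-free

-- The alternating paths of the usual subtraction argument are followed implicitly, one reassignment
-- per value. Uniqueness of the list ensures that `ι x` is not among the faces removed before, so
-- that its image is still available.
avoiding : ∀ {n} {S T : PointSet n} {X : Set} (ι : X → RankedFace S) (κ : X → RankedFace T) →
  Embedding S T → (∀ x → rank (ι x) ≡ rank (κ x)) → (∀ x y → ι x ≋ ι y → x ≡ y) →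
  ∀ {xs} → Unique xs → Avoiding ι κ xs
avoiding ι κ e rk ι-inj [] = record
  { embed = embed e ; embed-rank = embed-rank e
  ; embed-inj = λ F G _ _ → embed-inj e F G ; avoids = λ _ _ → [] }
avoiding ι κ e rk ι-inj {x ∷ _} (x∉xs ∷ unique) = avoid-one ι κ (rk x)
  (All.map (λ {y} x≢y eq → x≢y (ι-inj x y eq)) x∉xs) (avoiding ι κ e rk ι-inj unique)

-- Subsets are vectors here because membership in a list and uniqueness refer to propositional
-- equality, which for functions would need extensionality.
subsets : ∀ n → List (Vec Bool n)
subsets zero    = [] ∷ []
subsets (suc n) = map (true ∷_) (subsets n) ++ map (false ∷_) (subsets n)

∈-subsets : ∀ {n} (v : Vec Bool n) → v ∈ subsets n
∈-subsets []          = here refl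
∈-subsets (true ∷ v)  = ∈.∈-++⁺ˡ (∈.∈-map⁺ (true ∷_) (∈-subsets v))
∈-subsets {suc n} (false ∷ v) = ∈.∈-++⁺ʳ (map (true ∷_) (subsets n)) (∈.∈-map⁺ (false ∷_) (∈-subsets v))

subsets-unique : ∀ n → Unique (subsets n)
subsets-unique zero    = [] ∷ []
subsets-unique (suc n) = Unique.++⁺ (Unique.map⁺ Vec.∷-injectiveʳ (subsets-unique n))
  (Unique.map⁺ Vec.∷-injectiveʳ (subsets-unique n)) disjoint
  where
  disjoint : ∀ {v} → v ∈ map (true ∷_) (subsets n) × v ∈ map (false ∷_) (subsets n) → ⊥
  disjoint (p , q) with ∈.∈-map⁻ (true ∷_) p | ∈.∈-map⁻ (false ∷_) q
  ... | _ , _ , refl | _ , _ , ()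

-- Wedges of polytopes at a common vertex

left : ∀ {X : Set} m {n} → (Fin (m ℕ.+ n) → X) → Fin m → X
left m {n} z i = z (i ↑ˡ n)

right : ∀ {X : Set} m {n} → (Fin (m ℕ.+ n) → X) → Fin n → X
right m z j = z (m ↑ʳ j)

append : ∀ {X : Set} {m n} → (Fin m → X) → (Fin n → X) → Fin (m ℕ.+ n) → X
append {m = m} x y k with splitAt m k
... | inj₁ i = x i
... | inj₂ j = y j

append-l : ∀ {X : Set} {m n} (x : Fin m → X) (y : Fin n → X) i → append x y (i ↑ˡ n) ≡ x i
append-l {m = m} {n} x y i rewrite Fin.splitAt-↑ˡ m i n = refl

append-r : ∀ {X : Set} {m n} (x : Fin m → X) (y : Fin n → X) j → append x y (m ↑ʳ j) ≡ y j
append-r {m = m} {n} x y j rewrite Fin.splitAt-↑ʳ m n j = refl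

split-elim : ∀ m {n} (P : Fin (m ℕ.+ n) → Set) → (∀ i → P (i ↑ˡ n)) → (∀ j → P (m ↑ʳ j)) → ∀ k → P k
split-elim m {n} P l r k with splitAt m k in eq
... | inj₁ i = subst P (trans (cong (join m n) (sym eq)) (Fin.join-splitAt m n k)) (l i)
... | inj₂ j = subst P (trans (cong (join m n) (sym eq)) (Fin.join-splitAt m n k)) (r j)

origin : ∀ {n} → Point n
origin _ = 0ℚ

dot-split : ∀ m {n} (c z : Point (m ℕ.+ n)) → dot c z ≡ dot (left m c) (left m z) + dot (right m c) (right m z)
dot-split m c z = sum-split m (λ i → c i * z i)

dot-split-via : ∀ {m n} (c z : Point (m ℕ.+ n)) {x y} → (∀ i → left m z i ≡ x i) → (∀ j → right m z j ≡ y j) →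
  dot c z ≡ dot (left m c) x + dot (right m c) y
dot-split-via {m} c z l r = trans (dot-split m c z) (cong₂ _+_ (dot-congʳ (left m c) l) (dot-congʳ (right m c) r))

dot-append : ∀ {m n} (c : Point (m ℕ.+ n)) (x : Point m) (y : Point n) →
  dot c (append x y) ≡ dot (left m c) x + dot (right m c) y
dot-append c x y = dot-split-via c (append x y) (append-l x y) (append-r x y)

dot-inl : ∀ {m n} (c : Point (m ℕ.+ n)) (x : Point m) → dot c (append x origin) ≡ dot (left m c) x
dot-inl {m} c x = trans (dot-append c x origin)
  (trans (cong (dot (left m c) x +_) (dot-0ʳ (right m c) (λ _ → refl))) (ℚ.+-identityʳ _))

dot-inr : ∀ {m n} (c : Point (m ℕ.+ n)) (y : Point n) → dot c (append origin y) ≡ dot (right m c) y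
dot-inr {m} c y = trans (dot-append c origin y)
  (trans (cong (_+ dot (right m c) y) (dot-0ʳ (left m c) (λ _ → refl))) (ℚ.+-identityˡ _))

comb-split : ∀ {N} k {l} (μ : Fin (k ℕ.+ l) → ℚ) (v : Fin (k ℕ.+ l) → Point N) i →
  comb μ v i ≡ comb (left k μ) (left k v) i + comb (right k μ) (right k v) i
comb-split k μ v i = sum-split k (λ j → μ j * v j i)

-- `decompose` expresses membership in the convex hull of the two embedded polytopes; the remaining
-- weight 1 - α - β lies on the common vertex.
record Wedge {m n : ℕ} (S : PointSet m) (T : PointSet n) (Z : PointSet (m ℕ.+ n)) : Set where
  field
    origin-l  : S origin
    origin-r  : T origin
    inl       : ∀ x → S x → Z (append x origin)
    inr       : ∀ y → T y → Z (append origin y)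
    decompose : ∀ z → Z z → Σ ℚ λ α → Σ ℚ λ β → Σ (Point m) λ x → Σ (Point n) λ y →
      (0ℚ ≤ α × 0ℚ ≤ β × α + β ≤ 1ℚ) × (S x × T y) ×
      (∀ i → z (i ↑ˡ n) ≡ α * x i) × (∀ j → z (m ↑ʳ j) ≡ β * y j)

-- A part of weight 0 need not lie on the face, and a tight decomposition leaves exactly this
-- alternative.
scaled-span : ∀ {n} {A : PointSet n} {k} (B : Basis A k) (x : Point n) α → (α ≡ 0ℚ ⊎ A x) →
  Σ (Fin k → ℚ) λ μ → ∀ i → comb μ (hom ∘ pt B) i ≡ α * hom x i
scaled-span B x α (inj₁ refl) = (λ _ → 0ℚ) , λ i →
  trans (sum-zero (λ j → ℚ.*-zeroˡ (hom (pt B j) i))) (sym (ℚ.*-zeroˡ (hom x i)))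
scaled-span B x α (inj₂ x∈A) with span B x x∈A
... | μ , eq = (λ j → α * μ j) , λ i → trans (sum-cong (λ j → ℚ.*-assoc α (μ j) (hom (pt B j) i)))
  (trans (sum-*ˡ α (λ j → μ j * hom (pt B j) i)) (cong (α *_) (eq i)))

*-zero-cases : ∀ {a b} → a * b ≡ 0ℚ → a ≡ 0ℚ ⊎ b ≡ 0ℚ
*-zero-cases {a} eq with a ℚ.≟ 0ℚ
... | yes a≡0 = inj₁ a≡0
... | no a≢0  = inj₂ (*-cancel-0 a≢0 eq)

sub-zero : ∀ {a b} → a - b ≡ 0ℚ → b ≡ a
sub-zero {a} {b} eq = trans (sym (ℚ.+-identityʳ b)) (trans (cong (b +_) (sym eq)) (lem a b))
  where
  lem : ∀ a b → b + (a - b) ≡ a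
  lem = solve-∀ ringℚ

rhs-at-origin : ∀ {n} {S : PointSet n} (F : Face S) → S origin → 0ℚ ≤ rhs F
rhs-at-origin F 0∈S = subst (_≤ rhs F) (dot-0ʳ (normal F) (λ _ → refl)) (valid F origin 0∈S)

sub-add : ∀ s → 1ℚ - s + s ≡ 1ℚ
sub-add = solve-∀ ringℚ

append-origin : ∀ m {n} k → append (origin {m}) (origin {n}) k ≡ 0ℚ
append-origin m {n} = split-elim m (λ k → append (origin {m}) (origin {n}) k ≡ 0ℚ)
  (append-l origin origin) (append-r {m = m} origin origin)

spread : ∀ {m n k l} → (Fin k → Point m) → (Fin l → Point n) → Fin (k ℕ.+ l) → Point (m ℕ.+ n)
spread p q = append (λ j → append (p j) origin) (λ j → append origin (q j))

module _ {m n k l : ℕ} (p : Fin k → Point m) (q : Fin l → Point n) (ρ : Fin (k ℕ.+ l) → ℚ) where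

  spread-comb : ∀ i → comb ρ (spread p q) i ≡
    comb (left k ρ) (λ j → append (p j) origin) i + comb (right k ρ) (λ j → append origin (q j)) i
  spread-comb i = trans (comb-split k ρ (spread p q) i) (cong₂ _+_
    (sum-cong (λ j → cong (λ x → ρ (j ↑ˡ l) * x i) (append-l (λ j → append (p j) origin) (λ j → append origin (q j)) j)))
    (sum-cong (λ j → cong (λ x → ρ (k ↑ʳ j) * x i) (append-r (λ j → append (p j) origin) (λ j → append origin (q j)) j))))

  spread-comb-l : ∀ i → comb ρ (spread p q) (i ↑ˡ n) ≡ comb (left k ρ) p i
  spread-comb-l i = trans (spread-comb (i ↑ˡ n)) (trans (cong₂ _+_
    (sum-cong (λ j → cong (ρ (j ↑ˡ l) *_) (append-l (p j) origin i)))
    (sum-zero (λ j → trans (cong (ρ (k ↑ʳ j) *_) (append-l origin (q j) i)) (ℚ.*-zeroʳ (ρ (k ↑ʳ j))))))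
    (ℚ.+-identityʳ _))

  spread-comb-r : ∀ i → comb ρ (spread p q) (m ↑ʳ i) ≡ comb (right k ρ) q i
  spread-comb-r i = trans (spread-comb (m ↑ʳ i)) (trans (cong₂ _+_
    (sum-zero (λ j → trans (cong (ρ (j ↑ˡ l) *_) (append-r (p j) origin i)) (ℚ.*-zeroʳ (ρ (j ↑ˡ l)))))
    (sum-cong (λ j → cong (ρ (k ↑ʳ j) *_) (append-r {m = m} origin (q j) i))))
    (ℚ.+-identityˡ _))

-- The origin is visible only in the homogenising coordinate, and its coefficient is free to make
-- the sum vanish there; the other points are therefore linearly independent as vectors.
based-indep : ∀ {n} {A : PointSet n} {k} (B : Basis A (suc k)) → pt B zero ≡ origin →
  (μ : Fin k → ℚ) → (∀ i → comb μ (pt B ∘ suc) i ≡ 0ℚ) → ∀ j → μ j ≡ 0ℚ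
based-indep B base μ eq j = indep B ((- sumℚ μ) ▸ μ) combo (suc j)
  where
  combo : ∀ i → comb ((- sumℚ μ) ▸ μ) (hom ∘ pt B) i ≡ 0ℚ
  combo zero    = trans (cong₂ _+_ (ℚ.*-identityʳ (- sumℚ μ)) (sum-*1 μ)) (ℚ.+-inverseˡ (sumℚ μ))
  combo (suc i) = trans (cong₂ _+_ (trans (cong (λ x → (- sumℚ μ) * x i) base) (ℚ.*-zeroʳ (- sumℚ μ))) (eq i))
    (ℚ.+-identityʳ 0ℚ)

based-span : ∀ {n} {A : PointSet n} {k} (B : Basis A (suc k)) → pt B zero ≡ origin →
  (x : Point n) → ∀ α → (α ≡ 0ℚ ⊎ A x) → Combination (pt B ∘ suc) (λ i → α * x i)
based-span B base x α x∈ with scaled-span B x α x∈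
... | μ , eq = μ ∘ suc , λ i → trans (sym (ℚ.+-identityˡ _)) (trans
  (cong (_+ comb (μ ∘ suc) (pt B ∘ suc) i) (sym (trans (cong (λ b → μ zero * b i) base) (ℚ.*-zeroʳ (μ zero)))))
  (eq (suc i)))

module _ {m n : ℕ} {S : PointSet m} {T : PointSet n} {Z : PointSet (m ℕ.+ n)} (W : Wedge S T Z) where
  open Wedge W

  leftFace : Face Z → Face S
  leftFace (face c δ v) = face (left m c) δ λ x x∈S → subst (_≤ δ) (dot-inl c x) (v (append x origin) (inl x x∈S))

  rightFace : Face Z → Face T
  rightFace (face c δ v) = face (right m c) δ λ y y∈T → subst (_≤ δ) (dot-inr c y) (v (append origin y) (inr y y∈T))

  inl-face : ∀ F x → faceSet (leftFace F) x → faceSet F (append x origin)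
  inl-face F x (x∈S , on) = inl x x∈S , trans (dot-inl (normal F) x) on

  inr-face : ∀ F y → faceSet (rightFace F) y → faceSet F (append origin y)
  inr-face F y (y∈T , on) = inr y y∈T , trans (dot-inr (normal F) y) on

  rhs-nonneg : ∀ F → 0ℚ ≤ rhs F
  rhs-nonneg F = rhs-at-origin (leftFace F) origin-l

  -- Consequences of tightness for a decomposed point: a part of nonzero weight lies on the trace of
  -- the face, and weight can remain at the origin only if the right-hand side is 0, that is, if the
  -- face contains the origin.
  record Split (F : Face Z) (z : Point (m ℕ.+ n)) : Set where
    field
      α β    : ℚ
      x      : Point m
      y      : Point n
      x∈     : S x
      y∈     : T y
      z-l    : ∀ i → z (i ↑ˡ n) ≡ α * x i
      z-r    : ∀ j → z (m ↑ʳ j) ≡ β * y j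
      on-l   : α ≡ 0ℚ ⊎ faceSet (leftFace F) x
      on-r   : β ≡ 0ℚ ⊎ faceSet (rightFace F) y
      total  : rhs F ≡ 0ℚ ⊎ α + β ≡ 1ℚ

  dot-decomposed : ∀ c z α β x y → (∀ i → z (i ↑ˡ n) ≡ α * x i) → (∀ j → z (m ↑ʳ j) ≡ β * y j) →
    dot c z ≡ α * dot (left m c) x + β * dot (right m c) y
  dot-decomposed c z α β x y l r = trans (dot-split-via c z l r)
    (cong₂ _+_ (dot-*ʳ (left m c) x α) (dot-*ʳ (right m c) y β))

  -- The slack of the inequality at `z` is the sum of the slacks at `x`, `y` and the origin,
  -- weighted by α, β and 1 - α - β. All three terms are nonnegative, so on the face each product is
  -- 0.
  splitPoint : ∀ F z → faceSet F z → Split F z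
  splitPoint F z (z∈Z , on) with decompose z z∈Z
  ... | α , β , x , y , (0≤α , 0≤β , α+β≤1) , (x∈S , y∈T) , z-l , z-r = record
    { α = α ; β = β ; x = x ; y = y ; x∈ = x∈S ; y∈ = y∈T ; z-l = z-l ; z-r = z-r
    ; on-l  = case-l (*-zero-cases (+-zero-l s₁ (0≤+ s₂ s₃) slack))
    ; on-r  = case-r (*-zero-cases (+-zero-l s₂ s₃ (+-zero-r s₁ (0≤+ s₂ s₃) slack)))
    ; total = case-t (*-zero-cases (+-zero-r s₂ s₃ (+-zero-r s₁ (0≤+ s₂ s₃) slack))) }
    where
    δ = rhs F
    p = dot (left m (normal F)) x
    q = dot (right m (normal F)) y
    s₁ : 0ℚ ≤ α * (δ - p)
    s₁ = 0≤* 0≤α (≤-sub (valid (leftFace F) x x∈S))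
    s₂ : 0ℚ ≤ β * (δ - q)
    s₂ = 0≤* 0≤β (≤-sub (valid (rightFace F) y y∈T))
    s₃ : 0ℚ ≤ (1ℚ - (α + β)) * δ
    s₃ = 0≤* (≤-sub α+β≤1) (rhs-nonneg F)
    lem : ∀ α β δ p q → α * (δ - p) + (β * (δ - q) + (1ℚ - (α + β)) * δ) ≡ δ - (α * p + β * q)
    lem = solve-∀ ringℚ
    slack : α * (δ - p) + (β * (δ - q) + (1ℚ - (α + β)) * δ) ≡ 0ℚ
    slack = trans (lem α β δ p q) (trans (cong (λ u → δ - u) (trans (sym (dot-decomposed (normal F) z α β x y z-l z-r)) on)) (ℚ.+-inverseʳ δ))
    case-l : α ≡ 0ℚ ⊎ δ - p ≡ 0ℚ → α ≡ 0ℚ ⊎ faceSet (leftFace F) x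
    case-l (inj₁ e) = inj₁ e
    case-l (inj₂ e) = inj₂ (x∈S , sub-zero e)
    case-r : β ≡ 0ℚ ⊎ δ - q ≡ 0ℚ → β ≡ 0ℚ ⊎ faceSet (rightFace F) y
    case-r (inj₁ e) = inj₁ e
    case-r (inj₂ e) = inj₂ (y∈T , sub-zero e)
    case-t : 1ℚ - (α + β) ≡ 0ℚ ⊎ δ ≡ 0ℚ → δ ≡ 0ℚ ⊎ α + β ≡ 1ℚ
    case-t (inj₁ e) = inj₂ (sub-zero e)
    case-t (inj₂ e) = inj₁ e

  -- A face of a wedge is recovered from its two traces: their equations, weighted by α and β, add
  -- up to the equation of `G`, up to the weight left at the origin. If such weight is possible, the
  -- origin lies on the left trace of `F`, hence on that of `G`, and the right-hand side of `G` is 0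
  -- as well.
  faces-determined : ∀ F G → (∀ x → faceSet (leftFace F) x → faceSet (leftFace G) x) →
    (∀ y → faceSet (rightFace F) y → faceSet (rightFace G) y) → ∀ z → faceSet F z → faceSet G z
  faces-determined F G sub-l sub-r z z∈F = proj₁ z∈F , (begin
    dot (normal G) z                   ≡⟨ dot-decomposed (normal G) z α β x y z-l z-r ⟩
    α * dot cl x + β * dot cr y        ≡⟨ cong₂ _+_ (part-l on-l) (part-r on-r) ⟩
    α * rhs G + β * rhs G              ≡⟨ sym (ℚ.*-distribʳ-+ (rhs G) α β) ⟩
    (α + β) * rhs G                    ≡⟨ whole total ⟩
    rhs G                              ∎)
    where
    open ≡-Reasoning
    open Split (splitPoint F z z∈F)
    cl = left m (normal G)
    cr = right m (normal G)
    part-l : α ≡ 0ℚ ⊎ faceSet (leftFace F) x → α * dot cl x ≡ α * rhs G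
    part-l (inj₁ e)  = trans (cong (_* dot cl x) e) (trans (ℚ.*-zeroˡ (dot cl x)) (sym (trans (cong (_* rhs G) e) (ℚ.*-zeroˡ (rhs G)))))
    part-l (inj₂ x∈) = cong (α *_) (proj₂ (sub-l x x∈))
    part-r : β ≡ 0ℚ ⊎ faceSet (rightFace F) y → β * dot cr y ≡ β * rhs G
    part-r (inj₁ e)  = trans (cong (_* dot cr y) e) (trans (ℚ.*-zeroˡ (dot cr y)) (sym (trans (cong (_* rhs G) e) (ℚ.*-zeroˡ (rhs G)))))
    part-r (inj₂ y∈) = cong (β *_) (proj₂ (sub-r y y∈))
    whole : rhs F ≡ 0ℚ ⊎ α + β ≡ 1ℚ → (α + β) * rhs G ≡ rhs G
    whole (inj₂ e) = trans (cong (_* rhs G) e) (ℚ.*-identityˡ (rhs G))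
    whole (inj₁ e) = trans (cong ((α + β) *_) G0) (trans (ℚ.*-zeroʳ (α + β)) (sym G0))
      where
      G0 : rhs G ≡ 0ℚ
      G0 = trans (sym (proj₂ (sub-l origin (origin-l , trans (dot-0ʳ (left m (normal F)) (λ _ → refl)) (sym e)))))
        (dot-0ʳ cl (λ _ → refl))

  -- The traces lie in hyperplanes that miss the origin. A relation between the points on both sides
  -- splits into linear relations in the complementary spaces, and pairing each with the normal
  -- vector shows that its coefficients sum to 0 separately, so the ranks add.
  wedge-basis : ∀ F → rhs F ≢ 0ℚ → ∀ {k l} → Basis (faceSet (leftFace F)) k → Basis (faceSet (rightFace F)) l →
    Basis (faceSet F) (k ℕ.+ l)
  wedge-basis F δ≢0 {k} {l} P Q = record { pt = pts ; mem = pts-mem ; indep = pts-indep ; span = pts-span }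
    where
    pts = spread (pt P) (pt Q)
    pts-mem : ∀ j → faceSet F (pts j)
    pts-mem = split-elim k (λ j → faceSet F (pts j))
      (λ j → subst (faceSet F) (sym (append-l _ _ j)) (inl-face F (pt P j) (mem P j)))
      (λ j → subst (faceSet F) (sym (append-r {m = k} _ _ j)) (inr-face F (pt Q j) (mem Q j)))
    pts-indep : LinIndep (hom ∘ pts)
    pts-indep ρ eq = split-elim k (λ j → ρ j ≡ 0ℚ) (indep P (left k ρ) left-eq) (indep Q (right k ρ) right-eq)
      where
      μ = left k ρ
      ν = right k ρ
      p0 : ∀ i → comb μ (pt P) i ≡ 0ℚ
      p0 i = trans (sym (spread-comb-l (pt P) (pt Q) ρ i)) (eq (suc (i ↑ˡ n)))
      q0 : ∀ i → comb ν (pt Q) i ≡ 0ℚ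
      q0 i = trans (sym (spread-comb-r (pt P) (pt Q) ρ i)) (eq (suc (m ↑ʳ i)))
      μ-sum : sumℚ μ ≡ 0ℚ
      μ-sum = *-cancel-0 δ≢0 (trans (sym (dot-comb-const (normal (leftFace F)) (rhs F) μ (pt P) (proj₂ ∘ mem P)))
        (dot-0ʳ (normal (leftFace F)) p0))
      ν-sum : sumℚ ν ≡ 0ℚ
      ν-sum = *-cancel-0 δ≢0 (trans (sym (dot-comb-const (normal (rightFace F)) (rhs F) ν (pt Q) (proj₂ ∘ mem Q)))
        (dot-0ʳ (normal (rightFace F)) q0))
      left-eq : ∀ i → comb μ (hom ∘ pt P) i ≡ 0ℚ
      left-eq zero    = trans (sum-*1 μ) μ-sum
      left-eq (suc i) = p0 i
      right-eq : ∀ i → comb ν (hom ∘ pt Q) i ≡ 0ℚ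
      right-eq zero    = trans (sum-*1 ν) ν-sum
      right-eq (suc i) = q0 i
    pts-span : ∀ z → faceSet F z → Combination (hom ∘ pts) (hom z)
    pts-span z z∈F = ρ , λ where
        zero    → begin
          comb ρ (hom ∘ pts) zero                ≡⟨ sum-*1 ρ ⟩
          sumℚ ρ                                 ≡⟨ sum-split k ρ ⟩
          sumℚ (left k ρ) + sumℚ (right k ρ)     ≡⟨ cong₂ _+_ (sum-cong (append-l μ ν)) (sum-cong (append-r μ ν)) ⟩
          sumℚ μ + sumℚ ν                        ≡⟨ cong₂ _+_ (trans (sym (sum-*1 μ)) (trans (μ-eq zero) (ℚ.*-identityʳ α)))
                                                              (trans (sym (sum-*1 ν)) (trans (ν-eq zero) (ℚ.*-identityʳ β))) ⟩
          α + β                                  ≡⟨ one total ⟩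
          1ℚ                                     ∎
        (suc i) → split-elim m (λ i → comb ρ pts i ≡ z i)
          (λ i → trans (spread-comb-l (pt P) (pt Q) ρ i) (trans (sum-cong (λ j → cong (_* pt P j i) (append-l μ ν j)))
            (trans (μ-eq (suc i)) (sym (z-l i)))))
          (λ i → trans (spread-comb-r (pt P) (pt Q) ρ i) (trans (sum-cong (λ j → cong (_* pt Q j i) (append-r μ ν j)))
            (trans (ν-eq (suc i)) (sym (z-r i))))) i
      where
      open ≡-Reasoning
      open Split (splitPoint F z z∈F)
      μ = proj₁ (scaled-span P x α on-l)
      μ-eq = proj₂ (scaled-span P x α on-l)
      ν = proj₁ (scaled-span Q y β on-r)
      ν-eq = proj₂ (scaled-span Q y β on-r)
      ρ : Fin (k ℕ.+ l) → ℚ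
      ρ = append μ ν
      one : rhs F ≡ 0ℚ ⊎ α + β ≡ 1ℚ → α + β ≡ 1ℚ
      one (inj₁ e) = contradiction e δ≢0
      one (inj₂ e) = e

  -- Both bases start at the origin, which is counted once; apart from it the two families live in
  -- complementary spaces.
  wedge-basis₀ : ∀ F → rhs F ≡ 0ℚ → ∀ {k l}
    (P : Basis (faceSet (leftFace F)) (suc k)) → pt P zero ≡ origin →
    (Q : Basis (faceSet (rightFace F)) (suc l)) → pt Q zero ≡ origin →
    Basis (faceSet F) (suc (k ℕ.+ l))
  wedge-basis₀ F δ≡0 {k} {l} P P0 Q Q0 = record { pt = pts ; mem = pts-mem ; indep = pts-indep ; span = pts-span }
    where
    p = pt P ∘ suc
    q = pt Q ∘ suc
    base : Point (m ℕ.+ n)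
    base = append (origin {m}) (origin {n})
    pts = base ▸ spread p q
    pts-mem : ∀ j → faceSet F (pts j)
    pts-mem zero    = inl-face F origin (origin-l , trans (dot-0ʳ (left m (normal F)) (λ _ → refl)) (sym δ≡0))
    pts-mem (suc j) = split-elim k (λ j → faceSet F (spread p q j))
      (λ j → subst (faceSet F) (sym (append-l _ _ j)) (inl-face F (p j) (mem P (suc j))))
      (λ j → subst (faceSet F) (sym (append-r {m = k} _ _ j)) (inr-face F (q j) (mem Q (suc j)))) j
    tail-comb : ∀ ρ i → comb ρ (hom ∘ pts) (suc i) ≡ comb (ρ ∘ suc) (spread p q) i
    tail-comb ρ i = trans (cong (_+ comb (ρ ∘ suc) (spread p q) i)
      (trans (cong (ρ zero *_) (append-origin m i)) (ℚ.*-zeroʳ (ρ zero)))) (ℚ.+-identityˡ _)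
    pts-indep : LinIndep (hom ∘ pts)
    pts-indep ρ eq = λ { zero → first ; (suc j) → rest j }
      where
      rest : ∀ j → ρ (suc j) ≡ 0ℚ
      rest = split-elim k (λ j → ρ (suc j) ≡ 0ℚ)
        (based-indep P P0 (left k (ρ ∘ suc)) (λ i →
          trans (sym (trans (tail-comb ρ (i ↑ˡ n)) (spread-comb-l p q (ρ ∘ suc) i))) (eq (suc (i ↑ˡ n)))))
        (based-indep Q Q0 (right k (ρ ∘ suc)) (λ i →
          trans (sym (trans (tail-comb ρ (m ↑ʳ i)) (spread-comb-r p q (ρ ∘ suc) i))) (eq (suc (m ↑ʳ i)))))
      first : ρ zero ≡ 0ℚ
      first = trans (sym (trans (cong (ρ zero +_) (sum-zero rest)) (ℚ.+-identityʳ (ρ zero))))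
        (trans (sym (sum-*1 ρ)) (eq zero))
    pts-span : ∀ z → faceSet F z → Combination (hom ∘ pts) (hom z)
    pts-span z z∈F = ρ , λ where
        zero    → trans (sum-*1 ρ) (sub-add (sumℚ σ))
        (suc i) → trans (tail-comb ρ i) (split-elim m (λ i → comb σ (spread p q) i ≡ z i)
          (λ i → trans (spread-comb-l p q σ i) (trans (sum-cong (λ j → cong (_* p j i) (append-l μ ν j)))
            (trans (μ-eq i) (sym (z-l i)))))
          (λ i → trans (spread-comb-r p q σ i) (trans (sum-cong (λ j → cong (_* q j i) (append-r μ ν j)))
            (trans (ν-eq i) (sym (z-r i))))) i)
      where
      open Split (splitPoint F z z∈F)
      μ = proj₁ (based-span P P0 x α on-l)
      μ-eq = proj₂ (based-span P P0 x α on-l)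
      ν = proj₁ (based-span Q Q0 y β on-r)
      ν-eq = proj₂ (based-span Q Q0 y β on-r)
      σ : Fin (k ℕ.+ l) → ℚ
      σ = append μ ν
      ρ : Fin (suc (k ℕ.+ l)) → ℚ
      -- The origin absorbs whatever weight is missing for an affine combination.
      ρ = (1ℚ - sumℚ σ) ▸ σ
  
  -- α + β may fall short of 1, which does no harm: the right-hand side is nonnegative because the
  -- inequality holds at the origin.
  joinFace : (F : Face S) (G : Face T) → rhs F ≡ rhs G → Face Z
  joinFace F G same = face (append (normal F) (normal G)) (rhs F) v
    where
    δ = rhs F
    0≤δ : 0ℚ ≤ δ
    0≤δ = rhs-at-origin F origin-l
    v : ∀ z → Z z → dot (append (normal F) (normal G)) z ≤ δ
    v z z∈Z with decompose z z∈Z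
    ... | α , β , x , y , (0≤α , 0≤β , α+β≤1) , (x∈S , y∈T) , z-l , z-r = begin
      dot (append (normal F) (normal G)) z
        ≡⟨ dot-decomposed (append (normal F) (normal G)) z α β x y z-l z-r ⟩
      α * dot (left m {n} (append (normal F) (normal G))) x + β * dot (right m {n} (append (normal F) (normal G))) y
        ≡⟨ cong₂ _+_ (cong (α *_) (dot-congˡ x (append-l (normal F) (normal G))))
                     (cong (β *_) (dot-congˡ y (append-r {m = m} (normal F) (normal G)))) ⟩
      α * dot (normal F) x + β * dot (normal G) y
        ≤⟨ ℚ.+-mono-≤ (*-monoˡ 0≤α (valid F x x∈S)) (*-monoˡ 0≤β (subst (dot (normal G) y ≤_) (sym same) (valid G y y∈T))) ⟩
      α * δ + β * δ
        ≡⟨ lem α β δ ⟩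
      δ * (α + β)
        ≤⟨ *-monoˡ 0≤δ α+β≤1 ⟩
      δ * 1ℚ
        ≡⟨ ℚ.*-identityʳ δ ⟩
      δ ∎
      where
      open ℚ.≤-Reasoning
      lem : ∀ α β δ → α * δ + β * δ ≡ δ * (α + β)
      lem = solve-∀ ringℚ

  join-left : ∀ F G same → SameSet (faceSet F) (faceSet (leftFace (joinFace F G same)))
  join-left F G same x = mk⇔
    (λ (x∈S , on) → x∈S , trans (dot-congˡ x (append-l (normal F) (normal G))) on)
    (λ (x∈S , on) → x∈S , trans (sym (dot-congˡ x (append-l (normal F) (normal G)))) on)

  join-right : ∀ F G same → SameSet (faceSet G) (faceSet (rightFace (joinFace F G same)))
  join-right F G same y = mk⇔
    (λ (y∈T , on) → y∈T , trans (dot-congˡ y (append-r {m = m} (normal F) (normal G))) (trans on (sym same)))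
    (λ (y∈T , on) → y∈T , trans (sym (dot-congˡ y (append-r {m = m} (normal F) (normal G)))) (trans on same))

-- Products of polytopes

-- The tool for faces cut out by a sum of two valid inequalities: such a face is the intersection of
-- the two faces.
sum-tight : ∀ {a b c d} → a ≤ b → c ≤ d → a + c ≡ b + d → a ≡ b × c ≡ d
sum-tight {a} {b} {c} {d} a≤b c≤d eq =
  sub-zero (+-zero-l (≤-sub a≤b) (≤-sub c≤d) slack) , sub-zero (+-zero-r (≤-sub a≤b) (≤-sub c≤d) slack)
  where
  lem : ∀ a b c d → b - a + (d - c) ≡ b + d - (a + c)
  lem = solve-∀ ringℚ
  slack : b - a + (d - c) ≡ 0ℚ
  slack = trans (lem a b c d) (trans (cong (λ u → b + d - u) eq) (ℚ.+-inverseʳ (b + d)))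

nonempty-rank : ∀ {n} {A : PointSet n} {k} → Basis A k → ∀ a → A a → Σ ℕ λ l → k ≡ suc l
nonempty-rank {k = zero}  B a a∈A = contradiction (proj₂ (span B a a∈A) zero) (λ ())
nonempty-rank {k = suc l} _ _ _   = l , refl

emptyRanked : ∀ {n} {S : PointSet n} → RankedFace S
emptyRanked {n} {S} = ranked empty 0 record
  { pt = λ () ; mem = λ () ; indep = λ _ _ ()
  ; span = λ x (_ , on) → contradiction (trans (sym (dot-0ˡ x (λ _ → refl))) on) (λ ()) }
  where
  empty : Face S
  empty = face origin 1ℚ λ x _ → subst (_≤ 1ℚ) (sym (dot-0ˡ x (λ _ → refl))) 0≤1

-- A basis of a product: each factor is traversed while the other stays at its first point. The two
-- arms share the corner, so that dimensions add.
cross : ∀ {m n k l} → (Fin (suc k) → Point m) → (Fin (suc l) → Point n) → Fin (suc (k ℕ.+ l)) → Point (m ℕ.+ n)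
cross p q = append (p zero) (q zero) ▸
  append (λ j → append (p (suc j)) (q zero)) (λ j → append (p zero) (q (suc j)))

module _ {m n k l : ℕ} (p : Fin (suc k) → Point m) (q : Fin (suc l) → Point n) (ρ : Fin (suc (k ℕ.+ l)) → ℚ) where

  private
    μ = left k (ρ ∘ suc)
    ν = right k (ρ ∘ suc)
    tailₗ : Fin k → Point (m ℕ.+ n)
    tailₗ j = append (p (suc j)) (q zero)
    tailᵣ : Fin l → Point (m ℕ.+ n)
    tailᵣ j = append (p zero) (q (suc j))

    tail-comb : ∀ i → comb (ρ ∘ suc) (cross p q ∘ suc) i ≡ comb μ tailₗ i + comb ν tailᵣ i
    tail-comb i = trans (comb-split k (ρ ∘ suc) (append tailₗ tailᵣ) i) (cong₂ _+_
      (sum-cong (λ j → cong (λ x → μ j * x i) (append-l tailₗ tailᵣ j)))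
      (sum-cong (λ j → cong (λ x → ν j * x i) (append-r tailₗ tailᵣ j))))

    const-sum : ∀ {k} (μ : Fin k → ℚ) a → sumℚ (λ j → μ j * a) ≡ sumℚ μ * a
    const-sum μ a = trans (sum-cong (λ j → ℚ.*-comm (μ j) a)) (trans (sum-*ˡ a μ) (ℚ.*-comm a (sumℚ μ)))

  -- Seen from the left factor, the arm that varies on the right rests at `p zero`, so all its
  -- weight is credited to the corner.
  cross-comb-l : ∀ i → comb ρ (cross p q) (i ↑ˡ n) ≡ comb ((ρ zero + sumℚ ν) ▸ μ) p i
  cross-comb-l i = trans (cong₂ _+_ (cong (ρ zero *_) (append-l (p zero) (q zero) i))
      (trans (tail-comb (i ↑ˡ n)) (cong₂ _+_
        (sum-cong (λ j → cong (μ j *_) (append-l (p (suc j)) (q zero) i)))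
        (trans (sum-cong (λ j → cong (ν j *_) (append-l (p zero) (q (suc j)) i))) (const-sum ν (p zero i))))))
    (lem (ρ zero) (p zero i) (comb μ (p ∘ suc) i) (sumℚ ν))
    where
    lem : ∀ r a c s → r * a + (c + s * a) ≡ (r + s) * a + c
    lem = solve-∀ ringℚ

  cross-comb-r : ∀ i → comb ρ (cross p q) (m ↑ʳ i) ≡ comb ((ρ zero + sumℚ μ) ▸ ν) q i
  cross-comb-r i = trans (cong₂ _+_ (cong (ρ zero *_) (append-r {m = m} (p zero) (q zero) i))
      (trans (tail-comb (m ↑ʳ i)) (cong₂ _+_
        (trans (sum-cong (λ j → cong (μ j *_) (append-r {m = m} (p (suc j)) (q zero) i))) (const-sum μ (q zero i)))
        (sum-cong (λ j → cong (ν j *_) (append-r {m = m} (p zero) (q (suc j)) i))))))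
    (lem (ρ zero) (q zero i) (comb ν (q ∘ suc) i) (sumℚ μ))
    where
    lem : ∀ r a c s → r * a + (s * a + c) ≡ (r + s) * a + c
    lem = solve-∀ ringℚ

  cross-sum : sumℚ ρ ≡ ρ zero + (sumℚ μ + sumℚ ν)
  cross-sum = cong (ρ zero +_) (sum-split k (ρ ∘ suc))

product-basis : ∀ {m n} {A : PointSet m} {B : PointSet n} {C : PointSet (m ℕ.+ n)} →
  (∀ z → C z → A (left m z) × B (right m z)) → (∀ x y → A x → B y → C (append x y)) →
  ∀ {k l} → Basis A (suc k) → Basis B (suc l) → Basis C (suc (k ℕ.+ l))
product-basis {m} {n} {A} {B} {C} parts pair {k} {l} P Q =
  record { pt = pts ; mem = pts-mem ; indep = pts-indep ; span = pts-span }
  where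
  p = pt P
  q = pt Q
  pts = cross p q
  pts-mem : ∀ j → C (pts j)
  pts-mem zero    = pair (p zero) (q zero) (mem P zero) (mem Q zero)
  pts-mem (suc j) = split-elim k (λ j → C (pts (suc j)))
    (λ j → subst C (sym (append-l _ _ j)) (pair (p (suc j)) (q zero) (mem P (suc j)) (mem Q zero)))
    (λ j → subst C (sym (append-r {m = k} _ _ j)) (pair (p zero) (q (suc j)) (mem P zero) (mem Q (suc j)))) j
  pts-indep : LinIndep (hom ∘ pts)
  pts-indep ρ eq = λ { zero → first ; (suc j) → rest j }
    where
    μ = left k (ρ ∘ suc)
    ν = right k (ρ ∘ suc)
    total : ρ zero + (sumℚ μ + sumℚ ν) ≡ 0ℚ
    total = trans (sym (cross-sum p q ρ)) (trans (sym (sum-*1 ρ)) (eq zero))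
    lemₗ : ∀ r s t → (r + t) * 1ℚ + s ≡ r + (s + t)
    lemₗ = solve-∀ ringℚ
    lemᵣ : ∀ r s t → (r + s) * 1ℚ + t ≡ r + (s + t)
    lemᵣ = solve-∀ ringℚ
    left-eq : ∀ i → comb ((ρ zero + sumℚ ν) ▸ μ) (hom ∘ p) i ≡ 0ℚ
    left-eq zero    = trans (cong ((ρ zero + sumℚ ν) * 1ℚ +_) (sum-*1 μ)) (trans (lemₗ (ρ zero) (sumℚ μ) (sumℚ ν)) total)
    left-eq (suc i) = trans (sym (cross-comb-l p q ρ i)) (eq (suc (i ↑ˡ n)))
    right-eq : ∀ i → comb ((ρ zero + sumℚ μ) ▸ ν) (hom ∘ q) i ≡ 0ℚ
    right-eq zero    = trans (cong ((ρ zero + sumℚ μ) * 1ℚ +_) (sum-*1 ν)) (trans (lemᵣ (ρ zero) (sumℚ μ) (sumℚ ν)) total)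
    right-eq (suc i) = trans (sym (cross-comb-r p q ρ i)) (eq (suc (m ↑ʳ i)))
    rest : ∀ j → ρ (suc j) ≡ 0ℚ
    rest = split-elim k (λ j → ρ (suc j) ≡ 0ℚ)
      (λ j → indep P ((ρ zero + sumℚ ν) ▸ μ) left-eq (suc j)) (λ j → indep Q ((ρ zero + sumℚ μ) ▸ ν) right-eq (suc j))
    first : ρ zero ≡ 0ℚ
    first = trans (sym (trans (cong (ρ zero +_) (sum-zero rest)) (ℚ.+-identityʳ (ρ zero))))
      (trans (sym (sum-*1 ρ)) (eq zero))
  pts-span : ∀ z → C z → Combination (hom ∘ pts) (hom z)
  pts-span z z∈C = ρ , λ where
      zero    → trans (sum-*1 ρ) (sub-add (sumℚ σ))
      (suc i) → split-elim m (λ i → comb ρ pts i ≡ z i)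
        (λ i → trans (cross-comb-l p q ρ i) (trans (cong₂ _+_ (cong (_* p zero i) corner-l)
          (sum-cong (λ j → cong (_* p (suc j) i) (append-l (μ ∘ suc) (ν ∘ suc) j)))) (μ-eq (suc i))))
        (λ i → trans (cross-comb-r p q ρ i) (trans (cong₂ _+_ (cong (_* q zero i) corner-r)
          (sum-cong (λ j → cong (_* q (suc j) i) (append-r (μ ∘ suc) (ν ∘ suc) j)))) (ν-eq (suc i)))) i
    where
    μ = proj₁ (span P (left m z) (proj₁ (parts z z∈C)))
    μ-eq = proj₂ (span P (left m z) (proj₁ (parts z z∈C)))
    ν = proj₁ (span Q (right m z) (proj₂ (parts z z∈C)))
    ν-eq = proj₂ (span Q (right m z) (proj₂ (parts z z∈C)))
    σ : Fin (k ℕ.+ l) → ℚ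
    σ = append (μ ∘ suc) (ν ∘ suc)
    ρ : Fin (suc (k ℕ.+ l)) → ℚ
    ρ = (1ℚ - sumℚ σ) ▸ σ
    σ-sum : sumℚ σ ≡ sumℚ (left k σ) + sumℚ (right k σ)
    σ-sum = sum-split k σ
    lemₗ : ∀ a u t → a + u - (u + t) + t ≡ a
    lemₗ = solve-∀ ringℚ
    lemᵣ : ∀ a u t → a + t - (u + t) + u ≡ a
    lemᵣ = solve-∀ ringℚ
    μ-sum : 1ℚ ≡ μ zero + sumℚ (left k σ)
    μ-sum = trans (sym (trans (sym (sum-*1 μ)) (μ-eq zero)))
      (cong (μ zero +_) (sum-cong (λ j → sym (append-l (μ ∘ suc) (ν ∘ suc) j))))
    ν-sum : 1ℚ ≡ ν zero + sumℚ (right k σ)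
    ν-sum = trans (sym (trans (sym (sum-*1 ν)) (ν-eq zero)))
      (cong (ν zero +_) (sum-cong (λ j → sym (append-r (μ ∘ suc) (ν ∘ suc) j))))
    corner-l : 1ℚ - sumℚ σ + sumℚ (right k σ) ≡ μ zero
    corner-l = trans (cong₂ (λ u v → u - v + sumℚ (right k σ)) μ-sum σ-sum)
      (lemₗ (μ zero) (sumℚ (left k σ)) (sumℚ (right k σ)))
    corner-r : 1ℚ - sumℚ σ + sumℚ (left k σ) ≡ ν zero
    corner-r = trans (cong₂ (λ u v → u - v + sumℚ (left k σ)) ν-sum σ-sum)
      (lemᵣ (ν zero) (sumℚ (left k σ)) (sumℚ (right k σ)))

record Product {m n : ℕ} (S : PointSet m) (T : PointSet n) (Z : PointSet (m ℕ.+ n)) : Set where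
  field
    pair  : ∀ x y → S x → T y → Z (append x y)
    parts : ∀ z → Z z → S (left m z) × T (right m z)

module _ {m n : ℕ} {S : PointSet m} {T : PointSet n} {Z : PointSet (m ℕ.+ n)} (X : Product S T Z) where
  open Product X

  dot-parts : ∀ (c : Point m) (d : Point n) z → dot (append c d) z ≡ dot c (left m z) + dot d (right m z)
  dot-parts c d z = trans (dot-split m (append c d) z)
    (cong₂ _+_ (dot-congˡ (left m z) (append-l c d)) (dot-congˡ (right m z) (append-r {m = m} c d)))

  prodFace : Face S → Face T → Face Z
  prodFace (face c δ v) (face d ε w) = face (append c d) (δ + ε) λ z z∈Z →
    subst (_≤ δ + ε) (sym (dot-parts c d z))
      (ℚ.+-mono-≤ (v (left m z) (proj₁ (parts z z∈Z))) (w (right m z) (proj₂ (parts z z∈Z))))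

  prodFace-parts : ∀ F G z → faceSet (prodFace F G) z → faceSet F (left m z) × faceSet G (right m z)
  prodFace-parts F G z (z∈Z , on) = (proj₁ (parts z z∈Z) , proj₁ tight) , (proj₂ (parts z z∈Z) , proj₂ tight)
    where
    tight = sum-tight (valid F (left m z) (proj₁ (parts z z∈Z))) (valid G (right m z) (proj₂ (parts z z∈Z)))
      (trans (sym (dot-parts (normal F) (normal G) z)) on)

  prodFace-pair : ∀ F G x y → faceSet F x → faceSet G y → faceSet (prodFace F G) (append x y)
  prodFace-pair F G x y (x∈S , p) (y∈T , q) = pair x y x∈S y∈T ,
    trans (dot-split-via (append (normal F) (normal G)) (append x y) (append-l x y) (append-r x y))
      (cong₂ _+_ (trans (dot-congˡ x (append-l (normal F) (normal G))) p)
        (trans (dot-congˡ y (append-r {m = m} (normal F) (normal G))) q))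

  -- The right-hand sides of the factors of a nonempty face are read off from one of its points:
  -- exchanging only the left half of `z` stays in the product, so the left part of the functional
  -- is maximal at `left m z`.
  factorₗ : ∀ F z → faceSet F z → Face S
  factorₗ F z (z∈Z , on) = face c (dot c (left m z)) λ x x∈S → ≤-add (subst (0ℚ ≤_) (begin
      rhs F - dot (normal F) (append x y)   ≡⟨ cong₂ _-_ (trans (sym on) (dot-split m (normal F) z)) (dot-append (normal F) x y) ⟩
      dot c (left m z) + dot d y - (dot c x + dot d y) ≡⟨ lem (dot c (left m z)) (dot c x) (dot d y) ⟩
      dot c (left m z) - dot c x            ∎)
    (≤-sub (valid F (append x y) (pair x y x∈S (proj₂ (parts z z∈Z))))))
    where
    open ≡-Reasoning
    c = left m (normal F)
    d = right m (normal F)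
    y = right m z
    lem : ∀ a b e → a + e - (b + e) ≡ a - b
    lem = solve-∀ ringℚ

  factorᵣ : ∀ F z → faceSet F z → Face T
  factorᵣ F z (z∈Z , on) = face d (dot d (right m z)) λ y y∈T → ≤-add (subst (0ℚ ≤_) (begin
      rhs F - dot (normal F) (append x y)   ≡⟨ cong₂ _-_ (trans (sym on) (dot-split m (normal F) z)) (dot-append (normal F) x y) ⟩
      dot c x + dot d (right m z) - (dot c x + dot d y) ≡⟨ lem (dot d (right m z)) (dot d y) (dot c x) ⟩
      dot d (right m z) - dot d y           ∎)
    (≤-sub (valid F (append x y) (pair x y (proj₁ (parts z z∈Z)) y∈T))))
    where
    open ≡-Reasoning
    c = left m (normal F)
    d = right m (normal F)
    x = left m z
    lem : ∀ a b e → e + a - (e + b) ≡ a - b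
    lem = solve-∀ ringℚ

  factor-parts : ∀ F z₀ (z₀∈ : faceSet F z₀) z → faceSet F z →
    faceSet (factorₗ F z₀ z₀∈) (left m z) × faceSet (factorᵣ F z₀ z₀∈) (right m z)
  factor-parts F z₀ z₀∈ z (z∈Z , on) = (proj₁ (parts z z∈Z) , proj₁ tight) , (proj₂ (parts z z∈Z) , proj₂ tight)
    where
    tight = sum-tight (valid (factorₗ F z₀ z₀∈) (left m z) (proj₁ (parts z z∈Z)))
      (valid (factorᵣ F z₀ z₀∈) (right m z) (proj₂ (parts z z∈Z)))
      (trans (sym (dot-split m (normal F) z)) (trans on (trans (sym (proj₂ z₀∈)) (dot-split m (normal F) z₀))))

  factor-join : ∀ F z₀ (z₀∈ : faceSet F z₀) z → Z z →
    faceSet (factorₗ F z₀ z₀∈) (left m z) → faceSet (factorᵣ F z₀ z₀∈) (right m z) → faceSet F z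
  factor-join F z₀ z₀∈ z z∈Z (_ , p) (_ , q) = z∈Z ,
    trans (dot-split m (normal F) z) (trans (cong₂ _+_ p q) (trans (sym (dot-split m (normal F) z₀)) (proj₂ z₀∈)))

  factor-pair : ∀ F z₀ (z₀∈ : faceSet F z₀) x y →
    faceSet (factorₗ F z₀ z₀∈) x → faceSet (factorᵣ F z₀ z₀∈) y → faceSet F (append x y)
  factor-pair F z₀ z₀∈ x y (x∈S , p) (y∈T , q) = pair x y x∈S y∈T ,
    trans (dot-append (normal F) x y) (trans (cong₂ _+_ p q) (trans (sym (dot-split m (normal F) z₀)) (proj₂ z₀∈)))

HasBases : ∀ {n} → PointSet n → Set
HasBases S = (F : Face S) → Σ ℕ (Basis (faceSet F))

rankedBy : ∀ {n} {S : PointSet n} → HasBases S → Face S → RankedFace S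
rankedBy bases F = ranked F (proj₁ (bases F)) (proj₂ (bases F))

-- Nonempty faces are products of faces, and the images of the factors are multiplied. A product of
-- nonempty faces determines its factors, each being tested alongside a fixed point of the other.
product-embedding : ∀ {m n} {S S′ : PointSet m} {T T′ : PointSet n} {Z Z′ : PointSet (m ℕ.+ n)} →
  Product S T Z → Product S′ T′ Z′ → HasBases S → HasBases T →
  Embedding S S′ → Embedding T T′ → Embedding Z Z′
product-embedding {m} {n} {S} {S′} {T} {T′} {Z} {Z′} X X′ basesS basesT e f = record
  { embed = φ ; embed-rank = φ-rank ; embed-inj = φ-inj }
  where
  module NonEmpty (F : Face Z) (z : Point (m ℕ.+ n)) (z∈F : faceSet F z) where
    F₁ : RankedFace S
    F₁ = rankedBy basesS (factorₗ X F z z∈F)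
    F₂ : RankedFace T
    F₂ = rankedBy basesT (factorᵣ X F z z∈F)
    G₁ = embed e F₁
    G₂ = embed f F₂
    r₁ : Σ ℕ λ k → rank F₁ ≡ suc k
    r₁ = nonempty-rank (basis F₁) (left m z) (proj₁ (factor-parts X F z z∈F z z∈F))
    r₂ : Σ ℕ λ k → rank F₂ ≡ suc k
    r₂ = nonempty-rank (basis F₂) (right m z) (proj₂ (factor-parts X F z z∈F z z∈F))
    B₁ : Basis (points G₁) (suc (proj₁ r₁))
    B₁ = subst (Basis (points G₁)) (trans (embed-rank e F₁) (proj₂ r₁)) (basis G₁)
    B₂ : Basis (points G₂) (suc (proj₁ r₂))
    B₂ = subst (Basis (points G₂)) (trans (embed-rank f F₂) (proj₂ r₂)) (basis G₂)
    result : RankedFace Z′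
    result = ranked (prodFace X′ (fc G₁) (fc G₂)) (suc (proj₁ r₁ ℕ.+ proj₁ r₂))
      (product-basis (prodFace-parts X′ (fc G₁) (fc G₂)) (prodFace-pair X′ (fc G₁) (fc G₂)) B₁ B₂)
    result-rank : ∀ {k} → Basis (faceSet F) k → rank result ≡ k
    result-rank = Basis-unique (faceSet F) (faceSet F) (λ _ → mk⇔ id id)
      (product-basis (factor-parts X F z z∈F) (factor-pair X F z z∈F)
        (subst (Basis (points F₁)) (proj₂ r₁) (basis F₁)) (subst (Basis (points F₂)) (proj₂ r₂) (basis F₂)))
    cornerPoint : Point (m ℕ.+ n)
    cornerPoint = append (pt B₁ zero) (pt B₂ zero)
    corner : points result cornerPoint
    corner = prodFace-pair X′ (fc G₁) (fc G₂) (pt B₁ zero) (pt B₂ zero) (mem B₁ zero) (mem B₂ zero)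

  open NonEmpty

  φ : RankedFace Z → RankedFace Z′
  -- The empty face offers no point from which to read off factors and is treated apart.
  φ (ranked F zero    B) = emptyRanked
  φ (ranked F (suc k) B) = result F (pt B zero) (mem B zero)

  φ-rank : ∀ F → rank (φ F) ≡ rank F
  φ-rank (ranked F zero    B) = refl
  φ-rank (ranked F (suc k) B) = result-rank F (pt B zero) (mem B zero) B

  module _ (F G : Face Z) (z w : Point (m ℕ.+ n)) (z∈F : faceSet F z) (w∈G : faceSet G w)
      (sub : result F z z∈F ⊑ result G w w∈G) where
    sub-l : G₁ F z z∈F ⊑ G₁ G w w∈G
    sub-l x x∈ = proj₁ x∈ , trans (sym (dot-congʳ (normal (fc (G₁ G w w∈G))) (append-l x y)))
      (proj₂ (proj₁ (prodFace-parts X′ (fc (G₁ G w w∈G)) (fc (G₂ G w w∈G)) (append x y)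
        (sub (append x y) (prodFace-pair X′ (fc (G₁ F z z∈F)) (fc (G₂ F z z∈F)) x y x∈ (mem (B₂ F z z∈F) zero))))))
      where y = pt (B₂ F z z∈F) zero
    sub-r : G₂ F z z∈F ⊑ G₂ G w w∈G
    sub-r y y∈ = proj₁ y∈ , trans (sym (dot-congʳ (normal (fc (G₂ G w w∈G))) (append-r {m = m} x y)))
      (proj₂ (proj₂ (prodFace-parts X′ (fc (G₁ G w w∈G)) (fc (G₂ G w w∈G)) (append x y)
        (sub (append x y) (prodFace-pair X′ (fc (G₁ F z z∈F)) (fc (G₂ F z z∈F)) x y (mem (B₁ F z z∈F) zero) y∈)))))
      where x = pt (B₁ F z z∈F) zero

  result-inj : ∀ F G z w (z∈F : faceSet F z) (w∈G : faceSet G w) → result F z z∈F ≋ result G w w∈G → SameSet (faceSet F) (faceSet G)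
  result-inj F G z w z∈F w∈G eq x = mk⇔
    (λ x∈F → transfer F G z w z∈F w∈G (≋⇒⊑ {F = F₁ F z z∈F} {F₁ G w w∈G} eq₁) (≋⇒⊑ {F = F₂ F z z∈F} {F₂ G w w∈G} eq₂) x∈F)
    (λ x∈G → transfer G F w z w∈G z∈F
      (≋⇒⊑ {F = F₁ G w w∈G} {F₁ F z z∈F} (≋-sym (F₁ F z z∈F) (F₁ G w w∈G) eq₁))
      (≋⇒⊑ {F = F₂ G w w∈G} {F₂ F z z∈F} (≋-sym (F₂ F z z∈F) (F₂ G w w∈G) eq₂)) x∈G)
    where
    eq′ : result G w w∈G ≋ result F z z∈F
    eq′ = ≋-sym (result F z z∈F) (result G w w∈G) eq
    to⊑ : result F z z∈F ⊑ result G w w∈G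
    to⊑ = ≋⇒⊑ {F = result F z z∈F} {result G w w∈G} eq
    from⊑ : result G w w∈G ⊑ result F z z∈F
    from⊑ = ≋⇒⊑ {F = result G w w∈G} {result F z z∈F} eq′
    eq₁ : F₁ F z z∈F ≋ F₁ G w w∈G
    eq₁ = embed-inj e (F₁ F z z∈F) (F₁ G w w∈G) (≋-intro {F = G₁ F z z∈F} {G₁ G w w∈G}
      (sub-l F G z w z∈F w∈G to⊑) (sub-l G F w z w∈G z∈F from⊑))
    eq₂ : F₂ F z z∈F ≋ F₂ G w w∈G
    eq₂ = embed-inj f (F₂ F z z∈F) (F₂ G w w∈G) (≋-intro {F = G₂ F z z∈F} {G₂ G w w∈G}
      (sub-r F G z w z∈F w∈G to⊑) (sub-r G F w z w∈G z∈F from⊑))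
    transfer : ∀ F G z w (z∈F : faceSet F z) (w∈G : faceSet G w) → F₁ F z z∈F ⊑ F₁ G w w∈G → F₂ F z z∈F ⊑ F₂ G w w∈G →
      faceSet F x → faceSet G x
    transfer F G z w z∈F w∈G s₁ s₂ x∈F = factor-join X G w w∈G x (proj₁ x∈F)
      (s₁ (left m x) (proj₁ (factor-parts X F z z∈F x x∈F))) (s₂ (right m x) (proj₂ (factor-parts X F z z∈F x x∈F)))

  empty-points : ∀ x → ¬ points (emptyRanked {S = Z′}) x
  empty-points x x∈ = contradiction (proj₂ (nonempty-rank (basis (emptyRanked {S = Z′})) x x∈)) (λ ())

  φ-inj : ∀ F G → φ F ≋ φ G → F ≋ G
  φ-inj (ranked F zero B) (ranked G zero C) _ x =
    mk⇔ (λ x∈F → contradiction (proj₂ (nonempty-rank B x x∈F)) (λ ()))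
        (λ x∈G → contradiction (proj₂ (nonempty-rank C x x∈G)) (λ ()))
  φ-inj (ranked F zero B) (ranked G (suc l) C) eq = contradiction
    (Equivalence.from (eq u) (corner G (pt C zero) (mem C zero))) (empty-points u)
    where u = cornerPoint G (pt C zero) (mem C zero)
  φ-inj (ranked F (suc k) B) (ranked G zero C) eq = contradiction
    (Equivalence.to (eq u) (corner F (pt B zero) (mem B zero))) (empty-points u)
    where u = cornerPoint F (pt B zero) (mem B zero)
  φ-inj (ranked F (suc k) B) (ranked G (suc l) C) eq =
    result-inj F G (pt B zero) (pt C zero) (mem B zero) (mem C zero) eq

-- Faces of order polytopes

bit : Bool → ℚ
bit true  = 1ℚ
bit false = 0ℚ

ind : ∀ {n} → (Fin n → Bool) → Point n
ind p i = bit (p i)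

bit-nonneg : ∀ b → 0ℚ ≤ bit b
bit-nonneg true  = 0≤1
bit-nonneg false = ℚ.≤-refl

bit-≤1 : ∀ b → bit b ≤ 1ℚ
bit-≤1 true  = ℚ.≤-refl
bit-≤1 false = 0≤1

bit-lattice : ∀ a b → bit (a ∨ b) + bit (a ∧ b) ≡ bit a + bit b
bit-lattice true  true  = refl
bit-lattice true  false = refl
bit-lattice false true  = refl
bit-lattice false false = refl

1≰0 : ¬ 1ℚ ≤ 0ℚ
1≰0 le = ℚ.<-irrefl refl (ℚ.<-≤-trans 0<1 le)

IsFilter : ∀ {n} → BRel n → (Fin n → Bool) → Set
IsFilter R p = ∀ i j → T (R i j) → p i ≡ true → p j ≡ true

bit-mono : ∀ {a b} → (a ≡ true → b ≡ true) → bit a ≤ bit b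
bit-mono {true}  {b} f rewrite f refl = ℚ.≤-refl
bit-mono {false} {b} f = bit-nonneg b

bit-mono⁻ : ∀ {a b} → bit a ≤ bit b → a ≡ true → b ≡ true
bit-mono⁻ {b = true}  _  _    = refl
bit-mono⁻ {b = false} le refl = contradiction le 1≰0

filter⇒vertex : ∀ {n} (R : BRel n) p → IsFilter R p → OrderPolytope R (ind p)
filter⇒vertex R p filter = (λ i → bit-nonneg (p i)) , (λ i → bit-≤1 (p i)) , λ i j Rij → bit-mono (filter i j Rij)

vertex⇒filter : ∀ {n} (R : BRel n) p → OrderPolytope R (ind p) → IsFilter R p
vertex⇒filter R p (_ , _ , mono) i j Rij = bit-mono⁻ (mono i j Rij)

OrderPolytope-resp : ∀ {n} (R : BRel n) {x y} → (∀ i → x i ≡ y i) → OrderPolytope R x → OrderPolytope R y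
OrderPolytope-resp R {x} {y} eq (nonneg , bound , mono) =
  (λ i → subst (0ℚ ≤_) (eq i) (nonneg i)) , (λ i → subst (_≤ 1ℚ) (eq i) (bound i)) ,
  λ i j Rij → subst (_≤ y j) (eq i) (subst (x i ≤_) (eq j) (mono i j Rij))

module _ {n : ℕ} {R : BRel n} (F : Face (OrderPolytope R)) where

  Vertex : (Fin n → Bool) → Set
  Vertex p = faceSet F (ind p)

  faceSet-resp : ∀ {x y} → (∀ i → x i ≡ y i) → faceSet F x → faceSet F y
  faceSet-resp eq (x∈ , on) = OrderPolytope-resp R eq x∈ , trans (dot-congʳ (normal F) (λ i → sym (eq i))) on

  Vertex-resp : ∀ {p q} → (∀ i → p i ≡ q i) → Vertex p → Vertex q
  Vertex-resp eq = faceSet-resp (λ i → cong bit (eq i))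

  Vertex? : ∀ p → Dec (Vertex p)
  Vertex? p = map′ (λ (f , on) → filter⇒vertex R p (λ i j → f i j) , on)
    (λ (v , on) → vertex⇒filter R p v , on)
    (Fin.all? (λ i → Fin.all? (λ j → Bool.T? (R i j) →-dec (p i Bool.≟ true →-dec p j Bool.≟ true)))
      ×-dec dot (normal F) (ind p) ℚ.≟ rhs F)

  -- The indicators of union and intersection have the same sum as those of `p` and `q`. Two valid
  -- inequalities whose sum is tight are both tight.
  Vertex-lattice : ∀ p q → Vertex p → Vertex q → Vertex (λ i → p i ∨ q i) × Vertex (λ i → p i ∧ q i)
  Vertex-lattice p q (p∈ , p-on) (q∈ , q-on) = (∨∈ , proj₁ tight) , (∧∈ , proj₂ tight)
    where
    p∨q p∧q : Fin n → Bool
    p∨q i = p i ∨ q i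
    p∧q i = p i ∧ q i
    or-true : ∀ {a b a′ b′} → (a ≡ true → a′ ≡ true) → (b ≡ true → b′ ≡ true) → a ∨ b ≡ true → a′ ∨ b′ ≡ true
    or-true {true} {a′ = a′} f g _ rewrite f refl = refl
    or-true {false} {a′ = a′} f g eq rewrite g eq = Bool.∨-zeroʳ a′
    and-true : ∀ {a b a′ b′} → (a ≡ true → a′ ≡ true) → (b ≡ true → b′ ≡ true) → a ∧ b ≡ true → a′ ∧ b′ ≡ true
    and-true {true} f g eq rewrite f refl = g eq
    ∨∈ : OrderPolytope R (ind p∨q)
    ∨∈ = filter⇒vertex R p∨q λ i j Rij →
      or-true (vertex⇒filter R p p∈ i j Rij) (vertex⇒filter R q q∈ i j Rij)
    ∧∈ : OrderPolytope R (ind p∧q)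
    ∧∈ = filter⇒vertex R p∧q λ i j Rij →
      and-true (vertex⇒filter R p p∈ i j Rij) (vertex⇒filter R q q∈ i j Rij)
    c = normal F
    tight : dot c (ind p∨q) ≡ rhs F × dot c (ind p∧q) ≡ rhs F
    tight = sum-tight (valid F (ind p∨q) ∨∈) (valid F (ind p∧q) ∧∈)
      (trans (sym (dot-+ʳ c (ind p∨q) (ind p∧q)))
        (trans (dot-congʳ c (λ i → bit-lattice (p i) (q i)))
          (trans (dot-+ʳ c (ind p) (ind q)) (cong₂ _+_ p-on q-on))))

add-sub : ∀ t a → t + (a - t) ≡ a
add-sub = solve-∀ ringℚ

-- A step size for the perturbation in `threshold-vertex`: it does not exceed the distance from `t`
-- to 1 or to any coordinate above `t`.
gap : ∀ {n} (x : Fin n → ℚ) t → t < 1ℚ →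
  Σ ℚ λ η → 0ℚ < η × t + η ≤ 1ℚ × (∀ k → t < x k → t + η ≤ x k)
gap {zero} x t t<1 = 1ℚ - t , subst (_< 1ℚ - t) (ℚ.+-inverseʳ t) (ℚ.+-monoˡ-< (- t) t<1) ,
  ℚ.≤-reflexive (add-sub t 1ℚ) , λ ()
gap {suc n} x t t<1 with gap (x ∘ suc) t t<1 | t ℚ.<? x zero
... | η , 0<η , le , below | no t≮x₀ = η , 0<η , le , λ where
  zero    t<x₀ → contradiction t<x₀ t≮x₀
  (suc k) → below k
... | η , 0<η , le , below | yes t<x₀ with ℚ.≤-total η (x zero - t)
...   | inj₁ η≤ = η , 0<η , le , λ where
  zero    _ → subst (t + η ≤_) (add-sub t (x zero)) (ℚ.+-monoʳ-≤ t η≤)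
  (suc k) → below k
...   | inj₂ ≤η = x zero - t , subst (_< x zero - t) (ℚ.+-inverseʳ t) (ℚ.+-monoˡ-< (- t) t<x₀) ,
  ℚ.≤-trans (ℚ.+-monoʳ-≤ t ≤η) le , λ where
  zero    _   → ℚ.≤-reflexive (add-sub t (x zero))
  (suc k) t<x → ℚ.≤-trans (ℚ.+-monoʳ-≤ t ≤η) (below k t<x)

decided : ∀ {P : Set} (d : Dec P) → (P × does d ≡ true) ⊎ (¬ P × does d ≡ false)
decided (yes p) = inj₁ (p , refl)
decided (no ¬p) = inj₂ (¬p , refl)

does-true : ∀ {P : Set} (d : Dec P) → P → does d ≡ true
does-true (yes _) _ = refl
does-true (no ¬p) p = contradiction p ¬p

true-does : ∀ {P : Set} (d : Dec P) → does d ≡ true → P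
true-does (yes p) _ = p

does-false : ∀ {P : Set} (d : Dec P) → ¬ P → does d ≡ false
does-false (yes p) ¬p = contradiction p ¬p
does-false (no _)  _  = refl

above : ∀ {n} → Point n → ℚ → Fin n → Bool
above x t i = does (t ℚ.<? x i)

-- Moving from x away from the indicator u of {x > t} stays in the polytope for a short while,
-- so a valid inequality that is tight at x is tight at u.
threshold-vertex : ∀ {n} {R : BRel n} (F : Face (OrderPolytope R)) x → faceSet F x → ∀ t → 0ℚ ≤ t → t < 1ℚ →
  Vertex F (above x t)
threshold-vertex {n} {R} F x ((nonneg , bound , mono) , on) t 0≤t t<1 = u∈ , ℚ.≤-antisym (valid F u u∈) δ≤
  where
  η = proj₁ (gap x t t<1)
  0<η = proj₁ (proj₂ (gap x t t<1))
  0≤η = ℚ.<⇒≤ 0<η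
  t+η≤1 = proj₁ (proj₂ (proj₂ (gap x t t<1)))
  t+η≤x = proj₂ (proj₂ (proj₂ (gap x t t<1)))
  u : Point n
  u = ind (above x t)
  y : Point n
  y i = x i + η * (x i - u i)
  u-cases : ∀ i → (t < x i × u i ≡ 1ℚ) ⊎ (x i ≤ t × u i ≡ 0ℚ)
  u-cases i = cases (decided (t ℚ.<? x i))
    where
    cases : _ → (t < x i × u i ≡ 1ℚ) ⊎ (x i ≤ t × u i ≡ 0ℚ)
    cases (inj₁ (t<x , eq)) = inj₁ (t<x , cong bit eq)
    cases (inj₂ (t≮x , eq)) = inj₂ (ℚ.≮⇒≥ t≮x , cong bit eq)
  u∈ : OrderPolytope R u
  u∈ = filter⇒vertex R (above x t) λ i j Rij → up i j Rij
    where
    up : ∀ i j → T (R i j) → above x t i ≡ true → above x t j ≡ true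
    up i j Rij eq = does-true (t ℚ.<? x j) (ℚ.<-≤-trans (true-does (t ℚ.<? x i) eq) (mono i j Rij))
  value : ∀ {i a} → u i ≡ a → y i ≡ x i + η * (x i - a)
  value {i} eq = cong (λ a → x i + η * (x i - a)) eq
  y-nonneg : ∀ i → 0ℚ ≤ y i
  y-nonneg i = cases (u-cases i)
    where
    lem₁ : ∀ x t η → (x - (t + η)) + (t + η * x) ≡ x + η * (x - 1ℚ)
    lem₁ = solve-∀ ringℚ
    lem₀ : ∀ x η → x + η * x ≡ x + η * (x - 0ℚ)
    lem₀ = solve-∀ ringℚ
    cases : _ → 0ℚ ≤ y i
    cases (inj₁ (t<x , eq)) = subst (0ℚ ≤_) (trans (lem₁ (x i) t η) (sym (value eq)))
      (0≤+ (≤-sub (t+η≤x i t<x)) (0≤+ 0≤t (0≤* 0≤η (nonneg i))))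
    cases (inj₂ (_ , eq)) = subst (0ℚ ≤_) (trans (lem₀ (x i) η) (sym (value eq))) (0≤+ (nonneg i) (0≤* 0≤η (nonneg i)))
  y-bound : ∀ i → y i ≤ 1ℚ
  y-bound i = cases (u-cases i)
    where
    lem₁ : ∀ x η → (1ℚ - x) + η * (1ℚ - x) ≡ 1ℚ - (x + η * (x - 1ℚ))
    lem₁ = solve-∀ ringℚ
    lem₀ : ∀ x t η → (1ℚ - (t + η)) + ((t - x) + η * (1ℚ - x)) ≡ 1ℚ - (x + η * (x - 0ℚ))
    lem₀ = solve-∀ ringℚ
    cases : _ → y i ≤ 1ℚ
    cases (inj₁ (t<x , eq)) = ≤-add (subst (0ℚ ≤_) (trans (lem₁ (x i) η) (cong (λ z → 1ℚ - z) (sym (value eq))))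
      (0≤+ (≤-sub (bound i)) (0≤* 0≤η (≤-sub (bound i)))))
    cases (inj₂ (x≤t , eq)) = ≤-add (subst (0ℚ ≤_) (trans (lem₀ (x i) t η) (cong (λ z → 1ℚ - z) (sym (value eq))))
      (0≤+ (≤-sub t+η≤1) (0≤+ (≤-sub x≤t) (0≤* 0≤η (≤-sub (bound i))))))
  y-mono : ∀ i j → T (R i j) → y i ≤ y j
  y-mono i j Rij = cases (u-cases i) (u-cases j)
    where
    step = ≤-sub (mono i j Rij)
    both : ∀ a → u i ≡ a → u j ≡ a → y i ≤ y j
    both a p q = ≤-add (subst (0ℚ ≤_) (trans (lem (x i) (x j) η a) (sym (cong₂ _-_ (value q) (value p))))
      (0≤+ step (0≤* 0≤η step)))
      where
      lem : ∀ x y η a → (y - x) + η * (y - x) ≡ y + η * (y - a) - (x + η * (x - a))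
      lem = solve-∀ ringℚ
    cases : _ → _ → y i ≤ y j
    cases (inj₁ (_ , p)) (inj₁ (_ , q)) = both 1ℚ p q
    cases (inj₂ (_ , p)) (inj₂ (_ , q)) = both 0ℚ p q
    cases (inj₁ (t<x , _)) (inj₂ (x≤t , _)) = contradiction (ℚ.<-≤-trans t<x (ℚ.≤-trans (mono i j Rij) x≤t)) (ℚ.<-irrefl refl)
    -- The pair straddles the threshold: the perturbation costs `y j` the amount η, and the gap
    -- between `x i` and `x j` makes up for it.
    cases (inj₂ (x≤t , p)) (inj₁ (t<x , q)) = ≤-add (subst (0ℚ ≤_)
      (trans (lem (x i) (x j) t η) (sym (cong₂ _-_ (value q) (value p))))
      (0≤+ (≤-sub (t+η≤x j t<x)) (0≤+ (≤-sub x≤t) (0≤* 0≤η step))))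
      where
      lem : ∀ x y t η → (y - (t + η)) + ((t - x) + η * (y - x)) ≡ y + η * (y - 1ℚ) - (x + η * (x - 0ℚ))
      lem = solve-∀ ringℚ
  c = normal F
  δ = rhs F
  dot-y : dot c y ≡ δ + η * (δ - dot c u)
  dot-y = trans (dot-congʳ c (λ i → lem (x i) η (u i)))
    (trans (dot-+ʳ c x (λ i → η * (x i + (- 1ℚ) * u i)))
      (cong₂ _+_ on (trans (dot-*ʳ c (λ i → x i + (- 1ℚ) * u i) η)
        (cong (η *_) (trans (dot-+ʳ c x (λ i → (- 1ℚ) * u i))
          (trans (cong₂ _+_ on (dot-*ʳ c u (- 1ℚ))) (lem₂ δ (dot c u))))))))
    where
    lem : ∀ x η u → x + η * (x - u) ≡ x + η * (x + (- 1ℚ) * u)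
    lem = solve-∀ ringℚ
    lem₂ : ∀ d e → d + (- 1ℚ) * e ≡ d - e
    lem₂ = solve-∀ ringℚ
  excess : 0ℚ ≤ η * (dot c u - δ)
  excess = subst (0ℚ ≤_) (trans (cong (λ z → δ - z) dot-y) (lem δ η (dot c u))) (≤-sub (valid F y (y-nonneg , y-bound , y-mono)))
    where
    lem : ∀ d η e → d - (d + η * (d - e)) ≡ η * (e - d)
    lem = solve-∀ ringℚ
  η≢0 : η ≢ 0ℚ
  η≢0 eq = ℚ.<-irrefl (sym eq) 0<η
  δ≤ : δ ≤ dot c u
  δ≤ = ≤-add (subst (0ℚ ≤_) cancel (0≤* {b} (0≤1/ {η} {b} 0<η (proj₂ (inverse η≢0))) excess))
    where
    b = proj₁ (inverse η≢0)
    cancel : b * (η * (dot c u - δ)) ≡ dot c u - δ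
    cancel = trans (sym (ℚ.*-assoc b η (dot c u - δ)))
      (trans (cong (_* (dot c u - δ)) (proj₂ (inverse η≢0))) (ℚ.*-identityˡ (dot c u - δ)))

-- Level functions

level≥ : ∀ {n} → (Fin n → ℕ) → ℕ → Fin n → Bool
level≥ ℓ s i = does (s ℕ.≤? ℓ i)

-- A chain of M vertices {ℓ ≥ 1} ⊇ … ⊇ {ℓ ≥ M} of the face F that affinely spans it:
-- the points of F are constant on the levels of ℓ, with value 0 on level 0 and 1 on level M.
record Levels {n : ℕ} {R : BRel n} (F : Face (OrderPolytope R)) (M : ℕ) : Set where
  field
    ℓ         : Fin n → ℕ
    ℓ≤M       : ∀ i → ℓ i ℕ.≤ M
    vertex    : ∀ s → 1 ℕ.≤ s → s ℕ.≤ M → Vertex F (level≥ ℓ s)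
    level     : ∀ x → faceSet F x → ∀ i j → ℓ i ≡ ℓ j → x i ≡ x j
    bottom    : ∀ x → faceSet F x → ∀ i → ℓ i ≡ 0 → x i ≡ 0ℚ
    top       : ∀ x → faceSet F x → ∀ i → ℓ i ≡ M → x i ≡ 1ℚ
    positive  : ∀ x → faceSet F x → 1 ℕ.≤ M

-- Each of the inner levels 1, ..., M - 1 is a free coordinate of the face, which gives dimension M
-- - 1. The outer levels 0 and M have fixed values and may be empty.
Inhabited : ∀ {n} {R : BRel n} {F : Face (OrderPolytope R)} {M} → Levels F M → Set
Inhabited {n} {M = M} L = ∀ s → 1 ℕ.≤ s → s ℕ.< M → Σ (Fin n) λ i → Levels.ℓ L i ≡ s

below : ℕ → ℕ → ℚ
below a s = bit (does (suc a ℕ.≤? s))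

-- The value on level `s` of the combination of the level sets with coefficients `μ`, that is, the
-- sum of the first `s` coefficients.
staircase : ∀ M → (Fin M → ℚ) → ℕ → ℚ
staircase M μ s = sumℚ (λ j → μ j * below (toℕ j) s)

staircase-zero : ∀ M (μ : Fin M → ℚ) → (∀ s → s ℕ.≤ M → staircase M μ s ≡ 0ℚ) → ∀ j → μ j ≡ 0ℚ
staircase-zero (suc M) μ eq = λ { zero → first ; (suc j) → staircase-zero M (μ ∘ suc) rest j }
  where
  first : μ zero ≡ 0ℚ
  first = trans (sym (trans (cong₂ _+_ (ℚ.*-identityʳ (μ zero)) (sum-zero (λ j → ℚ.*-zeroʳ (μ (suc j)))))
    (ℚ.+-identityʳ (μ zero)))) (eq 1 (s≤s z≤n))
  rest : ∀ s → s ℕ.≤ M → staircase M (μ ∘ suc) s ≡ 0ℚ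
  rest s s≤M = trans (sym (trans (cong (λ z → z * 1ℚ + staircase M (μ ∘ suc) s) first)
    (trans (cong (_+ staircase M (μ ∘ suc) s) (ℚ.*-zeroˡ 1ℚ)) (ℚ.+-identityˡ _)))) (eq (suc s) (s≤s s≤M))

increments : (M : ℕ) → (ℕ → ℚ) → Fin M → ℚ
increments M g j = g (suc (toℕ j)) - g (toℕ j)

telescope : ∀ M g s → s ℕ.≤ M → staircase M (increments M g) s ≡ g s - g 0
telescope zero    g zero z≤n = sym (ℚ.+-inverseʳ (g 0))
telescope (suc M) g zero z≤n = trans (sum-zero (λ j → ℚ.*-zeroʳ (increments (suc M) g j))) (sym (ℚ.+-inverseʳ (g 0)))
telescope (suc M) g (suc s) (s≤s s≤M) = trans (cong ((g 1 - g 0) * 1ℚ +_) (telescope M (g ∘ suc) s s≤M)) (lem (g 1) (g 0) (g (suc s)))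
  where
  lem : ∀ a b c → (a - b) * 1ℚ + (c - a) ≡ c - b
  lem = solve-∀ ringℚ

telescope-sum : ∀ M g → sumℚ (increments M g) ≡ g M - g 0
telescope-sum zero    g = sym (ℚ.+-inverseʳ (g 0))
telescope-sum (suc M) g = trans (cong (g 1 - g 0 +_) (telescope-sum M (g ∘ suc))) (lem (g 1) (g 0) (g (suc M)))
  where
  lem : ∀ a b c → a - b + (c - a) ≡ c - b
  lem = solve-∀ ringℚ

-- The system is triangular: the partial sums of the coefficients are the values on the levels.
-- Independence follows since all partial sums vanish, and a point of the face is spanned with the
-- increments of its level values as coefficients.
levels-basis : ∀ {n} {R : BRel n} (F : Face (OrderPolytope R)) {M} (L : Levels F M) → Inhabited L →
  Basis (faceSet F) M
levels-basis {n} {R} F {M} L inhabited = record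
  { pt    = p
  ; mem   = λ j → vertex (suc (toℕ j)) (s≤s z≤n) (Fin.toℕ<n j)
  ; indep = λ μ eq → staircase-zero M μ (partial μ eq)
  ; span  = λ x x∈ → increments M (value x) , λ where
      zero    → trans (sum-*1 (increments M (value x))) (trans (telescope-sum M (value x))
                  (cong₂ _-_ (value-M x x∈) (value-0 x x∈)))
      (suc i) → trans (telescope M (value x) (ℓ i) (ℓ≤M i))
                  (trans (cong₂ _-_ (value-ℓ x x∈ i) (value-0 x x∈)) (lem (x i))) }
  where
  open Levels L
  p : Fin M → Point n
  p j = ind (level≥ ℓ (suc (toℕ j)))
  lem : ∀ a → a - 0ℚ ≡ a
  lem = solve-∀ ringℚ
  partial : ∀ μ → (∀ i → comb μ (hom ∘ p) i ≡ 0ℚ) → ∀ s → s ℕ.≤ M → staircase M μ s ≡ 0ℚ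
  partial μ eq zero s≤M = sum-zero (λ j → ℚ.*-zeroʳ (μ j))
  partial μ eq (suc s) s≤M with suc s ℕ.<? M
  ... | yes s<M = trans (cong (staircase M μ) (sym (proj₂ (inhabited (suc s) (s≤s z≤n) s<M))))
                    (eq (suc (proj₁ (inhabited (suc s) (s≤s z≤n) s<M))))
  -- Level M may have no element, but the M-th partial sum is the total, which the homogenising
  -- coordinate controls.
  ... | no s≮M = trans (sum-cong (λ j → cong (μ j *_) (cong bit (does-true (suc (toℕ j) ℕ.≤? suc s)
                   (ℕ.≤-trans (Fin.toℕ<n j) (ℕ.≮⇒≥ s≮M)))))) (eq zero)
  value′ : (x : Point n) → ∀ s → Dec (Σ (Fin n) λ i → ℓ i ≡ s) → ℚ
  value′ x s (yes (i , _)) = x i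
  -- Up to M only the levels 0 and M can be empty, and this default gives them their values 0 and 1.
  value′ x s (no _)        = bit (does (M ℕ.≟ s))
  value : Point n → ℕ → ℚ
  value x s = value′ x s (Fin.any? (λ i → ℓ i ℕ.≟ s))
  value-ℓ : ∀ x → faceSet F x → ∀ i → value x (ℓ i) ≡ x i
  value-ℓ x x∈ i with Fin.any? (λ j → ℓ j ℕ.≟ ℓ i)
  ... | yes (j , eq) = level x x∈ j i eq
  ... | no none      = contradiction (i , refl) none
  value-0 : ∀ x → faceSet F x → value x 0 ≡ 0ℚ
  value-0 x x∈ with Fin.any? (λ i → ℓ i ℕ.≟ 0)
  ... | yes (i , eq) = bottom x x∈ i eq
  ... | no _         = cong bit (does-false (M ℕ.≟ 0) λ M≡0 →
                         contradiction (subst (1 ℕ.≤_) M≡0 (positive x x∈)) (λ ()))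
  value-M : ∀ x → faceSet F x → value x M ≡ 1ℚ
  value-M x x∈ with Fin.any? (λ i → ℓ i ℕ.≟ M)
  ... | yes (i , eq) = top x x∈ i eq
  ... | no _         = cong bit (does-true (M ℕ.≟ M) refl)

-- Closes the gap left by an empty level s.
drop : ℕ → ℕ → ℕ
drop s a with s ℕ.<? a
... | yes _ = ℕ.pred a
... | no _  = a

drop-above : ∀ {s a} → s ℕ.< a → suc (drop s a) ≡ a
drop-above {s} {a} s<a with s ℕ.<? a
drop-above {s} {suc a} s<a | yes _ = refl
... | no s≮a = contradiction s<a s≮a

drop-below : ∀ {s a} → a ℕ.< s → drop s a ≡ a
drop-below {s} {a} a<s with s ℕ.<? a
... | yes s<a = contradiction s<a (ℕ.<-asym a<s)
... | no _    = refl

module _ {n : ℕ} {R : BRel n} {F : Face (OrderPolytope R)} where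

  -- When level `s` is empty, `{ℓ ≥ s}` and `{ℓ ≥ s + 1}` are the same vertex, so one of them can be
  -- omitted from the chain.
  skip : ∀ {M} (L : Levels F (suc M)) s → 1 ℕ.≤ s → s ℕ.≤ M → ¬ (Σ (Fin n) λ i → Levels.ℓ L i ≡ s) → Levels F M
  skip {M} L s 1≤s s≤M empty = record
    { ℓ = ℓ′ ; ℓ≤M = ℓ′≤M
    ; vertex = vertex′
    ; level = λ x x∈ i j eq → level x x∈ i j (ℓ′-inj i j eq)
    ; bottom = λ x x∈ i eq → bottom x x∈ i (ℓ′-zero i eq)
    ; top = λ x x∈ i eq → top x x∈ i (ℓ′-top i eq)
    ; positive = λ _ _ → ℕ.≤-trans 1≤s s≤M }
    where
    open Levels L
    ℓ′ : Fin n → ℕ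
    ℓ′ i = drop s (ℓ i)
    sides : ∀ i → (ℓ i ℕ.< s × ℓ′ i ≡ ℓ i) ⊎ (s ℕ.< ℓ i × suc (ℓ′ i) ≡ ℓ i)
    sides i with ℕ.<-cmp (ℓ i) s
    ... | tri< lt _ _ = inj₁ (lt , drop-below lt)
    ... | tri≈ _ eq _ = contradiction (i , eq) empty
    ... | tri> _ _ gt = inj₂ (gt , drop-above gt)
    ℓ′≤M : ∀ i → ℓ′ i ℕ.≤ M
    ℓ′≤M i with sides i
    ... | inj₁ (lt , eq) = subst (ℕ._≤ M) (sym eq) (ℕ.≤-trans (ℕ.<⇒≤ lt) s≤M)
    ... | inj₂ (gt , eq) = ℕ.≤-pred (subst (ℕ._≤ suc M) (sym eq) (ℓ≤M i))
    ℓ′-inj : ∀ i j → ℓ′ i ≡ ℓ′ j → ℓ i ≡ ℓ j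
    ℓ′-inj i j e with sides i | sides j
    ... | inj₁ (_ , p)  | inj₁ (_ , q)  = trans (sym p) (trans e q)
    ... | inj₂ (_ , p)  | inj₂ (_ , q)  = trans (sym p) (trans (cong suc e) q)
    ... | inj₁ (lt , p) | inj₂ (gt , q) = contradiction (subst (s ℕ.<_) (trans (sym q) (cong suc (trans (sym e) p))) gt) (ℕ.≤⇒≯ lt)
    ... | inj₂ (gt , p) | inj₁ (lt , q) = contradiction (subst (s ℕ.<_) (trans (sym p) (cong suc (trans e q))) gt) (ℕ.≤⇒≯ lt)
    ℓ′-zero : ∀ i → ℓ′ i ≡ 0 → ℓ i ≡ 0
    ℓ′-zero i e with sides i
    ... | inj₁ (_ , p)  = trans (sym p) e
    ... | inj₂ (gt , p) = contradiction (subst (s ℕ.<_) (trans (sym p) (cong suc e)) gt) (ℕ.≤⇒≯ 1≤s)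
    ℓ′-top : ∀ i → ℓ′ i ≡ M → ℓ i ≡ suc M
    ℓ′-top i e with sides i
    ... | inj₁ (lt , p) = contradiction (subst (ℕ._< s) (trans (sym p) e) lt) (ℕ.≤⇒≯ s≤M)
    ... | inj₂ (_ , p)  = trans (sym p) (cong suc e)
    vertex′ : ∀ t → 1 ℕ.≤ t → t ℕ.≤ M → Vertex F (level≥ ℓ′ t)
    vertex′ t 1≤t t≤M with t ℕ.≤? s
    ... | yes t≤s = Vertex-resp F (λ i → does-⇔ (mk⇔ (fw i) (bw i)) (t ℕ.≤? ℓ i) (t ℕ.≤? ℓ′ i)) (vertex t 1≤t (ℕ.m≤n⇒m≤1+n t≤M))
      where
      fw : ∀ i → t ℕ.≤ ℓ i → t ℕ.≤ ℓ′ i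
      fw i le with sides i
      ... | inj₁ (_ , p)  = subst (t ℕ.≤_) (sym p) le
      ... | inj₂ (gt , p) = ℕ.≤-trans t≤s (ℕ.≤-pred (subst (s ℕ.<_) (sym p) gt))
      bw : ∀ i → t ℕ.≤ ℓ′ i → t ℕ.≤ ℓ i
      bw i le with sides i
      ... | inj₁ (_ , p)  = subst (t ℕ.≤_) p le
      ... | inj₂ (gt , p) = ℕ.≤-trans t≤s (ℕ.<⇒≤ gt)
    ... | no t≰s = Vertex-resp F (λ i → does-⇔ (mk⇔ (fw i) (bw i)) (suc t ℕ.≤? ℓ i) (t ℕ.≤? ℓ′ i)) (vertex (suc t) (s≤s z≤n) (s≤s t≤M))
      where
      s<t = ℕ.≰⇒> t≰s
      fw : ∀ i → suc t ℕ.≤ ℓ i → t ℕ.≤ ℓ′ i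
      fw i le with sides i
      ... | inj₁ (lt , _) = contradiction (ℕ.≤-trans s<t (ℕ.<⇒≤ le)) (ℕ.<⇒≱ (ℕ.m≤n⇒m≤1+n lt))
      ... | inj₂ (_ , p)  = ℕ.≤-pred (subst (suc t ℕ.≤_) (sym p) le)
      bw : ∀ i → t ℕ.≤ ℓ′ i → suc t ℕ.≤ ℓ i
      bw i le with sides i
      ... | inj₁ (lt , p) = contradiction (ℕ.<-≤-trans s<t (subst (t ℕ.≤_) p le)) (ℕ.<⇒≱ (ℕ.m≤n⇒m≤1+n lt))
      ... | inj₂ (_ , p)  = subst (suc t ℕ.≤_) p (s≤s le)

  compress : ∀ {M} → Levels F M → Σ ℕ λ k → Σ (Levels F k) Inhabited
  compress {zero}  L = 0 , L , λ _ _ ()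
  compress {suc M} L with Fin.any? (λ (s : Fin M) → ¬? (Fin.any? (λ i → Levels.ℓ L i ℕ.≟ suc (toℕ s))))
  ... | yes (s , empty) = compress (skip L (suc (toℕ s)) (s≤s z≤n) (Fin.toℕ<n s) empty)
  ... | no none = suc M , L , inhabited
    where
    inhabited : Inhabited L
    inhabited (suc s) _ (s≤s s<M) with Fin.any? (λ i → Levels.ℓ L i ℕ.≟ suc s)
    ... | yes found = found
    ... | no empty  = contradiction
      (fromℕ< s<M , subst (λ t → ¬ (Σ (Fin n) λ i → Levels.ℓ L i ≡ suc t)) (sym (Fin.toℕ-fromℕ< s<M)) empty) none

-- Separating the vertices of a face by a level function

bitℕ : Bool → ℕ
bitℕ true  = 1
bitℕ false = 0

double-≤ : ∀ a l → a ℕ.+ a ℕ.≤ suc (l ℕ.+ l) → a ℕ.≤ l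
double-≤ zero    l       _  = z≤n
double-≤ (suc a) zero    (s≤s le) rewrite ℕ.+-suc a a = contradiction le (λ ())
double-≤ (suc a) (suc l) (s≤s le) rewrite ℕ.+-suc a a | ℕ.+-suc l l = s≤s (double-≤ a l (ℕ.≤-pred le))

even-≤ : ∀ a b l → a ℕ.+ a ℕ.≤ bitℕ b ℕ.+ (l ℕ.+ l) → a ℕ.≤ l
even-≤ a true  l le = double-≤ a l le
even-≤ a false l le = double-≤ a l (ℕ.m≤n⇒m≤1+n le)

even-≥ : ∀ a b l → a ℕ.≤ l → a ℕ.+ a ℕ.≤ bitℕ b ℕ.+ (l ℕ.+ l)
even-≥ a b l le = ℕ.≤-trans (ℕ.+-mono-≤ le le) (ℕ.m≤n+m (l ℕ.+ l) (bitℕ b))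

odd-≤ : ∀ a b l → suc (a ℕ.+ a) ℕ.≤ bitℕ b ℕ.+ (l ℕ.+ l) → suc a ℕ.≤ l ⊎ (a ℕ.≤ l × T b)
odd-≤ a true  l (s≤s le) = inj₂ (double-≤ a l (ℕ.m≤n⇒m≤1+n le) , tt)
odd-≤ a false l le with suc a ℕ.≤? l
... | yes a<l = inj₁ a<l
... | no a≮l  = contradiction le (ℕ.≤⇒≯ (ℕ.+-mono-≤ (ℕ.≮⇒≥ a≮l) (ℕ.≮⇒≥ a≮l)))

odd-≥ : ∀ a b l → suc a ℕ.≤ l ⊎ (a ℕ.≤ l × T b) → suc (a ℕ.+ a) ℕ.≤ bitℕ b ℕ.+ (l ℕ.+ l)
odd-≥ a b    l (inj₁ a<l)       = ℕ.≤-trans (ℕ.+-mono-≤ a<l (ℕ.<⇒≤ a<l)) (ℕ.m≤n+m (l ℕ.+ l) (bitℕ b))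
odd-≥ a true l (inj₂ (a≤l , _)) = s≤s (ℕ.+-mono-≤ a≤l a≤l)

double-inj : ∀ a b l l′ → bitℕ a ℕ.+ (l ℕ.+ l) ≡ bitℕ b ℕ.+ (l′ ℕ.+ l′) → a ≡ b × l ≡ l′
double-inj a b l l′ eq = bits a b (subst (λ k → bitℕ a ℕ.+ (l ℕ.+ l) ≡ bitℕ b ℕ.+ (k ℕ.+ k)) (sym l≡l′) eq) , l≡l′
  where
  l≡l′ : l ≡ l′
  l≡l′ = ℕ.≤-antisym (even-≤ l b l′ (subst (l ℕ.+ l ℕ.≤_) eq (ℕ.m≤n+m (l ℕ.+ l) (bitℕ a))))
    (even-≤ l′ a l (subst (l′ ℕ.+ l′ ℕ.≤_) (sym eq) (ℕ.m≤n+m (l′ ℕ.+ l′) (bitℕ b))))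
  bits : ∀ a b → bitℕ a ℕ.+ (l ℕ.+ l) ≡ bitℕ b ℕ.+ (l ℕ.+ l) → a ≡ b
  bits true  true  _ = refl
  bits false false _ = refl
  bits true  false e = contradiction e ℕ.1+n≢n
  bits false true  e = contradiction (sym e) ℕ.1+n≢n

parity : ∀ s → Σ ℕ λ a → s ≡ a ℕ.+ a ⊎ s ≡ suc (a ℕ.+ a)
parity zero = 0 , inj₁ refl
parity (suc s) with parity s
... | a , inj₁ refl = a , inj₂ refl
... | a , inj₂ refl = suc a , inj₁ (cong suc (sym (ℕ.+-suc a a)))

-- The conditions of `Levels`, demanded only for the vertices of `F` that occur in `vs`, so that the
-- vertices can be processed one at a time.
record Separation {n : ℕ} {R : BRel n} (F : Face (OrderPolytope R)) (vs : List (Vec Bool n)) : Set where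
  field
    M         : ℕ
    ℓ         : Fin n → ℕ
    ℓ≤M       : ∀ i → ℓ i ℕ.≤ M
    vertex    : ∀ s → 1 ℕ.≤ s → s ℕ.≤ M → Vertex F (level≥ ℓ s)
    level     : ∀ {v} → v ∈ vs → Vertex F (lookup v) → ∀ i j → ℓ i ≡ ℓ j → lookup v i ≡ lookup v j
    bottom    : ∀ {v} → v ∈ vs → Vertex F (lookup v) → ∀ i → ℓ i ≡ 0 → lookup v i ≡ false
    top       : ∀ {v} → v ∈ vs → Vertex F (lookup v) → ∀ i → ℓ i ≡ M → lookup v i ≡ true
    positive  : ∀ {v} → v ∈ vs → Vertex F (lookup v) → 1 ℕ.≤ M

module _ {n : ℕ} {R : BRel n} {F : Face (OrderPolytope R)} where

  -- Every level is cut in two by p; in the sequence of level sets this inserts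
  -- {ℓ > a} ∪ ({ℓ ≥ a} ∩ p), which is a vertex of F because the vertices of F form a lattice.
  refine : ∀ {vs} v → Vertex F (lookup v) → Separation F vs → Separation F (v ∷ vs)
  refine {vs} v v∈F sep = record
    { M = M′ ; ℓ = ℓ′ ; ℓ≤M = ℓ′≤M′ ; vertex = vertex′
    ; level    = λ { (here refl) _ i j eq → proj₁ (split i j eq)
                   ; (there w∈) w∈F i j eq → level w∈ w∈F i j (proj₂ (split i j eq)) }
    ; bottom   = λ { (here refl) _ i eq → proj₁ (split₀ i eq) ; (there w∈) w∈F i eq → bottom w∈ w∈F i (proj₂ (split₀ i eq)) }
    ; top      = λ { (here refl) _ i eq → proj₁ (split₁ i eq) ; (there w∈) w∈F i eq → top w∈ w∈F i (proj₂ (split₁ i eq)) }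
    ; positive = λ _ _ → s≤s z≤n }
    where
    open Separation sep
    p = lookup v
    -- The M + 1 levels 0, ..., M split into 2M + 2 levels, numbered from 0 to 2M + 1.
    M′ = suc (M ℕ.+ M)
    ℓ′ : Fin n → ℕ
    ℓ′ i = bitℕ (p i) ℕ.+ (ℓ i ℕ.+ ℓ i)
    ℓ′≤M′ : ∀ i → ℓ′ i ℕ.≤ M′
    ℓ′≤M′ i = ℕ.+-mono-≤ (bit≤1 (p i)) (ℕ.+-mono-≤ (ℓ≤M i) (ℓ≤M i))
      where
      bit≤1 : ∀ b → bitℕ b ℕ.≤ 1
      bit≤1 true  = s≤s z≤n
      bit≤1 false = z≤n
    split : ∀ i j → ℓ′ i ≡ ℓ′ j → p i ≡ p j × ℓ i ≡ ℓ j
    split i j = double-inj (p i) (p j) (ℓ i) (ℓ j)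
    split₀ : ∀ i → ℓ′ i ≡ 0 → p i ≡ false × ℓ i ≡ 0
    split₀ i = double-inj (p i) false (ℓ i) 0
    split₁ : ∀ i → ℓ′ i ≡ M′ → p i ≡ true × ℓ i ≡ M
    split₁ i = double-inj (p i) true (ℓ i) M
    vertex′ : ∀ s → 1 ℕ.≤ s → s ℕ.≤ M′ → Vertex F (level≥ ℓ′ s)
    vertex′ s 1≤s s≤M′ with parity s
    ... | zero  , inj₁ refl = contradiction 1≤s (λ ())
    ... | suc a , inj₁ refl = Vertex-resp F
      (λ i → does-⇔ (mk⇔ (even-≥ (suc a) (p i) (ℓ i)) (even-≤ (suc a) (p i) (ℓ i))) (suc a ℕ.≤? ℓ i) (suc a ℕ.+ suc a ℕ.≤? ℓ′ i))
      (vertex (suc a) (s≤s z≤n) (double-≤ (suc a) M s≤M′))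
    ... | a , inj₂ refl = Vertex-resp F
      (λ i → does-⇔ (mk⇔ (odd-≥ a (p i) (ℓ i)) (odd-≤ a (p i) (ℓ i)))
        ((suc a ℕ.≤? ℓ i) ⊎-dec ((a ℕ.≤? ℓ i) ×-dec Bool.T? (p i))) (suc (a ℕ.+ a) ℕ.≤? ℓ′ i))
      (inserted (double-≤ a M (ℕ.m≤n⇒m≤1+n (ℕ.≤-pred s≤M′))))
      where
      -- At the two ends a level set of `ℓ` is not among the given vertices: `{ℓ ≥ M + 1}` is empty
      -- and `{ℓ ≥ 0}` is everything. The union and the intersection with it change nothing.
      upper : ∀ {q} → Vertex F q → Dec (suc a ℕ.≤ M) → Vertex F (λ i → level≥ ℓ (suc a) i ∨ q i)
      upper {q} q∈ (yes a<M) = proj₁ (Vertex-lattice F (level≥ ℓ (suc a)) q (vertex (suc a) (s≤s z≤n) a<M) q∈)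
      upper {q} q∈ (no a≮M) = Vertex-resp F
        (λ i → cong (_∨ q i) (sym (does-false (suc a ℕ.≤? ℓ i) (λ a<ℓ → a≮M (ℕ.≤-trans a<ℓ (ℓ≤M i)))))) q∈
      lower : ∀ a → a ℕ.≤ M → Vertex F (λ i → level≥ ℓ a i ∧ p i)
      lower zero    _   = v∈F
      lower (suc a) a<M = proj₂ (Vertex-lattice F (level≥ ℓ (suc a)) p (vertex (suc a) (s≤s z≤n) a<M) v∈F)
      inserted : a ℕ.≤ M → Vertex F (λ i → level≥ ℓ (suc a) i ∨ (level≥ ℓ a i ∧ p i))
      inserted a≤M = upper (lower a a≤M) (suc a ℕ.≤? M)

  separate : ∀ vs → Separation F vs
  separate [] = record
    { M = 0 ; ℓ = λ _ → 0 ; ℓ≤M = λ _ → z≤n ; vertex = λ { (suc s) _ () }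
    ; level = λ () ; bottom = λ () ; top = λ () ; positive = λ () }
  separate (v ∷ vs) = cases (Vertex? F (lookup v))
    where
    cases : Dec (Vertex F (lookup v)) → Separation F (v ∷ vs)
    cases (yes v∈F) = refine v v∈F (separate vs)
    cases (no v∉F)  = record
      { M = M ; ℓ = ℓ ; ℓ≤M = ℓ≤M ; vertex = vertex
      ; level    = λ { (here refl) v∈F → contradiction v∈F v∉F ; (there w∈) → level w∈ }
      ; bottom   = λ { (here refl) v∈F → contradiction v∈F v∉F ; (there w∈) → bottom w∈ }
      ; top      = λ { (here refl) v∈F → contradiction v∈F v∉F ; (there w∈) → top w∈ }
      ; positive = λ { (here refl) v∈F → contradiction v∈F v∉F ; (there w∈) → positive w∈ } }
      where open Separation (separate vs)

  -- Conditions on vertices extend to all points through their threshold sets, which are vertices of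
  -- the face by `threshold-vertex`. If two coordinates on one level differed, the threshold at the
  -- smaller one would be a vertex separating them.
  separated-levels : (sep : Separation F (subsets n)) → Levels F (Separation.M sep)
  separated-levels sep = record
    { ℓ = ℓ ; ℓ≤M = ℓ≤M ; vertex = vertex
    ; level    = λ x x∈ i j eq → ℚ.≤-antisym (level-≤ x x∈ j i (sym eq)) (level-≤ x x∈ i j eq)
    ; bottom   = bottom′
    ; top      = top′
    ; positive = λ x x∈ → positive (∈-subsets (tabulate (above x 0ℚ)))
        (tabulated (above x 0ℚ) (threshold-vertex F x x∈ 0ℚ ℚ.≤-refl 0<1)) }
    where
    open Separation sep
    tabulated : ∀ p → Vertex F p → Vertex F (lookup (tabulate p))
    tabulated p = Vertex-resp F (λ i → sym (Vec.lookup∘tabulate p i))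
    value : ∀ p i {b} → lookup (tabulate p) i ≡ b → p i ≡ b
    value p i eq = trans (sym (Vec.lookup∘tabulate p i)) eq
    level-≤ : ∀ x → faceSet F x → ∀ i j → ℓ i ≡ ℓ j → x j ≤ x i
    level-≤ x x∈ i j eq with x i ℚ.<? x j
    ... | no ≮  = ℚ.≮⇒≥ ≮
    ... | yes lt = contradiction (true-does (x i ℚ.<? x i)
        (trans (trans (sym (Vec.lookup∘tabulate p i))
          (level (∈-subsets (tabulate p)) (tabulated p p∈) i j eq))
          (trans (Vec.lookup∘tabulate p j) (does-true (x i ℚ.<? x j) lt)))) (ℚ.<-irrefl refl)
      where
      p = above x (x i)
      p∈ = threshold-vertex F x x∈ (x i) (proj₁ (proj₁ x∈) i) (ℚ.<-≤-trans lt (proj₁ (proj₂ (proj₁ x∈)) j))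
    bottom′ : ∀ x → faceSet F x → ∀ i → ℓ i ≡ 0 → x i ≡ 0ℚ
    bottom′ x x∈ i eq with 0ℚ ℚ.<? x i
    ... | no ≮   = ℚ.≤-antisym (ℚ.≮⇒≥ ≮) (proj₁ (proj₁ x∈) i)
    ... | yes lt = contradiction (trans (sym (does-true (0ℚ ℚ.<? x i) lt))
        (value p i (bottom (∈-subsets (tabulate p)) (tabulated p p∈) i eq))) (λ ())
      where
      p = above x 0ℚ
      p∈ = threshold-vertex F x x∈ 0ℚ ℚ.≤-refl 0<1
    top′ : ∀ x → faceSet F x → ∀ i → ℓ i ≡ M → x i ≡ 1ℚ
    top′ x x∈ i eq with x i ℚ.<? 1ℚ
    ... | no ≮   = ℚ.≤-antisym (proj₁ (proj₂ (proj₁ x∈)) i) (ℚ.≮⇒≥ ≮)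
    ... | yes lt = contradiction (true-does (x i ℚ.<? x i)
        (value p i (top (∈-subsets (tabulate p)) (tabulated p p∈) i eq))) (ℚ.<-irrefl refl)
      where
      p = above x (x i)
      p∈ = threshold-vertex F x x∈ (x i) (proj₁ (proj₁ x∈) i) lt

levels : ∀ {n} {R : BRel n} (F : Face (OrderPolytope R)) → Σ ℕ λ M → Σ (Levels F M) Inhabited
levels {n} F = compress (separated-levels (separate (subsets n)))

order-bases : ∀ {n} (R : BRel n) → HasBases (OrderPolytope R)
order-bases R F = proj₁ (levels F) , levels-basis F (proj₁ (proj₂ (levels F))) (proj₂ (proj₂ (levels F)))

-- Faces of the order polytope at the origin

maximal : ∀ {n} (R : BRel (suc n)) → IsPoset R → Σ (Fin (suc n)) λ m → ∀ j → T (R m j) → j ≡ m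
maximal {zero}  R P = zero , λ { zero _ → refl }
maximal {suc n} R P with maximal (λ i j → R (suc i) (suc j)) record
    { refl = λ i → IsPoset.refl P (suc i)
    ; antisym = λ i j p q → Fin.suc-injective (IsPoset.antisym P (suc i) (suc j) p q)
    ; trans = λ i j k → IsPoset.trans P (suc i) (suc j) (suc k) }
... | m , max with Bool.T? (R (suc m) zero)
...   | yes m≤0 = zero , λ where
  zero    _   → refl
  (suc j) 0≤j → contradiction (IsPoset.antisym P zero (suc m)
    (subst (λ k → T (R zero (suc k))) (max j (IsPoset.trans P (suc m) zero (suc j) m≤0 0≤j)) 0≤j) m≤0) (λ ())
...   | no m≰0 = suc m , λ where
  zero    m≤0 → contradiction m≤0 m≰0
  (suc j) m≤j → cong suc (max j m≤j)

argmax : ∀ {n} (p : Fin n → Bool) (f : Fin n → ℕ) →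
  (∀ i → ¬ T (p i)) ⊎ Σ (Fin n) λ i → T (p i) × ∀ j → T (p j) → f j ℕ.≤ f i
argmax {zero}  p f = inj₁ λ ()
argmax {suc n} p f with argmax (p ∘ suc) (f ∘ suc) | Bool.T? (p zero)
... | inj₁ none | no ¬p₀ = inj₁ λ { zero → ¬p₀ ; (suc i) → none i }
... | inj₁ none | yes p₀ = inj₂ (zero , p₀ , λ { zero _ → ℕ.≤-refl ; (suc j) pj → contradiction pj (none j) })
... | inj₂ (i , pi , max) | no ¬p₀ = inj₂ (suc i , pi , λ { zero p₀ → contradiction p₀ ¬p₀ ; (suc j) → max j })
... | inj₂ (i , pi , max) | yes p₀ with ℕ.≤-total (f zero) (f (suc i))
...   | inj₁ le = inj₂ (suc i , pi , λ { zero _ → le ; (suc j) → max j })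
...   | inj₂ ge = inj₂ (zero , p₀ , λ { zero _ → ℕ.≤-refl ; (suc j) pj → ℕ.≤-trans (max j pj) ge })

punch-elim : ∀ {n} (m : Fin (suc n)) (P : Fin (suc n) → Set) → P m → (∀ i → P (punchIn m i)) → ∀ i → P i
punch-elim m P pm pi i with m Fin.≟ i
... | yes refl = pm
... | no m≢i   = subst P (Fin.punchIn-punchOut m≢i) (pi (punchOut m≢i))

-- As the origin lies on the face, no element has level M: its coordinate would have to be 1. The
-- last vertex `{ℓ ≥ M}` of the chain is thus the origin itself.
record RootedFace {n : ℕ} (R : BRel n) : Set where
  field
    F         : Face (OrderPolytope R)
    M         : ℕ
    L         : Levels F M
    inhabited : Inhabited L
    root      : faceSet F origin

rooted : ∀ {n} {R : BRel n} → RootedFace R → RankedFace (OrderPolytope R)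
rooted Q = ranked F M (levels-basis F L inhabited)
  where open RootedFace Q

rooted-⊑ : ∀ {n} {R : BRel n} (Q Q′ : RootedFace R) →
  (∀ s → 1 ℕ.≤ s → s ℕ.≤ RootedFace.M Q → Vertex (RootedFace.F Q′) (level≥ (Levels.ℓ (RootedFace.L Q)) s)) →
  rooted Q ⊑ rooted Q′
rooted-⊑ Q Q′ vs = ⊑-by-basis (rooted Q) (rooted Q′) λ j → proj₂ (vs (suc (toℕ j)) (s≤s z≤n) (Fin.toℕ<n j))

removeElement : ∀ {n} → BRel (suc n) → Fin (suc n) → BRel n
removeElement R m i j = R (punchIn m i) (punchIn m j)

removeElement-poset : ∀ {n} {R : BRel (suc n)} m → IsPoset R → IsPoset (removeElement R m)
removeElement-poset m P = record
  { refl    = λ i → IsPoset.refl P (punchIn m i)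
  ; antisym = λ i j p q → Fin.punchIn-injective m i j (IsPoset.antisym P (punchIn m i) (punchIn m j) p q)
  ; trans   = λ i j k → IsPoset.trans P (punchIn m i) (punchIn m j) (punchIn m k) }

-- The faces at the origin are built up by adding a maximal element m to a poset R′.
-- Its coordinate is either free, or bound to the value on the highest level below m.
module Extend {n : ℕ} {R : BRel (suc n)} (m : Fin (suc n)) (max : ∀ j → T (R m j) → j ≡ m)
    (Q : RootedFace (removeElement R m)) where
  open RootedFace Q
  open Levels L

  R′ : BRel n
  R′ = removeElement R m

  restrict : Point (suc n) → Point n
  restrict x i = x (punchIn m i)

  restrict-mem : ∀ x → OrderPolytope R x → OrderPolytope R′ (restrict x)
  restrict-mem x (nonneg , bound , mono) =
    (λ i → nonneg (punchIn m i)) , (λ i → bound (punchIn m i)) , λ i j → mono (punchIn m i) (punchIn m j)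

  restrict-form : AffineForm (λ x → dot (normal F) (restrict x))
  restrict-form = dot-affine (normal F) (λ i → coord-affine (punchIn m i))

  extend-mem : ∀ x → OrderPolytope R′ (restrict x) → 0ℚ ≤ x m → x m ≤ 1ℚ →
    (∀ j → T (R (punchIn m j) m) → x (punchIn m j) ≤ x m) → OrderPolytope R x
  extend-mem x (nonneg , bound , mono) 0≤v v≤1 below-m =
    punch-elim m (λ i → 0ℚ ≤ x i) 0≤v nonneg ,
    punch-elim m (λ i → x i ≤ 1ℚ) v≤1 bound ,
    punch-elim m (λ i → ∀ j → T (R i j) → x i ≤ x j)
      (λ j Rmj → ℚ.≤-reflexive (cong x (sym (max j Rmj))))
      (λ i → punch-elim m (λ j → T (R (punchIn m i) j) → x (punchIn m i) ≤ x j) (below-m i) (mono i))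

  ℓ<M : ∀ i → ℓ i ≢ M
  ℓ<M i eq = contradiction (top origin root i eq) (λ ())

  level-restrict : ∀ a s i → level≥ (insert m a ℓ) s (punchIn m i) ≡ level≥ ℓ s i
  level-restrict a s i = cong (λ b → does (s ℕ.≤? b)) (insert-punchIn m a ℓ i)

  level-at : ∀ a s → level≥ (insert m a ℓ) s m ≡ does (s ℕ.≤? a)
  level-at a s = cong (λ b → does (s ℕ.≤? b)) (insert-same m a ℓ)

  extended-vertex-mem : ∀ a s → OrderPolytope R′ (ind (level≥ ℓ s)) →
    (∀ j → T (R (punchIn m j) m) → s ℕ.≤ ℓ j → s ℕ.≤ a) → OrderPolytope R (ind (level≥ (insert m a ℓ) s))
  extended-vertex-mem a s u∈ dominated = extend-mem (ind q)
    (OrderPolytope-resp R′ (λ i → cong bit (sym (level-restrict a s i))) u∈) (bit-nonneg (q m)) (bit-≤1 (q m))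
    (λ j Rjm → bit-mono λ eq → trans (level-at a s) (does-true (s ℕ.≤? a)
      (dominated j Rjm (true-does (s ℕ.≤? ℓ j) (trans (sym (level-restrict a s j)) eq)))))
    where q = level≥ (insert m a ℓ) s

  restrict-vertex : ∀ a s → Vertex F (level≥ ℓ s) → faceSet F (restrict (ind (level≥ (insert m a ℓ) s)))
  restrict-vertex a s = faceSet-resp F (λ i → cong bit (sym (level-restrict a s i)))

  ℓ-elim : ∀ a (P : Fin (suc n) → ℕ → Set) → P m a → (∀ i → P (punchIn m i) (ℓ i)) → ∀ i → P i (insert m a ℓ i)
  ℓ-elim a P pm pi = punch-elim m (λ i → P i (insert m a ℓ i)) (subst (P m) (sym (insert-same m a ℓ)) pm)
    (λ i → subst (P (punchIn m i)) (sym (insert-punchIn m a ℓ i)) (pi i))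

  freeFace : Face (OrderPolytope R)
  freeFace = formFace restrict-form (rhs F) (λ x x∈ → valid F (restrict x) (restrict-mem x x∈))

  freeFace-on : ∀ x → OrderPolytope R x → faceSet F (restrict x) → faceSet freeFace x
  freeFace-on x x∈ (_ , on) = formFace-on restrict-form (rhs F) (λ x x∈ → valid F (restrict x) (restrict-mem x x∈)) x x∈ on

  freeFace-restrict : ∀ x → faceSet freeFace x → faceSet F (restrict x)
  freeFace-restrict x x∈ = restrict-mem x (proj₁ x∈) ,
    formFace-form restrict-form (rhs F) (λ x x∈ → valid F (restrict x) (restrict-mem x x∈)) x x∈

  free-origin : faceSet freeFace origin
  free-origin = freeFace-on origin (extend-mem origin (proj₁ root) ℚ.≤-refl 0≤1 (λ _ _ → ℚ.≤-refl)) root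

  -- `m` takes level M, which is vacant because the face contains the origin. All old vertices gain
  -- `m`, so the M-th becomes `{m}`, and the empty set returns as vertex M + 1; the rank grows by
  -- one.
  free-levels : Levels freeFace (suc M)
  free-levels = record
    { ℓ = insert m M ℓ
    ; ℓ≤M = ℓ-elim M (λ _ a → a ℕ.≤ suc M) (ℕ.n≤1+n M) (λ i → ℕ.m≤n⇒m≤1+n (ℓ≤M i))
    ; vertex = vertex′
    ; level = λ x x∈ → ℓ-elim M (λ i a → ∀ j → a ≡ insert m M ℓ j → x i ≡ x j)
        (ℓ-elim M (λ j b → M ≡ b → x m ≡ x j) (λ _ → refl) (λ j e → contradiction (sym e) (ℓ<M j)))
        (λ i → ℓ-elim M (λ j b → ℓ i ≡ b → x (punchIn m i) ≡ x j) (λ e → contradiction e (ℓ<M i))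
          (level (restrict x) (freeFace-restrict x x∈) i))
    ; bottom = λ x x∈ → ℓ-elim M (λ i a → a ≡ 0 → x i ≡ 0ℚ)
        (λ M≡0 → contradiction (subst (1 ℕ.≤_) M≡0 (positive origin root)) (λ ()))
        (bottom (restrict x) (freeFace-restrict x x∈))
    ; top = λ x x∈ → ℓ-elim M (λ i a → a ≡ suc M → x i ≡ 1ℚ)
        (λ e → contradiction (sym e) ℕ.1+n≢n)
        (λ i e → contradiction (subst (ℕ._≤ M) e (ℓ≤M i)) ℕ.1+n≰n)
    ; positive = λ _ _ → s≤s z≤n }
    where
    vertex′ : ∀ s → 1 ℕ.≤ s → s ℕ.≤ suc M → Vertex freeFace (level≥ (insert m M ℓ) s)
    vertex′ s 1≤s _ = cases (s ℕ.≤? M)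
      where
      low : ∀ i → insert m M ℓ i ℕ.≤ M
      low = ℓ-elim M (λ _ a → a ℕ.≤ M) ℕ.≤-refl ℓ≤M
      cases : Dec (s ℕ.≤ M) → Vertex freeFace (level≥ (insert m M ℓ) s)
      cases (yes s≤M) = freeFace-on (ind (level≥ (insert m M ℓ) s))
        (extended-vertex-mem M s (proj₁ (vertex s 1≤s s≤M)) (λ _ _ _ → s≤M)) (restrict-vertex M s (vertex s 1≤s s≤M))
      cases (no s≰M) = faceSet-resp freeFace
        (λ i → cong bit (sym (does-false (s ℕ.≤? insert m M ℓ i) (λ le → s≰M (ℕ.≤-trans le (low i)))))) free-origin

  free : RootedFace R
  free = record
    { F = freeFace ; M = suc M ; L = free-levels ; root = free-origin ; inhabited = inhabited′ }
    where
    inhabited′ : Inhabited free-levels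
    inhabited′ s 1≤s s<1+M with s ℕ.≟ M
    ... | yes refl = m , insert-same m M ℓ
    ... | no s≢M   = let i , eq = inhabited s 1≤s (ℕ.≤∧≢⇒< (ℕ.≤-pred s<1+M) s≢M) in
                     punchIn m i , trans (insert-punchIn m M ℓ i) eq

  -- What the coordinate of `m` is bound to: the coordinate of an element below `m` of maximal
  -- level, or the constant 0 if nothing lies below `m`. Maximality keeps the extended level sets
  -- upward closed.
  record Anchor : Set where
    field
      height    : ℕ
      value     : Point (suc n) → ℚ
      affine    : AffineForm value
      height≤M  : height ℕ.≤ M
      value≤    : ∀ x → OrderPolytope R x → value x ≤ x m
      highest   : ∀ j → T (R (punchIn m j) m) → ℓ j ℕ.≤ height
      same      : ∀ x → faceSet F (restrict x) → ∀ j → ℓ j ≡ height → x (punchIn m j) ≡ value x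
      bottom₀   : ∀ x → faceSet F (restrict x) → height ≡ 0 → value x ≡ 0ℚ
      notTop    : height ≢ M
      on-level  : ∀ s → 1 ℕ.≤ s → value (ind (level≥ (insert m height ℓ) s)) ≡ bit (does (s ℕ.≤? height))
      at-origin : ∀ x → (∀ i → restrict x i ≡ 0ℚ) → value x ≡ 0ℚ

  anchor : Anchor
  anchor with argmax (λ j → R (punchIn m j) m) ℓ
  ... | inj₁ none = record
    { height = 0 ; value = λ _ → 0ℚ ; affine = const-affine 0ℚ ; height≤M = z≤n
    ; value≤ = λ x x∈ → proj₁ x∈ m
    ; highest = λ j Rjm → contradiction Rjm (none j)
    ; same = λ x x∈ j → bottom (restrict x) x∈ j
    ; bottom₀ = λ _ _ _ → refl
    ; notTop = λ 0≡M → contradiction (subst (1 ℕ.≤_) (sym 0≡M) (positive origin root)) (λ ())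
    ; on-level = λ { (suc s) _ → refl }
    ; at-origin = λ _ _ → refl }
  ... | inj₂ (i , Rim , high) = record
    { height = ℓ i ; value = λ x → x (punchIn m i) ; affine = coord-affine (punchIn m i) ; height≤M = ℓ≤M i
    ; value≤ = λ x x∈ → proj₂ (proj₂ x∈) (punchIn m i) m Rim
    ; highest = high
    ; same = λ x x∈ j → level (restrict x) x∈ j i
    ; bottom₀ = λ x x∈ → bottom (restrict x) x∈ i
    ; notTop = ℓ<M i
    ; on-level = λ s _ → cong bit (level-restrict (ℓ i) s i)
    ; at-origin = λ x eq → eq i }

  open Anchor anchor

  bound-form : AffineForm (λ x → dot (normal F) (restrict x) + (value x - x m))
  bound-form = +-affine restrict-form (sub-affine affine (coord-affine m))

  value-slack : ∀ x → OrderPolytope R x → value x - x m ≤ 0ℚ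
  value-slack x x∈ = subst (value x - x m ≤_) (ℚ.+-inverseʳ (x m)) (ℚ.+-monoˡ-≤ (- x m) (value≤ x x∈))

  bound-valid : ∀ x → OrderPolytope R x → dot (normal F) (restrict x) + (value x - x m) ≤ rhs F
  bound-valid x x∈ = subst (dot (normal F) (restrict x) + (value x - x m) ≤_) (ℚ.+-identityʳ (rhs F))
    (ℚ.+-mono-≤ (valid F (restrict x) (restrict-mem x x∈)) (value-slack x x∈))

  -- Adding the valid inequality `value x ≤ x m` to that of `F` intersects the preimage of `F` with
  -- the face where the two values agree.
  boundFace : Face (OrderPolytope R)
  boundFace = formFace bound-form (rhs F) bound-valid

  boundFace-on : ∀ x → OrderPolytope R x → faceSet F (restrict x) → value x ≡ x m → faceSet boundFace x
  boundFace-on x x∈ (_ , on) eq = formFace-on bound-form (rhs F) bound-valid x x∈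
    (trans (cong₂ _+_ on (trans (cong (_- x m) eq) (ℚ.+-inverseʳ (x m)))) (ℚ.+-identityʳ (rhs F)))

  boundFace-tight : ∀ x → faceSet boundFace x → dot (normal F) (restrict x) ≡ rhs F × value x - x m ≡ 0ℚ
  boundFace-tight x x∈ = sum-tight (valid F (restrict x) (restrict-mem x (proj₁ x∈))) (value-slack x (proj₁ x∈))
    (trans (formFace-form bound-form (rhs F) bound-valid x x∈) (sym (ℚ.+-identityʳ (rhs F))))

  boundFace-restrict : ∀ x → faceSet boundFace x → faceSet F (restrict x)
  boundFace-restrict x x∈ = restrict-mem x (proj₁ x∈) , proj₁ (boundFace-tight x x∈)

  boundFace-value : ∀ x → faceSet boundFace x → x m ≡ value x
  boundFace-value x x∈ = sub-zero (proj₂ (boundFace-tight x x∈))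

  bound-levels : Levels boundFace M
  bound-levels = record
    { ℓ = insert m height ℓ
    ; ℓ≤M = ℓ-elim height (λ _ a → a ℕ.≤ M) height≤M ℓ≤M
    ; vertex = λ s 1≤s s≤M → boundFace-on (ind (level≥ (insert m height ℓ) s))
        (extended-vertex-mem height s (proj₁ (vertex s 1≤s s≤M)) (λ j Rjm le → ℕ.≤-trans le (highest j Rjm)))
        (restrict-vertex height s (vertex s 1≤s s≤M))
        (trans (on-level s 1≤s) (cong bit (sym (level-at height s))))
    ; level = λ x x∈ → ℓ-elim height (λ i a → ∀ j → a ≡ insert m height ℓ j → x i ≡ x j)
        (ℓ-elim height (λ j b → height ≡ b → x m ≡ x j) (λ _ → refl)
          (λ j e → trans (boundFace-value x x∈) (sym (same x (boundFace-restrict x x∈) j (sym e)))))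
        (λ i → ℓ-elim height (λ j b → ℓ i ≡ b → x (punchIn m i) ≡ x j)
          (λ e → trans (same x (boundFace-restrict x x∈) i e) (sym (boundFace-value x x∈)))
          (level (restrict x) (boundFace-restrict x x∈) i))
    ; bottom = λ x x∈ → ℓ-elim height (λ i a → a ≡ 0 → x i ≡ 0ℚ)
        (λ e → trans (boundFace-value x x∈) (bottom₀ x (boundFace-restrict x x∈) e))
        (bottom (restrict x) (boundFace-restrict x x∈))
    ; top = λ x x∈ → ℓ-elim height (λ i a → a ≡ M → x i ≡ 1ℚ) (λ e → contradiction e notTop)
        (λ i e → contradiction e (ℓ<M i))
    ; positive = λ _ _ → positive origin root }

  bound : RootedFace R
  bound = record
    { F = boundFace ; M = M ; L = bound-levels
    ; root = boundFace-on origin (extend-mem origin (proj₁ root) ℚ.≤-refl 0≤1 (λ _ _ → ℚ.≤-refl)) root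
        (at-origin origin (λ _ → refl))
    ; inhabited = λ s 1≤s s<M → let i , eq = inhabited s 1≤s s<M in
        punchIn m i , trans (insert-punchIn m height ℓ i) eq }

module _ {n : ℕ} {R : BRel (suc n)} (m : Fin (suc n)) (max : ∀ j → T (R m j) → j ≡ m)
    (Q Q′ : RootedFace (removeElement R m)) where
  private
    module E  = Extend {R = R} m max Q
    module E′ = Extend {R = R} m max Q′

  free-reflects : rooted E.free ⊑ rooted E′.free → rooted Q ⊑ rooted Q′
  free-reflects sub = rooted-⊑ Q Q′ λ s 1≤s s≤M → faceSet-resp (RootedFace.F Q′)
    (λ i → cong bit (E.level-restrict (RootedFace.M Q) s i))
    (E′.freeFace-restrict (u s) (sub (u s) (Levels.vertex E.free-levels s 1≤s (ℕ.m≤n⇒m≤1+n s≤M))))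
    where
    u : ℕ → Point (suc n)
    u s = ind (level≥ (Levels.ℓ E.free-levels) s)

  bound-reflects : rooted E.bound ⊑ rooted E′.bound → rooted Q ⊑ rooted Q′
  bound-reflects sub = rooted-⊑ Q Q′ λ s 1≤s s≤M → faceSet-resp (RootedFace.F Q′)
    (λ i → cong bit (E.level-restrict (E.Anchor.height E.anchor) s i))
    (E′.boundFace-restrict (u s) (sub (u s) (Levels.vertex E.bound-levels s 1≤s s≤M)))
    where
    u : ℕ → Point (suc n)
    u s = ind (level≥ (Levels.ℓ E.bound-levels) s)

  -- The unit vector of `m` is on the free face because `m` is maximal. It is on no bound face,
  -- since its other coordinates vanish and the anchor with them.
  free≢bound : ¬ rooted E.free ⊑ rooted E′.bound
  free≢bound sub = contradiction (trans (sym (unit-diag m)) (trans (E′.boundFace-value (unit m) (sub (unit m) e∈))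
      (E′.Anchor.at-origin E′.anchor (unit m) off))) (λ ())
    where
    off : ∀ i → unit m (punchIn m i) ≡ 0ℚ
    off i = unit-off (λ eq → Fin.punchInᵢ≢i m i (sym eq))
    restricted : faceSet (RootedFace.F Q) (E.restrict (unit m))
    restricted = faceSet-resp (RootedFace.F Q) (λ i → sym (off i)) (RootedFace.root Q)
    1≤ : 1ℚ ≤ unit m m
    1≤ = ℚ.≤-reflexive (sym (unit-diag m))
    e∈ : faceSet E.freeFace (unit m)
    e∈ = E.freeFace-on (unit m) (E.extend-mem (unit m) (proj₁ restricted) (ℚ.≤-trans 0≤1 1≤) (ℚ.≤-reflexive (unit-diag m))
      (λ j _ → subst (_≤ unit m m) (sym (off j)) (ℚ.≤-trans 0≤1 1≤))) restricted

addMaximal : ∀ {n} {R : BRel (suc n)} m → (∀ j → T (R m j) → j ≡ m) → Bool →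
  RootedFace (removeElement R m) → RootedFace R
addMaximal {R = R} m max true  Q = Extend.free {R = R} m max Q
addMaximal {R = R} m max false Q = Extend.bound {R = R} m max Q

addMaximal-inj : ∀ {n} {R : BRel (suc n)} m (max : ∀ j → T (R m j) → j ≡ m) b b′ (Q Q′ : RootedFace (removeElement R m)) →
  rooted (addMaximal {R = R} m max b Q) ⊑ rooted (addMaximal {R = R} m max b′ Q′) →
  rooted (addMaximal {R = R} m max b′ Q′) ⊑ rooted (addMaximal {R = R} m max b Q) →
  b ≡ b′ × rooted Q ⊑ rooted Q′ × rooted Q′ ⊑ rooted Q
addMaximal-inj {R = R} m max true  true  Q Q′ s t =
  refl , free-reflects {R = R} m max Q Q′ s , free-reflects {R = R} m max Q′ Q t
addMaximal-inj {R = R} m max false false Q Q′ s t =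
  refl , bound-reflects {R = R} m max Q Q′ s , bound-reflects {R = R} m max Q′ Q t
addMaximal-inj {R = R} m max true  false Q Q′ s t = contradiction s (free≢bound {R = R} m max Q Q′)
addMaximal-inj {R = R} m max false true  Q Q′ s t = contradiction t (free≢bound {R = R} m max Q′ Q)

count : ∀ {n} → Vec Bool n → ℕ
count []          = 0
count (true ∷ v)  = suc (count v)
count (false ∷ v) = count v

-- The bits follow the order in which maximal elements are removed, not the indices of the elements.
-- This is enough for the matching with coordinate faces, which needs only that rank depends on the
-- number of free choices.
rootedFace : ∀ {n} (R : BRel n) → IsPoset R → Vec Bool n → RootedFace R
rootedFace {zero} R P [] = record
  { F = whole ; M = 1
  ; L = record
    { ℓ = λ () ; ℓ≤M = λ () ; vertex = λ _ _ _ → ((λ ()) , (λ ()) , λ ()) , refl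
    ; level = λ _ _ () ; bottom = λ _ _ () ; top = λ _ _ () ; positive = λ _ _ → s≤s z≤n }
  ; inhabited = λ { (suc s) _ (s≤s ()) }
  ; root = ((λ ()) , (λ ()) , λ ()) , refl }
  where
  whole : Face (OrderPolytope R)
  whole = face origin 0ℚ λ _ _ → ℚ.≤-refl
rootedFace {suc n} R P (b ∷ v) = addMaximal {R = R} (proj₁ (maximal R P)) (proj₂ (maximal R P)) b
  (rootedFace (removeElement R (proj₁ (maximal R P))) (removeElement-poset (proj₁ (maximal R P)) P) v)

rootedFace-rank : ∀ {n} (R : BRel n) (P : IsPoset R) v → RootedFace.M (rootedFace R P v) ≡ suc (count v)
rootedFace-rank {zero}  R P []          = refl
rootedFace-rank {suc n} R P (true ∷ v)  = cong suc (rootedFace-rank _ _ v)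
rootedFace-rank {suc n} R P (false ∷ v) = rootedFace-rank _ _ v

rootedFace-inj : ∀ {n} (R : BRel n) (P : IsPoset R) v w →
  rooted (rootedFace R P v) ⊑ rooted (rootedFace R P w) → rooted (rootedFace R P w) ⊑ rooted (rootedFace R P v) → v ≡ w
rootedFace-inj {zero}  R P [] [] _ _ = refl
rootedFace-inj {suc n} R P (b ∷ v) (b′ ∷ w) s t =
  cong₂ _∷_ (proj₁ same) (rootedFace-inj R′ P′ v w (proj₁ (proj₂ same)) (proj₂ (proj₂ same)))
  where
  m = proj₁ (maximal R P)
  R′ = removeElement R m
  P′ = removeElement-poset m P
  same = addMaximal-inj {R = R} m (proj₂ (maximal R P)) b b′ (rootedFace R′ P′ v) (rootedFace R′ P′ w) s t

-- From faces at the origin to faces that avoid it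

record Shifted {n : ℕ} {R : BRel n} (Q : RootedFace R) : Set where
  open RootedFace Q
  field
    G           : RankedFace (OrderPolytope R)
    G-rank      : suc (rank G) ≡ M
    G⊑F         : ∀ x → points G x → faceSet F x
    vertices    : ∀ s → 1 ℕ.≤ s → s ℕ.< M → points G (ind (level≥ (Levels.ℓ L) s))
    avoids-root : ¬ points G origin

empty-points : ∀ {n} {S : PointSet n} x → ¬ points (emptyRanked {S = S}) x
empty-points {S = S} x x∈ = contradiction (proj₂ (nonempty-rank (basis (emptyRanked {S = S})) x x∈)) (λ ())

-- The facet of F on which the coordinates of the highest level are 1.
shift : ∀ {n} {R : BRel n} (Q : RootedFace R) → Shifted Q
shift {n} {R} record { F = F ; M = zero ; L = L ; root = root } =
  contradiction (Levels.positive L origin root) (λ ())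
-- A face of rank 1 at the origin is the origin alone, and its facet avoiding the origin is the
-- empty face.
shift {n} {R} record { M = suc zero } = record
  { G = emptyRanked ; G-rank = refl ; G⊑F = λ x x∈ → contradiction x∈ (empty-points {S = OrderPolytope R} x)
  ; vertices = λ { (suc s) _ (s≤s ()) } ; avoids-root = empty-points {S = OrderPolytope R} origin }
shift {n} {R} record { F = F ; M = suc (suc k) ; L = L ; inhabited = inhabited ; root = root } = record
  { G = ranked facet (suc k) (levels-basis facet L′ (λ s 1≤s s<k → inhabited s 1≤s (ℕ.m≤n⇒m≤1+n s<k)))
  ; G-rank = refl ; G⊑F = facet⊑F
  ; vertices = λ s 1≤s s<M → vertex′ s 1≤s (ℕ.≤-pred s<M)
  ; avoids-root = λ 0∈ → contradiction (facet-r origin 0∈) (λ ()) }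
  where
  open Levels L
  r = proj₁ (inhabited (suc k) (s≤s z≤n) ℕ.≤-refl)
  ℓr : ℓ r ≡ suc k
  ℓr = proj₂ (inhabited (suc k) (s≤s z≤n) ℕ.≤-refl)
  form : AffineForm (λ x → dot (normal F) x + x r)
  form = +-affine (dot-affine (normal F) coord-affine) (coord-affine r)
  form-valid : ∀ x → OrderPolytope R x → dot (normal F) x + x r ≤ rhs F + 1ℚ
  form-valid x x∈ = ℚ.+-mono-≤ (valid F x x∈) (proj₁ (proj₂ x∈) r)
  facet : Face (OrderPolytope R)
  facet = formFace form (rhs F + 1ℚ) form-valid
  facet-on : ∀ x → faceSet F x → x r ≡ 1ℚ → faceSet facet x
  facet-on x (x∈ , on) xr≡1 = formFace-on form (rhs F + 1ℚ) form-valid x x∈ (cong₂ _+_ on xr≡1)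
  facet-tight : ∀ x → faceSet facet x → dot (normal F) x ≡ rhs F × x r ≡ 1ℚ
  facet-tight x x∈ = sum-tight (valid F x (proj₁ x∈)) (proj₁ (proj₂ (proj₁ x∈)) r)
    (formFace-form form (rhs F + 1ℚ) form-valid x x∈)
  facet⊑F : ∀ x → faceSet facet x → faceSet F x
  facet⊑F x x∈ = proj₁ x∈ , proj₁ (facet-tight x x∈)
  facet-r : ∀ x → faceSet facet x → x r ≡ 1ℚ
  facet-r x x∈ = proj₂ (facet-tight x x∈)
  vertex′ : ∀ s → 1 ℕ.≤ s → s ℕ.≤ suc k → Vertex facet (level≥ ℓ s)
  vertex′ s 1≤s s≤k = facet-on (ind (level≥ ℓ s)) (vertex s 1≤s (ℕ.m≤n⇒m≤1+n s≤k))
    (cong bit (does-true (s ℕ.≤? ℓ r) (subst (s ℕ.≤_) (sym ℓr) s≤k)))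
  L′ : Levels facet (suc k)
  L′ = record
    { ℓ = ℓ
    ; ℓ≤M = λ i → ℕ.≤-pred (ℕ.≤∧≢⇒< (ℓ≤M i) (λ eq → contradiction (top origin root i eq) (λ ())))
    ; vertex = vertex′
    ; level = λ x x∈ → level x (facet⊑F x x∈)
    ; bottom = λ x x∈ → bottom x (facet⊑F x x∈)
    ; top = λ x x∈ i eq → trans (level x (facet⊑F x x∈) i r (trans eq (sym ℓr))) (facet-r x x∈)
    ; positive = λ _ _ → s≤s z≤n }

-- The facet retains every vertex `{ℓ ≥ s}` with s below M, and the one it loses is the origin,
-- which lies on every rooted face. Together they span the original face.
shift-reflects : ∀ {n} {R : BRel n} (Q Q′ : RootedFace R) →
  Shifted.G (shift Q) ⊑ Shifted.G (shift Q′) → rooted Q ⊑ rooted Q′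
shift-reflects Q Q′ sub = rooted-⊑ Q Q′ λ s 1≤s s≤M → cases s 1≤s s≤M (s ℕ.<? M)
  where
  open RootedFace Q
  open Levels L
  cases : ∀ s → 1 ℕ.≤ s → s ℕ.≤ M → Dec (s ℕ.< M) → Vertex (RootedFace.F Q′) (level≥ ℓ s)
  cases s 1≤s _ (yes s<M) = Shifted.G⊑F (shift Q′) (ind (level≥ ℓ s))
    (sub (ind (level≥ ℓ s)) (Shifted.vertices (shift Q) s 1≤s s<M))
  cases s 1≤s s≤M (no s≮M) = faceSet-resp (RootedFace.F Q′)
    (λ i → cong bit (sym (does-false (s ℕ.≤? ℓ i) λ le →
      contradiction (top origin root i (ℕ.≤-antisym (ℓ≤M i) (ℕ.≤-trans (ℕ.≮⇒≥ s≮M) le))) (λ ()))))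
    (RootedFace.root Q′)

-- Faces of chain polytopes at the origin

-- The summand of indicatorSum is a local function of Defs; it is recovered by unification.
summand : ∀ {n} {f : Fin n → ℚ} {s : ℚ} → s ≡ sumℚ f → Fin n → ℚ
summand {f = f} _ = f

indicatorTerm : ∀ {n} → (Fin n → Bool) → Point n → Fin n → ℚ
indicatorTerm C x = summand (refl {x = indicatorSum C x})

indicatorSum-dot : ∀ {n} (C : Fin n → Bool) (x : Point n) → indicatorSum C x ≡ dot (ind C) x
indicatorSum-dot C x = sum-cong term
  where
  term : ∀ i → indicatorTerm C x i ≡ bit (C i) * x i
  term i with C i
  ... | true  = sym (ℚ.*-identityˡ (x i))
  ... | false = sym (ℚ.*-zeroˡ (x i))

chain-sum : ∀ {n} {R : BRel n} {x} → ChainPolytope R x → ∀ C → IsChain R C → dot (ind C) x ≤ 1ℚ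
chain-sum {x = x} x∈ C chain = subst (_≤ 1ℚ) (indicatorSum-dot C x) (proj₂ x∈ C chain)

chainPolytope-intro : ∀ {n} (R : BRel n) x → (∀ i → 0ℚ ≤ x i) →
  (∀ C → IsChain R C → dot (ind C) x ≤ 1ℚ) → ChainPolytope R x
chainPolytope-intro R x nonneg sums = nonneg , λ C chain → subst (_≤ 1ℚ) (sym (indicatorSum-dot C x)) (sums C chain)

chain-origin : ∀ {n} (R : BRel n) → ChainPolytope R origin
chain-origin R = chainPolytope-intro R origin (λ _ → ℚ.≤-refl) λ C _ →
  subst (_≤ 1ℚ) (sym (dot-0ʳ (ind C) (λ _ → refl))) 0≤1

unit-nonneg : ∀ {n} (i j : Fin n) → 0ℚ ≤ unit i j
unit-nonneg i j with i Fin.≟ j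
... | yes _ = 0≤1
... | no _  = ℚ.≤-refl

chain-unit : ∀ {n} (R : BRel n) i → ChainPolytope R (unit i)
chain-unit R i = chainPolytope-intro R (unit i) (unit-nonneg i) λ C _ →
  subst (_≤ 1ℚ) (sym (dot-unitʳ (ind C) i)) (bit-≤1 (C i))

position : ∀ {n} (v : Vec Bool n) → Fin (count v) → Fin n
position (true ∷ v)  zero    = zero
position (true ∷ v)  (suc j) = suc (position v j)
position (false ∷ v) j       = suc (position v j)

position-inj : ∀ {n} (v : Vec Bool n) i j → position v i ≡ position v j → i ≡ j
position-inj (true ∷ v)  zero    zero    _  = refl
position-inj (true ∷ v)  (suc i) (suc j) eq = cong suc (position-inj v i j (Fin.suc-injective eq))
position-inj (false ∷ v) i       j       eq = position-inj v i j (Fin.suc-injective eq)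

position-true : ∀ {n} (v : Vec Bool n) j → lookup v (position v j) ≡ true
position-true (true ∷ v)  zero    = refl
position-true (true ∷ v)  (suc j) = position-true v j
position-true (false ∷ v) j       = position-true v j

position-surj : ∀ {n} (v : Vec Bool n) i → lookup v i ≡ true → Σ (Fin (count v)) λ j → position v j ≡ i
position-surj (true ∷ v)  zero    _  = zero , refl
position-surj (true ∷ v)  (suc i) eq = let j , e = position-surj v i eq in suc j , cong suc e
position-surj (false ∷ v) (suc i) eq = let j , e = position-surj v i eq in j , cong suc e

module _ {n : ℕ} (R : BRel n) (v : Vec Bool n) where

  -- The coordinates outside `v` are nonnegative, so their sum vanishes only if each of them does.
  -- One inequality thus cuts out the whole coordinate subspace.
  coordFace : Face (ChainPolytope R)
  coordFace = face (λ i → - bit (not (lookup v i))) 0ℚ λ x x∈ → ≤-add (subst (0ℚ ≤_)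
    (trans (sum-cong (λ i → lem (bit (not (lookup v i))) (x i)))
      (trans (sum-*ˡ (- 1ℚ) (λ i → - bit (not (lookup v i)) * x i)) (lem₂ (dot (λ i → - bit (not (lookup v i))) x))))
    (sum-nonneg (λ i → 0≤* (bit-nonneg (not (lookup v i))) (proj₁ x∈ i))))
    where
    lem : ∀ b a → b * a ≡ (- 1ℚ) * (- b * a)
    lem = solve-∀ ringℚ
    lem₂ : ∀ d → (- 1ℚ) * d ≡ 0ℚ - d
    lem₂ = solve-∀ ringℚ

  coordFace-on : ∀ x → ChainPolytope R x → (∀ i → lookup v i ≡ false → x i ≡ 0ℚ) → faceSet coordFace x
  coordFace-on x x∈ zeros = x∈ , sum-zero λ i → term i (lookup v i) refl
    where
    term : ∀ i b → lookup v i ≡ b → - bit (not (lookup v i)) * x i ≡ 0ℚ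
    term i true  eq = trans (cong (λ b → - bit (not b) * x i) eq) (ℚ.*-zeroˡ (x i))
    term i false eq = trans (cong (- bit (not (lookup v i)) *_) (zeros i eq)) (ℚ.*-zeroʳ (- bit (not (lookup v i))))

  coordFace-zero : ∀ x → faceSet coordFace x → ∀ i → lookup v i ≡ false → x i ≡ 0ℚ
  coordFace-zero x (x∈ , on) i eq = trans (sym (ℚ.*-identityˡ (x i)))
    (trans (cong (λ b → bit (not b) * x i) (sym eq)) (sum-nonneg-zero terms total i))
    where
    terms : ∀ i → 0ℚ ≤ bit (not (lookup v i)) * x i
    terms i = 0≤* (bit-nonneg (not (lookup v i))) (proj₁ x∈ i)
    lem : ∀ b a → b * a ≡ (- 1ℚ) * (- b * a)
    lem = solve-∀ ringℚ
    total : sumℚ (λ i → bit (not (lookup v i)) * x i) ≡ 0ℚ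
    total = trans (sum-cong (λ i → lem (bit (not (lookup v i))) (x i)))
      (trans (sum-*ˡ (- 1ℚ) (λ i → - bit (not (lookup v i)) * x i)) (trans (cong ((- 1ℚ) *_) on) (ℚ.*-zeroʳ (- 1ℚ))))

  coordRanked : RankedFace (ChainPolytope R)
  coordRanked = ranked coordFace (suc (count v)) record
    { pt    = p
    ; mem   = λ { zero    → coordFace-on origin (chain-origin R) (λ _ _ → refl)
                ; (suc j) → coordFace-on (unit (position v j)) (chain-unit R (position v j)) λ i eq →
                    unit-off λ e → contradiction (trans (sym (position-true v j)) (trans (cong (lookup v) e) eq)) (λ ()) }
    ; indep = λ μ eq → λ { zero → first μ eq ; (suc j) → rest μ eq j }
    ; span  = λ x x∈ → (1ℚ - sumℚ (x ∘ position v)) ▸ (x ∘ position v) , λ where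
        zero    → trans (sum-*1 ((1ℚ - sumℚ (x ∘ position v)) ▸ (x ∘ position v))) (sub-add (sumℚ (x ∘ position v)))
        (suc i) → trans (tail ((1ℚ - sumℚ (x ∘ position v)) ▸ (x ∘ position v)) i) (spanned x x∈ i (lookup v i) refl) }
    where
    p : Fin (suc (count v)) → Point n
    p = origin ▸ (unit ∘ position v)
    tail : ∀ μ i → comb μ p i ≡ comb (μ ∘ suc) (unit ∘ position v) i
    tail μ i = trans (cong (_+ comb (μ ∘ suc) (unit ∘ position v) i) (ℚ.*-zeroʳ (μ zero)))
      (ℚ.+-identityˡ (comb (μ ∘ suc) (unit ∘ position v) i))
    at : ∀ (μ : Fin (count v) → ℚ) j → comb μ (unit ∘ position v) (position v j) ≡ μ j
    at μ j = trans (sum-single (λ l → μ l * unit (position v l) (position v j)) j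
        (λ l l≢j → trans (cong (μ l *_) (unit-off (l≢j ∘ position-inj v l j))) (ℚ.*-zeroʳ (μ l))))
      (trans (cong (μ j *_) (unit-diag (position v j))) (ℚ.*-identityʳ (μ j)))
    rest : ∀ μ → (∀ i → comb μ (hom ∘ p) i ≡ 0ℚ) → ∀ j → μ (suc j) ≡ 0ℚ
    rest μ eq j = trans (sym (at (μ ∘ suc) j)) (trans (sym (tail μ (position v j))) (eq (suc (position v j))))
    first : ∀ μ → (∀ i → comb μ (hom ∘ p) i ≡ 0ℚ) → μ zero ≡ 0ℚ
    first μ eq = trans (sym (trans (cong (μ zero +_) (sum-zero (rest μ eq))) (ℚ.+-identityʳ (μ zero))))
      (trans (sym (sum-*1 μ)) (eq zero))
    spanned : ∀ x → faceSet coordFace x → ∀ i b → lookup v i ≡ b → comb (x ∘ position v) (unit ∘ position v) i ≡ x i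
    spanned x x∈ i true eq = let j , e = position-surj v i eq in
      subst (λ i → comb (x ∘ position v) (unit ∘ position v) i ≡ x i) e (at (x ∘ position v) j)
    spanned x x∈ i false eq = trans (sum-zero (λ j → trans (cong (x (position v j) *_)
        (unit-off λ e → contradiction (trans (sym (position-true v j)) (trans (cong (lookup v) e) eq)) (λ ())))
        (ℚ.*-zeroʳ (x (position v j)))))
      (sym (coordFace-zero x x∈ i eq))

coord-inj : ∀ {n} (R : BRel n) v w → coordRanked R v ⊑ coordRanked R w → ∀ i → lookup v i ≡ true → lookup w i ≡ true
coord-inj R v w sub i vi with lookup w i Bool.≟ true
... | yes wi = wi
... | no ¬wi = contradiction (trans (sym (unit-diag i)) (coordFace-zero R w (unit i) (sub (unit i)
    (coordFace-on R v (unit i) (chain-unit R i) λ j vj → unit-off λ i≡j →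
      contradiction (trans (sym vi) (trans (cong (lookup v) i≡j) vj)) (λ ()))) i (Bool.¬-not ¬wi))) (λ ())

origin-rhs : ∀ {n} {S : PointSet n} (F : Face S) → faceSet F origin → rhs F ≡ 0ℚ
origin-rhs F (_ , on) = trans (sym on) (dot-0ʳ (normal F) (λ _ → refl))

rhs-origin : ∀ {n} {S : PointSet n} (F : Face S) → S origin → rhs F ≡ 0ℚ → faceSet F origin
rhs-origin F 0∈S eq = 0∈S , trans (dot-0ʳ (normal F) (λ _ → refl)) (sym eq)

-- A valid inequality c · x ≤ 0 of a chain polytope has c ≤ 0, hence cuts out a coordinate face.
rhs-zero-coord : ∀ {n} (R : BRel n) (F : RankedFace (ChainPolytope R)) → rhs (fc F) ≡ 0ℚ →
  Σ (Vec Bool n) λ v → F ≋ coordRanked R v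
rhs-zero-coord {n} R F δ≡0 = v , ≋-intro {F = F} {coordRanked R v} fw bw
  where
  c = normal (fc F)
  v : Vec Bool n
  v = tabulate (λ i → does (c i ℚ.≟ 0ℚ))
  c≤0 : ∀ i → c i ≤ 0ℚ
  c≤0 i = subst (_≤ 0ℚ) (dot-unitʳ c i) (subst (dot c (unit i) ≤_) δ≡0 (valid (fc F) (unit i) (chain-unit R i)))
  lem : ∀ a b → (- 1ℚ) * (a * b) ≡ (0ℚ - a) * b
  lem = solve-∀ ringℚ
  fw : F ⊑ coordRanked R v
  fw x (x∈ , on) = coordFace-on R v x x∈ λ i vi → *-cancel-0 (nonzero i vi) (sum-nonneg-zero
    (λ i → 0≤* (≤-sub (c≤0 i)) (proj₁ x∈ i)) total i)
    where
    total : sumℚ (λ i → (0ℚ - c i) * x i) ≡ 0ℚ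
    total = trans (sum-cong (λ i → sym (lem (c i) (x i)))) (trans (sum-*ˡ (- 1ℚ) (λ i → c i * x i))
      (trans (cong ((- 1ℚ) *_) (trans on δ≡0)) (ℚ.*-zeroʳ (- 1ℚ))))
    nonzero : ∀ i → lookup v i ≡ false → 0ℚ - c i ≢ 0ℚ
    nonzero i vi eq = contradiction (trans (sym (does-true (c i ℚ.≟ 0ℚ) (sub-zero eq)))
      (trans (sym (Vec.lookup∘tabulate (λ i → does (c i ℚ.≟ 0ℚ)) i)) vi)) (λ ())
  bw : coordRanked R v ⊑ F
  bw x x∈ = proj₁ x∈ , trans (sum-zero term) (sym δ≡0)
    where
    term : ∀ i → c i * x i ≡ 0ℚ
    term i = cases (decided (c i ℚ.≟ 0ℚ))
      where
      cases : _ → c i * x i ≡ 0ℚ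
      cases (inj₁ (ci≡0 , _)) = trans (cong (_* x i) ci≡0) (ℚ.*-zeroˡ (x i))
      cases (inj₂ (_ , eq))   = trans (cong (c i *_) (coordFace-zero R v x x∈ i
        (trans (Vec.lookup∘tabulate (λ i → does (c i ℚ.≟ 0ℚ)) i) eq))) (ℚ.*-zeroʳ (c i))

-- Embeddings of wedges

scaleFace : ∀ {n} {S : PointSet n} (a : ℚ) → 0ℚ ≤ a → Face S → Face S
scaleFace a 0≤a (face c δ v) = face (λ i → a * c i) (a * δ) λ x x∈ →
  subst (_≤ a * δ) (sym (dot-*ˡ c x a)) (*-monoˡ 0≤a (v x x∈))

scaleFace-same : ∀ {n} {S : PointSet n} a (0≤a : 0ℚ ≤ a) → a ≢ 0ℚ → (F : Face S) →
  SameSet (faceSet F) (faceSet (scaleFace a 0≤a F))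
scaleFace-same a 0≤a a≢0 (face c δ v) x = mk⇔
  (λ (x∈ , on) → x∈ , trans (dot-*ˡ c x a) (cong (a *_) on))
  (λ (x∈ , on) → x∈ , sub-zero (*-cancel-0 a≢0 (trans (lem a δ (dot c x))
    (trans (cong (λ z → a * δ - z) (trans (sym (dot-*ˡ c x a)) on)) (ℚ.+-inverseʳ (a * δ))))))
  where
  lem : ∀ a d e → a * (d - e) ≡ a * d - a * e
  lem = solve-∀ ringℚ

SameSet-trans : ∀ {n} {A B C : PointSet n} → SameSet A B → SameSet B C → SameSet A C
SameSet-trans p q x =
  mk⇔ (Equivalence.to (q x) ∘ Equivalence.to (p x)) (Equivalence.from (p x) ∘ Equivalence.from (q x))

module Join {m n : ℕ} {S : PointSet m} {T : PointSet n} {Z : PointSet (m ℕ.+ n)} (W : Wedge S T Z) where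
  open Wedge W

  -- Both inequalities are scaled to a common right-hand side.
  scaledₗ : Face S → Face T → Face S
  scaledₗ G₁ G₂ = scaleFace (rhs G₂) (rhs-at-origin G₂ origin-r) G₁

  scaledᵣ : Face S → Face T → Face T
  scaledᵣ G₁ G₂ = scaleFace (rhs G₁) (rhs-at-origin G₁ origin-l) G₂

  scaledJoin : Face S → Face T → Face Z
  scaledJoin G₁ G₂ = joinFace W (scaledₗ G₁ G₂) (scaledᵣ G₁ G₂) (ℚ.*-comm (rhs G₂) (rhs G₁))

  joinₗ : ∀ G₁ G₂ → rhs G₂ ≢ 0ℚ → SameSet (faceSet G₁) (faceSet (leftFace W (scaledJoin G₁ G₂)))
  joinₗ G₁ G₂ nz = SameSet-trans {A = faceSet G₁} {faceSet (scaledₗ G₁ G₂)} {faceSet (leftFace W (scaledJoin G₁ G₂))}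
    (scaleFace-same (rhs G₂) (rhs-at-origin G₂ origin-r) nz G₁)
    (join-left W (scaledₗ G₁ G₂) (scaledᵣ G₁ G₂) (ℚ.*-comm (rhs G₂) (rhs G₁)))

  joinᵣ : ∀ G₁ G₂ → rhs G₁ ≢ 0ℚ → SameSet (faceSet G₂) (faceSet (rightFace W (scaledJoin G₁ G₂)))
  joinᵣ G₁ G₂ nz = SameSet-trans {A = faceSet G₂} {faceSet (scaledᵣ G₁ G₂)} {faceSet (rightFace W (scaledJoin G₁ G₂))}
    (scaleFace-same (rhs G₁) (rhs-at-origin G₁ origin-l) nz G₂)
    (join-right W (scaledₗ G₁ G₂) (scaledᵣ G₁ G₂) (ℚ.*-comm (rhs G₂) (rhs G₁)))

  joinRanked : (G₁ : RankedFace S) (G₂ : RankedFace T) → rhs (fc G₁) ≢ 0ℚ → rhs (fc G₂) ≢ 0ℚ → RankedFace Z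
  joinRanked (ranked G₁ r₁ B₁) (ranked G₂ r₂ B₂) nz₁ nz₂ = ranked (scaledJoin G₁ G₂) (r₁ ℕ.+ r₂)
    (wedge-basis W (scaledJoin G₁ G₂) (λ eq → nz₁ (*-cancel-0 nz₂ eq))
      (Basis-cong (faceSet G₁) (faceSet (leftFace W (scaledJoin G₁ G₂))) (joinₗ G₁ G₂ nz₂) B₁)
      (Basis-cong (faceSet G₂) (faceSet (rightFace W (scaledJoin G₁ G₂))) (joinᵣ G₁ G₂ nz₁) B₂))

  join-reflectsₗ : ∀ G₁ G₂ H₁ H₂ nz₁ nz₂ nz₁′ nz₂′ →
    joinRanked G₁ G₂ nz₁ nz₂ ⊑ joinRanked H₁ H₂ nz₁′ nz₂′ → G₁ ⊑ H₁
  join-reflectsₗ G₁ G₂ H₁ H₂ nz₁ nz₂ nz₁′ nz₂′ sub x x∈ = Equivalence.from (joinₗ (fc H₁) (fc H₂) nz₂′ x)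
    (proj₁ x∈ , trans (sym (dot-inl (normal K) x)) (proj₂ (sub (append x origin) (inl-face W J x (Equivalence.to (joinₗ (fc G₁) (fc G₂) nz₂ x) x∈)))))
    where
    J = scaledJoin (fc G₁) (fc G₂)
    K = scaledJoin (fc H₁) (fc H₂)

  join-reflectsᵣ : ∀ G₁ G₂ H₁ H₂ nz₁ nz₂ nz₁′ nz₂′ →
    joinRanked G₁ G₂ nz₁ nz₂ ⊑ joinRanked H₁ H₂ nz₁′ nz₂′ → G₂ ⊑ H₂
  join-reflectsᵣ G₁ G₂ H₁ H₂ nz₁ nz₂ nz₁′ nz₂′ sub y y∈ = Equivalence.from (joinᵣ (fc H₁) (fc H₂) nz₁′ y)
    (proj₁ y∈ , trans (sym (dot-inr (normal K) y)) (proj₂ (sub (append origin y) (inr-face W J y (Equivalence.to (joinᵣ (fc G₁) (fc G₂) nz₁ y) y∈)))))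
    where
    J = scaledJoin (fc G₁) (fc G₂)
    K = scaledJoin (fc H₁) (fc H₂)

  join-avoids-origin : ∀ G₁ G₂ nz₁ nz₂ → ¬ points (joinRanked G₁ G₂ nz₁ nz₂) origin
  join-avoids-origin G₁ G₂ nz₁ nz₂ 0∈ = nz₁ (*-cancel-0 nz₂ (origin-rhs (scaledJoin (fc G₁) (fc G₂)) 0∈))

rootAt : ∀ {n} {R : BRel n} (F : Face (OrderPolytope R)) → faceSet F origin → RootedFace R
rootAt F 0∈F = record
  { F = F ; M = proj₁ (levels F) ; L = proj₁ (proj₂ (levels F)) ; inhabited = proj₂ (proj₂ (levels F)) ; root = 0∈F }

ι : ∀ {n} {R : BRel n} → IsPoset R → Vec Bool n → RankedFace (OrderPolytope R)
ι {R = R} P v = rooted (rootedFace R P v)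

Free : ∀ {n} {R : BRel n} → IsPoset R → RankedFace (OrderPolytope R) → Set
Free {n} P F = All (λ v → ¬ F ≋ ι P v) (subsets n)

unrooted-free : ∀ {n} {R : BRel n} (P : IsPoset R) F → ¬ points F origin → Free P F
unrooted-free {n} {R} P F 0∉F = All.universal
  (λ v eq → 0∉F (Equivalence.from (eq origin) (RootedFace.root (rootedFace R P v)))) (subsets n)

data Search {n : ℕ} {R : BRel n} (P : IsPoset R) (F : RankedFace (OrderPolytope R)) : Set where
  found : ∀ v → F ≋ ι P v → Search P F
  free  : Free P F → Search P F

search : ∀ {n} {R : BRel n} (P : IsPoset R) F → Search P F
search {n} P F = go (subsets n) free
  where
  cases : ∀ v {vs} → (All (λ v → ¬ F ≋ ι P v) (v ∷ vs) → Search P F) → Dec (F ≋ ι P v) →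
    All (λ v → ¬ F ≋ ι P v) vs → Search P F
  cases v k (yes eq) _   = found v eq
  cases v k (no neq) all = k (neq ∷ all)
  go : ∀ vs → (All (λ v → ¬ F ≋ ι P v) vs → Search P F) → Search P F
  go []       k = k []
  go (v ∷ vs) k = go vs (cases v k (F ≋? ι P v))

ι-coord-rank : ∀ {n} {R : BRel n} (P : IsPoset R) (R′ : BRel n) v → rank (ι P v) ≡ rank (coordRanked R′ v)
ι-coord-rank {R = R} P R′ v = rootedFace-rank R P v

AvoidingCoords : ∀ {n} {R : BRel n} → IsPoset R → BRel n → Set
AvoidingCoords {n} P R′ = Avoiding (ι P) (coordRanked R′) (subsets n)

avoidingCoords : ∀ {n} {R : BRel n} (P : IsPoset R) (R′ : BRel n) →
  Embedding (OrderPolytope R) (ChainPolytope R′) → AvoidingCoords P R′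
avoidingCoords {n} {R} P R′ e = avoiding (ι P) (coordRanked R′) e (ι-coord-rank P R′)
  (λ v w eq → rootedFace-inj R P v w (≋⇒⊑ {F = ι P v} {ι P w} eq) (≋⇒⊑ {F = ι P w} {ι P v} (≋-sym (ι P v) (ι P w) eq)))
  (subsets-unique n)

-- An image with right-hand side 0 would be a coordinate face by `rhs-zero-coord`, and all
-- coordinate faces have been freed.
avoiding-rhs : ∀ {n} {R : BRel n} {P : IsPoset R} {R′ : BRel n} (A : AvoidingCoords P R′) F → Free P F →
  rhs (fc (Avoiding.embed A F)) ≢ 0ℚ
avoiding-rhs {R′ = R′} A F F-free eq = All.lookup (Avoiding.avoids A F F-free) (∈-subsets v) v≋
  where
  v = proj₁ (rhs-zero-coord R′ (Avoiding.embed A F) eq)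
  v≋ = proj₂ (rhs-zero-coord R′ (Avoiding.embed A F) eq)

count-++ : ∀ {m n} (v : Vec Bool m) (w : Vec Bool n) → count (v Vec.++ w) ≡ count v ℕ.+ count w
count-++ []          w = refl
count-++ (true ∷ v)  w = cong suc (count-++ v w)
count-++ (false ∷ v) w = count-++ v w

coord-++-inj : ∀ {m n} (R : BRel (m ℕ.+ n)) (v v′ : Vec Bool m) (w w′ : Vec Bool n) →
  coordRanked R (v Vec.++ w) ≋ coordRanked R (v′ Vec.++ w′) → v ≡ v′ × w ≡ w′
coord-++-inj R v v′ w w′ eq = Vec.++-injective v v′ (lookup-ext (v Vec.++ w) (v′ Vec.++ w′)
    (coord-inj R (v Vec.++ w) (v′ Vec.++ w′) (≋⇒⊑ {F = coordRanked R (v Vec.++ w)} {coordRanked R (v′ Vec.++ w′)} eq))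
    (coord-inj R (v′ Vec.++ w′) (v Vec.++ w) (≋⇒⊑ {F = coordRanked R (v′ Vec.++ w′)} {coordRanked R (v Vec.++ w)}
      (≋-sym (coordRanked R (v Vec.++ w)) (coordRanked R (v′ Vec.++ w′)) eq))))
  where
  bool-ext : ∀ {a b} → (a ≡ true → b ≡ true) → (b ≡ true → a ≡ true) → a ≡ b
  bool-ext {true}  f g = sym (f refl)
  bool-ext {false} {true}  f g = g refl
  bool-ext {false} {false} f g = refl
  lookup-ext : ∀ {k} (a b : Vec Bool k) → (∀ i → lookup a i ≡ true → lookup b i ≡ true) →
    (∀ i → lookup b i ≡ true → lookup a i ≡ true) → a ≡ b
  lookup-ext []      []      f g = refl
  lookup-ext (x ∷ a) (y ∷ b) f g = cong₂ _∷_ (bool-ext (f zero) (g zero)) (lookup-ext a b (f ∘ suc) (g ∘ suc))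

-- The posets on the order side and on the chain side are separate parameters, because the upper
-- part of an ordinal sum enters the order side with its dual.
module WedgeEmbedding {m n : ℕ} {R₁ : BRel m} {R₂ : BRel n} (P₁ : IsPoset R₁) (P₂ : IsPoset R₂)
    {R₁′ : BRel m} {R₂′ : BRel n} {Z : PointSet (m ℕ.+ n)} {R′ : BRel (m ℕ.+ n)}
    (W : Wedge (OrderPolytope R₁) (OrderPolytope R₂) Z)
    (W′ : Wedge (ChainPolytope R₁′) (ChainPolytope R₂′) (ChainPolytope R′))
    (A₁ : AvoidingCoords P₁ R₁′) (A₂ : AvoidingCoords P₂ R₂′) where

  F₁ : Face Z → RankedFace (OrderPolytope R₁)
  F₁ F = rankedBy (order-bases R₁) (leftFace W F)

  F₂ : Face Z → RankedFace (OrderPolytope R₂)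
  F₂ F = rankedBy (order-bases R₂) (rightFace W F)

  root₁ : ∀ F → rhs F ≡ 0ℚ → faceSet (leftFace W F) origin
  root₁ F = rhs-origin (leftFace W F) (Wedge.origin-l W)

  root₂ : ∀ F → rhs F ≡ 0ℚ → faceSet (rightFace W F) origin
  root₂ F = rhs-origin (rightFace W F) (Wedge.origin-r W)

  rooted₁ : ∀ F → rhs F ≡ 0ℚ → RootedFace R₁
  rooted₁ F e = rootAt {R = R₁} (leftFace W F) (root₁ F e)

  rooted₂ : ∀ F → rhs F ≡ 0ℚ → RootedFace R₂
  rooted₂ F e = rootAt {R = R₂} (rightFace W F) (root₂ F e)

  shift₁ : ∀ F (e : rhs F ≡ 0ℚ) → Shifted {R = R₁} (rooted₁ F e)
  shift₁ F e = shift {R = R₁} (rooted₁ F e)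

  shift₂ : ∀ F (e : rhs F ≡ 0ℚ) → Shifted {R = R₂} (rooted₂ F e)
  shift₂ F e = shift {R = R₂} (rooted₂ F e)

  data JoinKind (F : Face Z) : Set where
    apart      : rhs F ≢ 0ℚ → JoinKind F
    shiftRight : rhs F ≡ 0ℚ → Free P₁ (F₁ F) → JoinKind F
    shiftLeft  : rhs F ≡ 0ℚ → Free P₂ (F₂ F) → JoinKind F

  data Kind (F : Face Z) : Set where
    joint  : JoinKind F → Kind F
    coords : rhs F ≡ 0ℚ → ∀ v w → F₁ F ≋ ι P₁ v → F₂ F ≋ ι P₂ w → Kind F

  kind : ∀ F → Kind F
  kind F = cases (rhs F ℚ.≟ 0ℚ)
    where
    rooted-cases : rhs F ≡ 0ℚ → Search P₁ (F₁ F) → Search P₂ (F₂ F) → Kind F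
    -- If neither face is an `ι`, either of them could be shifted; the right one is.
    rooted-cases e (free f)    _            = joint (shiftRight e f)
    rooted-cases e (found _ _) (free f)     = joint (shiftLeft e f)
    rooted-cases e (found v p) (found w q)  = coords e v w p q
    cases : Dec (rhs F ≡ 0ℚ) → Kind F
    cases (yes e) = rooted-cases e (search P₁ (F₁ F)) (search P₂ (F₂ F))
    cases (no ¬e) = joint (apart ¬e)

  G₁ : ∀ F → JoinKind F → RankedFace (OrderPolytope R₁)
  G₁ F (apart _)        = F₁ F
  G₁ F (shiftRight _ _) = F₁ F
  G₁ F (shiftLeft e _)  = Shifted.G (shift₁ F e)

  G₂ : ∀ F → JoinKind F → RankedFace (OrderPolytope R₂)
  G₂ F (apart _)        = F₂ F
  G₂ F (shiftRight e _) = Shifted.G (shift₂ F e)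
  G₂ F (shiftLeft _ _)  = F₂ F

  unrooted₁ : ∀ F → rhs F ≢ 0ℚ → ¬ points (F₁ F) origin
  unrooted₁ F nz 0∈ = nz (origin-rhs (leftFace W F) 0∈)

  unrooted₂ : ∀ F → rhs F ≢ 0ℚ → ¬ points (F₂ F) origin
  unrooted₂ F nz 0∈ = nz (origin-rhs (rightFace W F) 0∈)

  free₁ : ∀ F j → Free P₁ (G₁ F j)
  free₁ F (apart nz)       = unrooted-free P₁ (F₁ F) (unrooted₁ F nz)
  free₁ F (shiftRight _ f) = f
  free₁ F (shiftLeft e _)  = unrooted-free P₁ (Shifted.G (shift₁ F e)) (Shifted.avoids-root (shift₁ F e))

  free₂ : ∀ F j → Free P₂ (G₂ F j)
  free₂ F (apart nz)       = unrooted-free P₂ (F₂ F) (unrooted₂ F nz)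
  free₂ F (shiftRight e _) = unrooted-free P₂ (Shifted.G (shift₂ F e)) (Shifted.avoids-root (shift₂ F e))
  free₂ F (shiftLeft _ f)  = f

  ψ₁ = Avoiding.embed A₁
  ψ₂ = Avoiding.embed A₂

  joined : ∀ F → JoinKind F → RankedFace (ChainPolytope R′)
  joined F j = Join.joinRanked W′ (ψ₁ (G₁ F j)) (ψ₂ (G₂ F j))
    (avoiding-rhs A₁ (G₁ F j) (free₁ F j)) (avoiding-rhs A₂ (G₂ F j) (free₂ F j))

  image : ∀ F → Kind F → RankedFace (ChainPolytope R′)
  image F (joint j)           = joined F j
  image F (coords _ v w _ _) = coordRanked R′ (v Vec.++ w)

  rank-apart : ∀ F {k} → rhs F ≢ 0ℚ → Basis (faceSet F) k → rank (F₁ F) ℕ.+ rank (F₂ F) ≡ k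
  rank-apart F nz B = Basis-unique (faceSet F) (faceSet F) (λ _ → mk⇔ id id)
    (wedge-basis W F nz (basis (F₁ F)) (basis (F₂ F))) B

  rank-rooted : ∀ F {k} → rhs F ≡ 0ℚ → Basis (faceSet F) k → rank (F₁ F) ℕ.+ rank (F₂ F) ≡ suc k
  rank-rooted F e B = cases (exchange (basis (F₁ F)) origin (root₁ F e)) (exchange (basis (F₂ F)) origin (root₂ F e))
    where
    cases : _ → _ → rank (F₁ F) ℕ.+ rank (F₂ F) ≡ suc _
    cases (k , e₁ , B₁ , z₁) (l , e₂ , B₂ , z₂) = trans (cong₂ ℕ._+_ e₁ e₂) (trans (cong suc (ℕ.+-suc k l))
      (cong suc (Basis-unique (faceSet F) (faceSet F) (λ _ → mk⇔ id id) (wedge-basis₀ W F e B₁ z₁ B₂ z₂) B)))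

  -- Replacing one component by a facet lowers the sum of the ranks by one, exactly the amount lost
  -- at the shared origin.
  joined-rank : ∀ F j {k} → Basis (faceSet F) k → rank (G₁ F j) ℕ.+ rank (G₂ F j) ≡ k
  joined-rank F (apart nz) B = rank-apart F nz B
  joined-rank F (shiftRight e _) B = ℕ.suc-injective (trans (sym (ℕ.+-suc (rank (F₁ F)) (rank (Shifted.G (shift₂ F e)))))
    (trans (cong (rank (F₁ F) ℕ.+_) (Shifted.G-rank (shift₂ F e))) (rank-rooted F e B)))
  joined-rank F (shiftLeft e _) B = ℕ.suc-injective (trans (cong (ℕ._+ rank (F₂ F)) (Shifted.G-rank (shift₁ F e)))
    (rank-rooted F e B))

  image-rank : ∀ F κ {k} → Basis (faceSet F) k → rank (image F κ) ≡ k
  image-rank F (joint j) B = trans (cong₂ ℕ._+_ (Avoiding.embed-rank A₁ (G₁ F j)) (Avoiding.embed-rank A₂ (G₂ F j)))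
    (joined-rank F j B)
  -- The ranks `count v + 1` and `count w + 1` share the origin, which leaves the rank of the
  -- coordinate face of the concatenation.
  image-rank F (coords e v w p q) B = trans (cong suc (count-++ v w)) (ℕ.suc-injective
    (trans (trans (cong suc (sym (ℕ.+-suc (count v) (count w)))) (sym (cong₂ ℕ._+_
      (trans (≋-rank (F₁ F) (ι P₁ v) p) (rootedFace-rank R₁ P₁ v)) (trans (≋-rank (F₂ F) (ι P₂ w) q) (rootedFace-rank R₂ P₂ w)))))
      (rank-rooted F e B)))

  -- Which components contain the origin reveals the case: neither for `apart`, only the left for
  -- `shiftRight`, only the right for `shiftLeft`. Different cases are therefore contradictory, and
  -- in equal cases `shift-reflects` undoes the passage to a facet.
  decode : ∀ F G (j : JoinKind F) (k : JoinKind G) → G₁ F j ⊑ G₁ G k → G₁ G k ⊑ G₁ F j → G₂ F j ⊑ G₂ G k → G₂ G k ⊑ G₂ F j →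
    F₁ F ⊑ F₁ G × F₂ F ⊑ F₂ G
  decode F G (apart _) (apart _) s _ t _ = s , t
  decode F G (shiftRight e _) (shiftRight e′ _) s _ t _ =
    s , shift-reflects {R = R₂} (rooted₂ F e) (rooted₂ G e′) t
  decode F G (shiftLeft e _) (shiftLeft e′ _) s _ t _ =
    shift-reflects {R = R₁} (rooted₁ F e) (rooted₁ G e′) s , t
  decode F G (apart nz) (shiftRight e _) _ s _ _ = ⊥-elim (unrooted₁ F nz (s origin (root₁ G e)))
  decode F G (apart nz) (shiftLeft e _) _ _ _ t = ⊥-elim (unrooted₂ F nz (t origin (root₂ G e)))
  decode F G (shiftRight e _) (apart nz) s _ _ _ = ⊥-elim (unrooted₁ G nz (s origin (root₁ F e)))
  decode F G (shiftLeft e _) (apart nz) _ _ t _ = ⊥-elim (unrooted₂ G nz (t origin (root₂ F e)))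
  decode F G (shiftRight e _) (shiftLeft e′ _) s _ _ _ =
    ⊥-elim (Shifted.avoids-root (shift₁ G e′) (s origin (root₁ F e)))
  decode F G (shiftLeft e _) (shiftRight e′ _) _ s _ _ =
    ⊥-elim (Shifted.avoids-root (shift₁ F e) (s origin (root₁ G e′)))

  same-faces : ∀ F G → F₁ F ⊑ F₁ G × F₂ F ⊑ F₂ G → F₁ G ⊑ F₁ F × F₂ G ⊑ F₂ F → SameSet (faceSet F) (faceSet G)
  same-faces F G (s , t) (s′ , t′) x = mk⇔ (faces-determined W F G s t x) (faces-determined W G F s′ t′ x)

  joined-inj : ∀ F G j k → joined F j ≋ joined G k → SameSet (faceSet F) (faceSet G)
  joined-inj F G j k eq = same-faces F G (decode F G j k (to₁ e₁) (from₁ e₁) (to₂ e₂) (from₂ e₂))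
    (decode G F k j (from₁ e₁) (to₁ e₁) (from₂ e₂) (to₂ e₂))
    where
    sub : joined F j ⊑ joined G k
    sub = ≋⇒⊑ {F = joined F j} {joined G k} eq
    sup : joined G k ⊑ joined F j
    sup = ≋⇒⊑ {F = joined G k} {joined F j} (≋-sym (joined F j) (joined G k) eq)
    nz₁ : ∀ F j → rhs (fc (ψ₁ (G₁ F j))) ≢ 0ℚ
    nz₁ F j = avoiding-rhs A₁ (G₁ F j) (free₁ F j)
    nz₂ : ∀ F j → rhs (fc (ψ₂ (G₂ F j))) ≢ 0ℚ
    nz₂ F j = avoiding-rhs A₂ (G₂ F j) (free₂ F j)
    left⊑ : ∀ F G j k → joined F j ⊑ joined G k → ψ₁ (G₁ F j) ⊑ ψ₁ (G₁ G k)
    left⊑ F G j k = Join.join-reflectsₗ W′ (ψ₁ (G₁ F j)) (ψ₂ (G₂ F j)) (ψ₁ (G₁ G k)) (ψ₂ (G₂ G k))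
      (nz₁ F j) (nz₂ F j) (nz₁ G k) (nz₂ G k)
    right⊑ : ∀ F G j k → joined F j ⊑ joined G k → ψ₂ (G₂ F j) ⊑ ψ₂ (G₂ G k)
    right⊑ F G j k = Join.join-reflectsᵣ W′ (ψ₁ (G₁ F j)) (ψ₂ (G₂ F j)) (ψ₁ (G₁ G k)) (ψ₂ (G₂ G k))
      (nz₁ F j) (nz₂ F j) (nz₁ G k) (nz₂ G k)
    e₁ : G₁ F j ≋ G₁ G k
    e₁ = Avoiding.embed-inj A₁ (G₁ F j) (G₁ G k) (free₁ F j) (free₁ G k)
      (≋-intro {F = ψ₁ (G₁ F j)} {ψ₁ (G₁ G k)} (left⊑ F G j k sub) (left⊑ G F k j sup))
    e₂ : G₂ F j ≋ G₂ G k
    e₂ = Avoiding.embed-inj A₂ (G₂ F j) (G₂ G k) (free₂ F j) (free₂ G k)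
      (≋-intro {F = ψ₂ (G₂ F j)} {ψ₂ (G₂ G k)} (right⊑ F G j k sub) (right⊑ G F k j sup))
    to₁ : G₁ F j ≋ G₁ G k → G₁ F j ⊑ G₁ G k
    to₁ = ≋⇒⊑ {F = G₁ F j} {G₁ G k}
    from₁ : G₁ F j ≋ G₁ G k → G₁ G k ⊑ G₁ F j
    from₁ eq x = Equivalence.from (eq x)
    to₂ : G₂ F j ≋ G₂ G k → G₂ F j ⊑ G₂ G k
    to₂ = ≋⇒⊑ {F = G₂ F j} {G₂ G k}
    from₂ : G₂ F j ≋ G₂ G k → G₂ G k ⊑ G₂ F j
    from₂ eq x = Equivalence.from (eq x)

  coord-root : ∀ v → points (coordRanked R′ v) origin
  coord-root v = coordFace-on R′ v origin (chain-origin R′) (λ _ _ → refl)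

  joined-unrooted : ∀ F j → ¬ points (joined F j) origin
  joined-unrooted F j = Join.join-avoids-origin W′ (ψ₁ (G₁ F j)) (ψ₂ (G₂ F j))
    (avoiding-rhs A₁ (G₁ F j) (free₁ F j)) (avoiding-rhs A₂ (G₂ F j) (free₂ F j))

  image-inj : ∀ F G κ λ′ → image F κ ≋ image G λ′ → SameSet (faceSet F) (faceSet G)
  image-inj F G (joint j) (joint k) eq = joined-inj F G j k eq
  -- Coordinate faces contain the origin and joins avoid it.
  image-inj F G (joint j) (coords _ v w _ _) eq =
    ⊥-elim (joined-unrooted F j (Equivalence.from (eq origin) (coord-root (v Vec.++ w))))
  image-inj F G (coords _ v w _ _) (joint j) eq =
    ⊥-elim (joined-unrooted G j (Equivalence.to (eq origin) (coord-root (v Vec.++ w))))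
  image-inj F G (coords _ v w p q) (coords _ v′ w′ p′ q′) eq = same-faces F G
    ((λ x → Equivalence.to (e₁ x)) , λ x → Equivalence.to (e₂ x))
    ((λ x → Equivalence.from (e₁ x)) , λ x → Equivalence.from (e₂ x))
    where
    same = coord-++-inj R′ v v′ w w′ eq
    e₁ : F₁ F ≋ F₁ G
    e₁ = ≋-trans (F₁ F) (ι P₁ v) (F₁ G) p (≋-sym (F₁ G) (ι P₁ v) (subst (λ v → F₁ G ≋ ι P₁ v) (sym (proj₁ same)) p′))
    e₂ : F₂ F ≋ F₂ G
    e₂ = ≋-trans (F₂ F) (ι P₂ w) (F₂ G) q (≋-sym (F₂ G) (ι P₂ w) (subst (λ w → F₂ G ≋ ι P₂ w) (sym (proj₂ same)) q′))

  wedge-embedding : Embedding Z (ChainPolytope R′)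
  wedge-embedding = record
    { embed      = λ F → image (fc F) (kind (fc F))
    ; embed-rank = λ F → image-rank (fc F) (kind (fc F)) (basis F)
    ; embed-inj  = λ F G → image-inj (fc F) (fc G) (kind (fc F)) (kind (fc G)) }

-- X-free posets

dual : ∀ {n} → BRel n → BRel n
dual R i j = R j i

dual-poset : ∀ {n} {R : BRel n} → IsPoset R → IsPoset (dual R)
dual-poset P = record
  { refl = IsPoset.refl P ; antisym = λ i j p q → IsPoset.antisym P i j q p
  ; trans = λ i j k p q → IsPoset.trans P k j i q p }

complement : ∀ {n} → Point n → Point n
complement x i = 1ℚ - x i

complement-involutive : ∀ a → 1ℚ - (1ℚ - a) ≡ a
complement-involutive = solve-∀ ringℚ

complement-mem : ∀ {n} (R : BRel n) x → OrderPolytope R x → OrderPolytope (dual R) (complement x)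
complement-mem R x (nonneg , bound , mono) =
  (λ i → ≤-sub (bound i)) ,
  (λ i → ≤-add (subst (0ℚ ≤_) (sym (complement-involutive (x i))) (nonneg i))) ,
  λ i j Rji → ≤-add (subst (0ℚ ≤_) (lem (x j) (x i)) (≤-sub (mono j i Rji)))
  where
  lem : ∀ a b → b - a ≡ 1ℚ - a - (1ℚ - b)
  lem = solve-∀ ringℚ

complement-affine : ∀ {n} {h : Point n → ℚ} → AffineForm h → AffineForm (λ x → 1ℚ - h x)
complement-affine = sub-affine (const-affine 1ℚ)

bit-T : ∀ {b} → T b → bit b ≡ 1ℚ
bit-T {true} _ = refl

bit-¬T : ∀ {b} → ¬ T b → bit b ≡ 0ℚ
bit-¬T {true}  ¬b = contradiction tt ¬b
bit-¬T {false} _  = refl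

bit-mono-T : ∀ {a b} → (T a → T b) → bit a ≤ bit b
bit-mono-T {true}  {b} f = ℚ.≤-reflexive (sym (bit-T (f tt)))
bit-mono-T {false} {b} f = bit-nonneg b

T-bool : ∀ {a b} → (T a → T b) → (T b → T a) → a ≡ b
T-bool {true}  {true}  _ _ = refl
T-bool {true}  {false} f _ = contradiction (f tt) id
T-bool {false} {true}  _ g = contradiction (g tt) id
T-bool {false} {false} _ _ = refl

T⇒true : ∀ {b} → T b → b ≡ true
T⇒true = T-bool (λ _ → tt) ∘ λ t _ → t

true⇒T : ∀ {b} → b ≡ true → T b
true⇒T refl = tt

Comparable : ∀ {n} → BRel n → Fin n → Fin n → Set
Comparable R a b = T (R a b) ⊎ T (R b a)

comparable? : ∀ {n} (R : BRel n) a b → Dec (Comparable R a b)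
comparable? R a b = Bool.T? (R a b) ⊎-dec Bool.T? (R b a)

ChainBelow : ∀ {n} → BRel n → Fin n → Set
ChainBelow R c = ∀ a b → T (R a c) → T (R b c) → Comparable R a b

Fork : ∀ {n} → BRel n → Fin n → Set
Fork {n} R c = Σ (Fin n) λ a → Σ (Fin n) λ b → T (R a c) × T (R b c) × ¬ Comparable R a b

chainBelow? : ∀ {n} (R : BRel n) c → Dec (ChainBelow R c)
chainBelow? R c = Fin.all? λ a → Fin.all? λ b →
  Bool.T? (R a c) →-dec (Bool.T? (R b c) →-dec comparable? R a b)

fork : ∀ {n} (R : BRel n) c → ¬ ChainBelow R c → Fork R c
fork R c ¬chain with Fin.any? (λ a → Fin.any? (λ b → Bool.T? (R a c) ×-dec (Bool.T? (R b c) ×-dec ¬? (comparable? R a b))))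
... | yes exists = exists
... | no none   = contradiction chain ¬chain
  where
  chain : ChainBelow R c
  chain a b ac bc with comparable? R a b
  ... | yes comp = comp
  ... | no ¬comp = contradiction (a , b , ac , bc , ¬comp) none

-- A fork below c together with a fork above c is an induced X.
X-free-fork : ∀ {n} {R : BRel n} → IsPoset R → XFree R → ∀ c → Fork R c → ¬ Fork (dual R) c
X-free-fork {n} {R} P X-free c (a , b , a≤c , b≤c , a∥b) (d , e , c≤d , c≤e , d∥e) = X-free (f , f-inj , f-rel)
  where
  open IsPoset P renaming (refl to reflR; trans to transR)
  f : Fin 5 → Fin n
  f zero                         = a
  f (suc zero)                   = b
  f (suc (suc zero))             = c
  f (suc (suc (suc zero)))       = d
  f (suc (suc (suc (suc zero)))) = e
  off : ∀ {x} → ¬ T x → x ≡ false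
  off ¬x = T-bool (λ x → contradiction x ¬x) (λ ())
  c≰a : ¬ T (R c a)
  c≰a c≤a = a∥b (inj₂ (transR b c a b≤c c≤a))
  c≰b : ¬ T (R c b)
  c≰b c≤b = a∥b (inj₁ (transR a c b a≤c c≤b))
  d≰c : ¬ T (R d c)
  d≰c d≤c = d∥e (inj₂ (transR d c e d≤c c≤e))
  e≰c : ¬ T (R e c)
  e≰c e≤c = d∥e (inj₁ (transR e c d e≤c c≤d))
  f-rel : ∀ x y → R (f x) (f y) ≡ XPoset x y
  f-rel zero zero = T⇒true (reflR a)
  f-rel zero (suc zero) = off (a∥b ∘ inj₁)
  f-rel zero (suc (suc zero)) = T⇒true a≤c
  f-rel zero (suc (suc (suc zero))) = T⇒true (transR a c d a≤c c≤d)
  f-rel zero (suc (suc (suc (suc zero)))) = T⇒true (transR a c e a≤c c≤e)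
  f-rel (suc zero) zero = off (a∥b ∘ inj₂)
  f-rel (suc zero) (suc zero) = T⇒true (reflR b)
  f-rel (suc zero) (suc (suc zero)) = T⇒true b≤c
  f-rel (suc zero) (suc (suc (suc zero))) = T⇒true (transR b c d b≤c c≤d)
  f-rel (suc zero) (suc (suc (suc (suc zero)))) = T⇒true (transR b c e b≤c c≤e)
  f-rel (suc (suc zero)) zero = off c≰a
  f-rel (suc (suc zero)) (suc zero) = off c≰b
  f-rel (suc (suc zero)) (suc (suc zero)) = T⇒true (reflR c)
  f-rel (suc (suc zero)) (suc (suc (suc zero))) = T⇒true c≤d
  f-rel (suc (suc zero)) (suc (suc (suc (suc zero)))) = T⇒true c≤e
  f-rel (suc (suc (suc zero))) zero = off (λ d≤a → d≰c (transR d a c d≤a a≤c))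
  f-rel (suc (suc (suc zero))) (suc zero) = off (λ d≤b → d≰c (transR d b c d≤b b≤c))
  f-rel (suc (suc (suc zero))) (suc (suc zero)) = off d≰c
  f-rel (suc (suc (suc zero))) (suc (suc (suc zero))) = T⇒true (reflR d)
  f-rel (suc (suc (suc zero))) (suc (suc (suc (suc zero)))) = off (d∥e ∘ inj₂)
  f-rel (suc (suc (suc (suc zero)))) zero = off (λ e≤a → e≰c (transR e a c e≤a a≤c))
  f-rel (suc (suc (suc (suc zero)))) (suc zero) = off (λ e≤b → e≰c (transR e b c e≤b b≤c))
  f-rel (suc (suc (suc (suc zero)))) (suc (suc zero)) = off e≰c
  f-rel (suc (suc (suc (suc zero)))) (suc (suc (suc zero))) = off (d∥e ∘ inj₁)
  f-rel (suc (suc (suc (suc zero)))) (suc (suc (suc (suc zero)))) = T⇒true (reflR e)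
  -- Injectivity follows from the relation alone: `f` reflects the order, `R` is reflexive, and the
  -- X-poset is antisymmetric by enumeration.
  XPoset-antisym : ∀ x y → T (XPoset x y) → T (XPoset y x) → x ≡ y
  XPoset-antisym = from-yes (Fin.all? λ x → Fin.all? λ y →
    Bool.T? (XPoset x y) →-dec (Bool.T? (XPoset y x) →-dec x Fin.≟ y))
  f-inj : ∀ x y → f x ≡ f y → x ≡ y
  f-inj x y eq = XPoset-antisym x y
    (subst T (f-rel x y) (subst (λ z → T (R (f x) z)) eq (reflR (f x))))
    (subst T (f-rel y x) (subst (λ z → T (R (f y) z)) (sym eq) (reflR (f y))))

top-of : ∀ {n N} (R : BRel N) → IsPoset R → (g : Fin n → Fin N) (p : Fin n → Bool) →
  (∀ a b → T (p a) → T (p b) → Comparable R (g a) (g b)) →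
  (∀ a → ¬ T (p a)) ⊎ Σ (Fin n) λ a → T (p a) × ∀ b → T (p b) → T (R (g b) (g a))
top-of {zero}  R P g p chain = inj₁ λ ()
top-of {suc n} R P g p chain with top-of R P (g ∘ suc) (p ∘ suc) (λ a b → chain (suc a) (suc b)) | Bool.T? (p zero)
... | inj₁ none | no ¬p₀ = inj₁ λ { zero → ¬p₀ ; (suc a) → none a }
... | inj₁ none | yes p₀ = inj₂ (zero , p₀ , λ { zero _ → IsPoset.refl P (g zero) ; (suc b) pb → contradiction pb (none b) })
... | inj₂ (a , pa , top) | no ¬p₀ = inj₂ (suc a , pa , λ { zero p₀ → contradiction p₀ ¬p₀ ; (suc b) → top b })
... | inj₂ (a , pa , top) | yes p₀ with chain zero (suc a) p₀ pa
...   | inj₁ 0≤a = inj₂ (suc a , pa , λ { zero _ → 0≤a ; (suc b) → top b })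
...   | inj₂ a≤0 = inj₂ (zero , p₀ , λ where
          zero    _  → IsPoset.refl P (g zero)
          (suc b) pb → IsPoset.trans P (g (suc b)) (g (suc a)) (g zero) (top b pb) a≤0)

-- For `dual R` this is the unique upper cover, and `none` means that `c` is maximal.
data Predecessor {n : ℕ} (R : BRel n) (c : Fin n) : Set where
  none : (∀ i → T (R i c) → i ≡ c) → Predecessor R c
  pred : ∀ d → T (R d c) → d ≢ c → (∀ i → T (R i c) → i ≢ c → T (R i d)) → Predecessor R c

predValue : ∀ {n} {R : BRel n} {c} → Predecessor R c → Point n → ℚ
predValue (none _)       x = 0ℚ
predValue (pred d _ _ _) x = x d

predValue-affine : ∀ {n} {R : BRel n} {c} (p : Predecessor R c) → AffineForm (predValue p)
predValue-affine (none _)       = const-affine 0ℚ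
predValue-affine (pred d _ _ _) = coord-affine d

down : ∀ {n} → BRel n → Fin n → Point n
down R c i = bit (R i c)

-- Summation over the principal ideal of `c`. Where that ideal is a chain, it is inverse to
-- subtracting the value at the predecessor.
downSum : ∀ {n} → BRel n → Point n → Point n
downSum R z c = dot (down R c) z

dot-ind-mono : ∀ {n} (p q : Fin n → Bool) {z : Point n} → (∀ i → 0ℚ ≤ z i) → (∀ i → T (p i) → T (q i)) → dot (ind p) z ≤ dot (ind q) z
dot-ind-mono p q {z} nonneg sub = sum-mono λ i → subst (_≤ bit (q i) * z i) (ℚ.*-comm (z i) (bit (p i)))
  (subst (z i * bit (p i) ≤_) (ℚ.*-comm (z i) (bit (q i))) (*-monoˡ (nonneg i) (bit-mono-T (sub i))))

module _ {n : ℕ} {R : BRel n} (P : IsPoset R) where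
  open IsPoset P renaming (refl to reflR; trans to transR)

  predecessor : ∀ c → ChainBelow R c → Predecessor R c
  predecessor c chain = cases (top-of R P id strict (λ a b a<c b<c → chain a b (proj₁ (strict⁻ a a<c)) (proj₁ (strict⁻ b b<c))))
    where
    strict : Fin n → Bool
    strict i = does (Bool.T? (R i c) ×-dec ¬? (i Fin.≟ c))
    strict⁺ : ∀ i → T (R i c) → i ≢ c → T (strict i)
    strict⁺ i i≤c i≢c = true⇒T (does-true (Bool.T? (R i c) ×-dec ¬? (i Fin.≟ c)) (i≤c , i≢c))
    strict⁻ : ∀ i → T (strict i) → T (R i c) × i ≢ c
    strict⁻ i s = true-does (Bool.T? (R i c) ×-dec ¬? (i Fin.≟ c)) (T⇒true s)
    cases : _ → Predecessor R c
    cases (inj₁ empty) = none λ i i≤c → only i i≤c (i Fin.≟ c)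
      where
      only : ∀ i → T (R i c) → Dec (i ≡ c) → i ≡ c
      only i i≤c (yes eq) = eq
      only i i≤c (no neq) = contradiction (strict⁺ i i≤c neq) (empty i)
    cases (inj₂ (d , d<c , top)) = pred d (proj₁ (strict⁻ d d<c)) (proj₂ (strict⁻ d d<c)) λ i i≤c i≢c → top i (strict⁺ i i≤c i≢c)

  -- The principal ideal of `c` consists of `c` and the principal ideal of its predecessor.
  downSum-step : ∀ z c (p : Predecessor R c) → downSum R z c ≡ z c + predValue p (downSum R z)
  downSum-step z c (none only) = trans (dot-congˡ z single) (trans (dot-unitˡ c z) (sym (ℚ.+-identityʳ (z c))))
    where
    single : ∀ i → bit (R i c) ≡ unit c i
    single i with c Fin.≟ i
    ... | yes refl = bit-T (reflR c)
    ... | no c≢i   = bit-¬T λ i≤c → c≢i (sym (only i i≤c))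
  downSum-step z c (pred d d≤c d≢c top) = trans (dot-congˡ z split-c)
    (trans (dot-+ˡ (unit c) (down R d) z) (cong (_+ downSum R z d) (dot-unitˡ c z)))
    where
    split-c : ∀ i → bit (R i c) ≡ unit c i + bit (R i d)
    split-c i with c Fin.≟ i
    ... | yes refl = trans (bit-T (reflR c)) (sym (trans (cong (1ℚ +_) (bit-¬T λ c≤d → d≢c (antisym d c d≤c c≤d))) (ℚ.+-identityʳ 1ℚ)))
    ... | no c≢i   = trans (cong bit (T-bool (λ i≤c → top i i≤c (c≢i ∘ sym)) (λ i≤d → transR i d c i≤d d≤c)))
                       (sym (ℚ.+-identityˡ (bit (R i d))))

  strict-wellFounded : WellFounded (λ a b → T (R a b) × a ≢ b)
  strict-wellFounded = spo-wellFounded record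
    { isEquivalence = ≡.isEquivalence
    ; irrefl = λ { refl (_ , neq) → neq refl }
    ; trans = λ { {a} {b} {c} (ab , a≢b) (bc , _) → transR a b c ab bc , λ { refl → a≢b (antisym a b ab bc) } }
    ; <-resp-≈ = (λ { refl p → p }) , (λ { refl p → p }) }

  -- Telescoping along the chain below c.
  downSum-inverse : ∀ (Q : Fin n → Set) → (∀ d c → T (R d c) → Q c → Q d) → ∀ (x y : Point n) →
    (∀ c → Q c → Σ (Predecessor R c) λ p → y c ≡ x c - predValue p x) →
    ∀ c → Q c → downSum R y c ≡ x c
  downSum-inverse Q Q-down x y eq c = go c (strict-wellFounded c)
    where
    go : ∀ c → Acc (λ a b → T (R a b) × a ≢ b) c → Q c → downSum R y c ≡ x c
    go c (acc rs) q = trans (downSum-step y c p) (trans (cong₂ _+_ (proj₂ (eq c q)) (pred-eq p rs)) (lem (x c) (predValue p x)))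
      where
      p = proj₁ (eq c q)
      pred-eq : (p : Predecessor R c) → (∀ {d} → T (R d c) × d ≢ c → Acc (λ a b → T (R a b) × a ≢ b) d) →
        predValue p (downSum R y) ≡ predValue p x
      pred-eq (none _) _ = refl
      pred-eq (pred d d≤c d≢c _) rs = go d (rs (d≤c , d≢c)) (Q-down d c d≤c q)
      lem : ∀ a b → a - b + b ≡ a
      lem = solve-∀ ringℚ

  downSum-nonneg : ∀ {z} → (∀ i → 0ℚ ≤ z i) → ∀ c → 0ℚ ≤ downSum R z c
  downSum-nonneg nonneg c = sum-nonneg (λ i → 0≤* (bit-nonneg (R i c)) (nonneg i))

  predValue≤ : ∀ x → OrderPolytope R x → ∀ {c} (p : Predecessor R c) → predValue p x ≤ x c
  predValue≤ x (nonneg , _ , _) {c} (none _)         = nonneg c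
  predValue≤ x (_ , _ , mono)   {c} (pred d d≤c _ _) = mono d c d≤c

-- The affine equivalence of Hibi and Li for X-free posets

module HibiLi {n : ℕ} {R : BRel n} (P : IsPoset R) (X-free : XFree R) where

  P° : IsPoset (dual R)
  P° = dual-poset P

  Low : Fin n → Set
  Low c = ChainBelow R c

  low-down : ∀ d c → T (R d c) → Low c → Low d
  low-down d c d≤c chain a b a≤d b≤d = chain a b (IsPoset.trans P a d c a≤d d≤c) (IsPoset.trans P b d c b≤d d≤c)

  high-up : ∀ d c → T (R c d) → ¬ Low c → ¬ Low d
  high-up d c c≤d ¬low low = ¬low (low-down c d c≤d low)

  -- This is where X-freeness enters: an element with a fork below it cannot have one above it, so
  -- every element has a chain on at least one side.
  chain-above : ∀ c → ¬ Low c → ChainBelow (dual R) c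
  chain-above c ¬low with chainBelow? (dual R) c
  ... | yes chain = chain
  ... | no ¬chain = contradiction (fork (dual R) c ¬chain) (X-free-fork P X-free c (fork R c ¬low))

  predLow : ∀ c → Low c → Predecessor R c
  predLow c low = predecessor P c low

  predHigh : ∀ c → ¬ Low c → Predecessor (dual R) c
  predHigh c ¬low = predecessor P° c (chain-above c ¬low)

  -- Below an element of the lower part everything is a chain, so its coordinate is measured from
  -- below; the coordinates of the other elements are measured from above.
  toChain′ : ∀ c → Dec (Low c) → Point n → ℚ
  toChain′ c (yes low) x = x c - predValue (predLow c low) x
  toChain′ c (no ¬low) x = complement x c - predValue (predHigh c ¬low) (complement x)

  toOrder′ : ∀ c → Dec (Low c) → Point n → ℚ
  toOrder′ c (yes _) z = downSum R z c
  toOrder′ c (no _)  z = 1ℚ - downSum (dual R) z c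

  toChain : Point n → Point n
  toChain x c = toChain′ c (chainBelow? R c) x

  toOrder : Point n → Point n
  toOrder z c = toOrder′ c (chainBelow? R c) z

  chain-low : ∀ x c → Low c → Σ (Predecessor R c) λ p → toChain x c ≡ x c - predValue p x
  chain-low x c low = cases (chainBelow? R c)
    where
    cases : ∀ d → Σ (Predecessor R c) λ p → toChain′ c d x ≡ x c - predValue p x
    cases (yes low′) = predLow c low′ , refl
    cases (no ¬low)  = contradiction low ¬low

  chain-high : ∀ x c → ¬ Low c → Σ (Predecessor (dual R) c) λ p →
    toChain x c ≡ complement x c - predValue p (complement x)
  chain-high x c ¬low = cases (chainBelow? R c)
    where
    cases : ∀ d → Σ (Predecessor (dual R) c) λ p → toChain′ c d x ≡ complement x c - predValue p (complement x)
    cases (yes low)   = contradiction low ¬low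
    cases (no ¬low′)  = predHigh c ¬low′ , refl

  order-low : ∀ z c → Low c → toOrder z c ≡ downSum R z c
  order-low z c low = cases (chainBelow? R c)
    where
    cases : ∀ d → toOrder′ c d z ≡ downSum R z c
    cases (yes _)   = refl
    cases (no ¬low) = contradiction low ¬low

  order-high : ∀ z c → ¬ Low c → toOrder z c ≡ 1ℚ - downSum (dual R) z c
  order-high z c ¬low = cases (chainBelow? R c)
    where
    cases : ∀ d → toOrder′ c d z ≡ 1ℚ - downSum (dual R) z c
    cases (yes low) = contradiction low ¬low
    cases (no _)    = refl

  downSum-toChain : ∀ x c → Low c → downSum R (toChain x) c ≡ x c
  downSum-toChain x = downSum-inverse P Low low-down x (toChain x) (chain-low x)

  upSum-toChain : ∀ x c → ¬ Low c → downSum (dual R) (toChain x) c ≡ complement x c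
  upSum-toChain x = downSum-inverse P° (λ c → ¬ Low c) high-up (complement x) (toChain x) (chain-high x)

  order-chain : ∀ x c → toOrder (toChain x) c ≡ x c
  order-chain x c = cases (chainBelow? R c)
    where
    cases : Dec (Low c) → toOrder (toChain x) c ≡ x c
    cases (yes low) = trans (order-low (toChain x) c low) (downSum-toChain x c low)
    cases (no ¬low) = trans (order-high (toChain x) c ¬low)
      (trans (cong (λ z → 1ℚ - z) (upSum-toChain x c ¬low)) (complement-involutive (x c)))

  predValue-order-low : ∀ z {c} (p : Predecessor R c) → Low c → predValue p (toOrder z) ≡ predValue p (downSum R z)
  predValue-order-low z (none _)             low = refl
  predValue-order-low z {c} (pred d d≤c _ _) low = order-low z d (low-down d c d≤c low)

  predValue-order-high : ∀ z {c} (p : Predecessor (dual R) c) → ¬ Low c →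
    predValue p (complement (toOrder z)) ≡ predValue p (downSum (dual R) z)
  predValue-order-high z (none _)             ¬low = refl
  predValue-order-high z {c} (pred d c≤d _ _) ¬low =
    trans (cong (λ a → 1ℚ - a) (order-high z d (high-up d c c≤d ¬low))) (complement-involutive (downSum (dual R) z d))

  chain-order : ∀ z c → toChain (toOrder z) c ≡ z c
  chain-order z c = cases (chainBelow? R c)
    where
    lem : ∀ a b → a + b - b ≡ a
    lem = solve-∀ ringℚ
    cases : Dec (Low c) → toChain (toOrder z) c ≡ z c
    cases (yes low) = trans (proj₂ (chain-low (toOrder z) c low)) (trans
      (cong₂ _-_ (trans (order-low z c low) (downSum-step P z c p)) (predValue-order-low z p low))
      (lem (z c) (predValue p (downSum R z))))
      where p = proj₁ (chain-low (toOrder z) c low)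
    cases (no ¬low) = trans (proj₂ (chain-high (toOrder z) c ¬low)) (trans
      (cong₂ _-_ (trans (trans (cong (λ a → 1ℚ - a) (order-high z c ¬low)) (complement-involutive (downSum (dual R) z c)))
          (downSum-step P° z c p)) (predValue-order-high z p ¬low))
      (lem (z c) (predValue p (downSum (dual R) z))))
      where p = proj₁ (chain-high (toOrder z) c ¬low)

  toChain-nonneg : ∀ x → OrderPolytope R x → ∀ c → 0ℚ ≤ toChain x c
  toChain-nonneg x x∈ c = cases (chainBelow? R c)
    where
    cases : Dec (Low c) → 0ℚ ≤ toChain x c
    cases (yes low) = subst (0ℚ ≤_) (sym (proj₂ (chain-low x c low)))
      (≤-sub (predValue≤ P x x∈ (proj₁ (chain-low x c low))))
    cases (no ¬low) = subst (0ℚ ≤_) (sym (proj₂ (chain-high x c ¬low)))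
      (≤-sub (predValue≤ P° (complement x) (complement-mem R x x∈) (proj₁ (chain-high x c ¬low))))

  -- A chain splits into its low elements and the others. By telescoping, the first contribute at
  -- most the coordinate of their top `a`, the second at most 1 minus the coordinate of their bottom
  -- `b`, and `x a ≤ x b`.
  toChain-mem : ∀ x → OrderPolytope R x → ChainPolytope R (toChain x)
  toChain-mem x x∈ = chainPolytope-intro R y y≥0 sums
    where
    y = toChain x
    y≥0 = toChain-nonneg x x∈
    sums : ∀ C → IsChain R C → dot (ind C) y ≤ 1ℚ
    sums C chain = subst (_≤ 1ℚ) (sym (trans (dot-congˡ y parts) (dot-+ˡ (ind Cₗ) (ind Cₕ) y)))
      (cases (top-of R P id Cₗ (λ a b p q → comparable a b (proj₁ (Cₗ⁻ a p)) (proj₁ (Cₗ⁻ b q))))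
             (top-of (dual R) P° id Cₕ (λ a b p q → comparable b a (proj₁ (Cₕ⁻ b q)) (proj₁ (Cₕ⁻ a p)))))
      where
      Cₗ Cₕ : Fin n → Bool
      Cₗ i = C i ∧ does (chainBelow? R i)
      Cₕ i = C i ∧ not (does (chainBelow? R i))
      comparable : ∀ a b → T (C a) → T (C b) → Comparable R a b
      comparable a b Ca Cb = chain a b (T⇒true Ca) (T⇒true Cb)
      ∧⁻ : ∀ {a b} → T (a ∧ b) → T a × T b
      ∧⁻ {true} {true} _ = tt , tt
      Cₗ⁻ : ∀ i → T (Cₗ i) → T (C i) × Low i
      Cₗ⁻ i t = proj₁ (∧⁻ t) , true-does (chainBelow? R i) (T⇒true (proj₂ (∧⁻ {C i} t)))
      Cₕ⁻ : ∀ i → T (Cₕ i) → T (C i) × ¬ Low i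
      Cₕ⁻ i t = proj₁ (∧⁻ t) , λ low → T-not (does-true (chainBelow? R i) low) (proj₂ (∧⁻ {C i} t))
        where
        T-not : ∀ {b} → b ≡ true → ¬ T (not b)
        T-not refl ()
      parts : ∀ i → bit (C i) ≡ bit (Cₗ i) + bit (Cₕ i)
      parts i = bits (C i) (does (chainBelow? R i))
        where
        bits : ∀ a b → bit a ≡ bit (a ∧ b) + bit (a ∧ not b)
        bits true  true  = refl
        bits true  false = refl
        bits false _     = refl
      empty : ∀ (p : Fin n → Bool) → (∀ i → ¬ T (p i)) → dot (ind p) y ≡ 0ℚ
      empty p out = dot-0ˡ y (λ i → bit-¬T (out i))
      below-top : ∀ a → T (Cₗ a) → (∀ b → T (Cₗ b) → T (R b a)) → dot (ind Cₗ) y ≤ x a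
      below-top a a∈ top = subst (dot (ind Cₗ) y ≤_) (downSum-toChain x a (proj₂ (Cₗ⁻ a a∈)))
        (dot-ind-mono Cₗ (λ i → R i a) y≥0 top)
      above-bottom : ∀ b → T (Cₕ b) → (∀ i → T (Cₕ i) → T (R b i)) → dot (ind Cₕ) y ≤ 1ℚ - x b
      above-bottom b b∈ bot = subst (dot (ind Cₕ) y ≤_) (upSum-toChain x b (proj₂ (Cₕ⁻ b b∈)))
        (dot-ind-mono Cₕ (λ i → R b i) y≥0 bot)
      separated : ∀ a b → T (Cₗ a) → T (Cₕ b) → x a ≤ x b
      separated a b a∈ b∈ = go (comparable a b (proj₁ (Cₗ⁻ a a∈)) (proj₁ (Cₕ⁻ b b∈)))
        where
        go : _ → x a ≤ x b
        go (inj₁ a≤b) = proj₂ (proj₂ x∈) a b a≤b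
        go (inj₂ b≤a) = contradiction (low-down b a b≤a (proj₂ (Cₗ⁻ a a∈))) (proj₂ (Cₕ⁻ b b∈))
      cases : _ → _ → dot (ind Cₗ) y + dot (ind Cₕ) y ≤ 1ℚ
      cases (inj₁ noL) (inj₁ noH) = subst (_≤ 1ℚ) (sym (cong₂ _+_ (empty Cₗ noL) (empty Cₕ noH))) 0≤1
      cases (inj₂ (a , a∈ , top)) (inj₁ noH) = subst (_≤ 1ℚ)
        (sym (trans (cong (dot (ind Cₗ) y +_) (empty Cₕ noH)) (ℚ.+-identityʳ (dot (ind Cₗ) y))))
        (ℚ.≤-trans (below-top a a∈ top) (proj₁ (proj₂ x∈) a))
      cases (inj₁ noL) (inj₂ (b , b∈ , bot)) = subst (_≤ 1ℚ)
        (sym (trans (cong (_+ dot (ind Cₕ) y) (empty Cₗ noL)) (ℚ.+-identityˡ (dot (ind Cₕ) y))))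
        (ℚ.≤-trans (above-bottom b b∈ bot) (proj₁ (proj₂ (complement-mem R x x∈)) b))
      cases (inj₂ (a , a∈ , top)) (inj₂ (b , b∈ , bot)) = ℚ.≤-trans
        (ℚ.+-mono-≤ (ℚ.≤-trans (below-top a a∈ top) (separated a b a∈ b∈)) (above-bottom b b∈ bot))
        (ℚ.≤-reflexive (add-sub (x b) 1ℚ))

  module _ (z : Point n) (z∈ : ChainPolytope R z) where

    downSum≤1 : ∀ c → Low c → downSum R z c ≤ 1ℚ
    downSum≤1 c low = chain-sum {R = R} z∈ (λ i → R i c) λ i j i≤c j≤c → low i j (true⇒T i≤c) (true⇒T j≤c)

    upSum≤1 : ∀ c → ¬ Low c → downSum (dual R) z c ≤ 1ℚ
    upSum≤1 c ¬low = chain-sum {R = R} z∈ (λ i → R c i) λ i j c≤i c≤j → chain-above c ¬low j i (true⇒T c≤j) (true⇒T c≤i)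

    -- The ideal of `c` and the filter of `d` together form one chain, and its inequality is the
    -- monotonicity of `toOrder` across the two parts.
    crossing : ∀ c d → T (R c d) → Low c → ¬ Low d → downSum R z c + downSum (dual R) z d ≤ 1ℚ
    crossing c d c≤d low ¬low = subst (_≤ 1ℚ) (trans (dot-congˡ z parts) (dot-+ˡ (down R c) (down (dual R) d) z))
      (chain-sum {R = R} z∈ C C-chain)
      where
      C : Fin n → Bool
      C i = R i c ∨ R d i
      ∨⁻ : ∀ {a b} → a ∨ b ≡ true → T a ⊎ T b
      ∨⁻ {true}  _  = inj₁ tt
      ∨⁻ {false} eq = inj₂ (true⇒T eq)
      C-chain : IsChain R C
      C-chain i j Ci Cj = go (∨⁻ Ci) (∨⁻ Cj)
        where
        trans³ : ∀ i j → T (R i c) → T (R d j) → T (R i j)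
        trans³ i j i≤c d≤j = IsPoset.trans P i c j i≤c (IsPoset.trans P c d j c≤d d≤j)
        go : _ → _ → Comparable R i j
        go (inj₁ i≤c) (inj₁ j≤c) = low i j i≤c j≤c
        go (inj₂ d≤i) (inj₂ d≤j) = chain-above d ¬low j i d≤j d≤i
        go (inj₁ i≤c) (inj₂ d≤j) = inj₁ (trans³ i j i≤c d≤j)
        go (inj₂ d≤i) (inj₁ j≤c) = inj₂ (trans³ j i j≤c d≤i)
      disjoint : ∀ i → T (R i c) → ¬ T (R d i)
      disjoint i i≤c d≤i = ¬low (low-down d c (IsPoset.trans P d i c d≤i i≤c) low)
      bits : ∀ a b → (T a → ¬ T b) → bit (a ∨ b) ≡ bit a + bit b
      bits true  true  f = contradiction tt (f tt)
      bits true  false f = refl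
      bits false true  f = refl
      bits false false f = refl
      parts : ∀ i → bit (R i c ∨ R d i) ≡ bit (R i c) + bit (R d i)
      parts i = bits (R i c) (R d i) (disjoint i)

    private
      z≥0 = proj₁ z∈
      compl≥0 : ∀ {a} → a ≤ 1ℚ → 0ℚ ≤ 1ℚ - a
      compl≥0 = ≤-sub
      compl≤1 : ∀ {a} → 0ℚ ≤ a → 1ℚ - a ≤ 1ℚ
      compl≤1 {a} 0≤a = ≤-add (subst (0ℚ ≤_) (sym (complement-involutive a)) 0≤a)

    toOrder-mem : OrderPolytope R (toOrder z)
    toOrder-mem = (λ c → nonneg c (chainBelow? R c)) , (λ c → bound c (chainBelow? R c)) ,
      λ c d c≤d → mono c d c≤d (chainBelow? R c) (chainBelow? R d)
      where
      nonneg : ∀ c → (d : Dec (Low c)) → 0ℚ ≤ toOrder′ c d z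
      nonneg c (yes low) = downSum-nonneg P z≥0 c
      nonneg c (no ¬low) = compl≥0 (upSum≤1 c ¬low)
      bound : ∀ c → (d : Dec (Low c)) → toOrder′ c d z ≤ 1ℚ
      bound c (yes low) = downSum≤1 c low
      bound c (no ¬low) = compl≤1 (downSum-nonneg P° z≥0 c)
      lem : ∀ a b → 1ℚ - (a + b) ≡ 1ℚ - b - a
      lem = solve-∀ ringℚ
      lem₂ : ∀ a b → a - b ≡ 1ℚ - b - (1ℚ - a)
      lem₂ = solve-∀ ringℚ
      mono : ∀ c d → T (R c d) → (p : Dec (Low c)) (q : Dec (Low d)) → toOrder′ c p z ≤ toOrder′ d q z
      mono c d c≤d (yes _) (yes _) = dot-ind-mono (λ i → R i c) (λ i → R i d) z≥0 (λ i i≤c → IsPoset.trans P i c d i≤c c≤d)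
      mono c d c≤d (no _) (no _) = ≤-add (subst (0ℚ ≤_) (lem₂ (downSum (dual R) z c) (downSum (dual R) z d))
        (≤-sub (dot-ind-mono (λ i → R d i) (λ i → R c i) z≥0 (λ i d≤i → IsPoset.trans P c d i c≤d d≤i))))
      mono c d c≤d (yes low) (no ¬low) = ≤-add (subst (0ℚ ≤_) (lem (downSum R z c) (downSum (dual R) z d))
        (≤-sub (crossing c d c≤d low ¬low)))
      mono c d c≤d (no ¬low) (yes low) = contradiction (low-down c d c≤d low) ¬low

  predValue-complement : ∀ {c} (p : Predecessor (dual R) c) → AffineForm (λ x → predValue p (complement x))
  predValue-complement (none _)       = const-affine 0ℚ
  predValue-complement (pred d _ _ _) = complement-affine (coord-affine d)

  toChain-affine : ∀ c (d : Dec (Low c)) → AffineForm (toChain′ c d)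
  toChain-affine c (yes low) = sub-affine (coord-affine c) (predValue-affine (predLow c low))
  toChain-affine c (no ¬low) = sub-affine (complement-affine (coord-affine c)) (predValue-complement (predHigh c ¬low))

  toOrder-affine : ∀ c (d : Dec (Low c)) → AffineForm (toOrder′ c d)
  toOrder-affine c (yes _) = dot-affine (down R c) coord-affine
  toOrder-affine c (no _)  = complement-affine (dot-affine (down (dual R) c) coord-affine)

  equivalence : AffineEquiv (OrderPolytope R) (ChainPolytope R)
  equivalence = record
    { to          = toChain
    ; from        = toOrder
    ; to-affine   = λ c → toChain-affine c (chainBelow? R c)
    ; from-affine = λ c → toOrder-affine c (chainBelow? R c)
    ; to-mem      = toChain-mem
    ; from-mem    = toOrder-mem
    ; from-to     = λ x _ → order-chain x
    ; to-from     = λ z _ → chain-order z }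

-- Disjoint unions and ordinal sums

union-ll : ∀ {m n} (P : BRel m) (Q : BRel n) i j → disjointUnion P Q (i ↑ˡ n) (j ↑ˡ n) ≡ P i j
union-ll {m} {n} P Q i j rewrite Fin.splitAt-↑ˡ m i n | Fin.splitAt-↑ˡ m j n = refl

union-rr : ∀ {m n} (P : BRel m) (Q : BRel n) i j → disjointUnion P Q (m ↑ʳ i) (m ↑ʳ j) ≡ Q i j
union-rr {m} {n} P Q i j rewrite Fin.splitAt-↑ʳ m n i | Fin.splitAt-↑ʳ m n j = refl

union-lr : ∀ {m n} (P : BRel m) (Q : BRel n) i j → disjointUnion P Q (i ↑ˡ n) (m ↑ʳ j) ≡ false
union-lr {m} {n} P Q i j rewrite Fin.splitAt-↑ˡ m i n | Fin.splitAt-↑ʳ m n j = refl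

union-rl : ∀ {m n} (P : BRel m) (Q : BRel n) i j → disjointUnion P Q (m ↑ʳ i) (j ↑ˡ n) ≡ false
union-rl {m} {n} P Q i j rewrite Fin.splitAt-↑ʳ m n i | Fin.splitAt-↑ˡ m j n = refl

ordinal-ll : ∀ {m n} (P : BRel m) (Q : BRel n) i j → ordinalSum P Q (i ↑ˡ n) (j ↑ˡ n) ≡ P i j
ordinal-ll {m} {n} P Q i j rewrite Fin.splitAt-↑ˡ m i n | Fin.splitAt-↑ˡ m j n = refl

ordinal-rr : ∀ {m n} (P : BRel m) (Q : BRel n) i j → ordinalSum P Q (m ↑ʳ i) (m ↑ʳ j) ≡ Q i j
ordinal-rr {m} {n} P Q i j rewrite Fin.splitAt-↑ʳ m n i | Fin.splitAt-↑ʳ m n j = refl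

ordinal-lr : ∀ {m n} (P : BRel m) (Q : BRel n) i j → ordinalSum P Q (i ↑ˡ n) (m ↑ʳ j) ≡ true
ordinal-lr {m} {n} P Q i j rewrite Fin.splitAt-↑ˡ m i n | Fin.splitAt-↑ʳ m n j = refl

ordinal-rl : ∀ {m n} (P : BRel m) (Q : BRel n) i j → ordinalSum P Q (m ↑ʳ i) (j ↑ˡ n) ≡ false
ordinal-rl {m} {n} P Q i j rewrite Fin.splitAt-↑ʳ m n i | Fin.splitAt-↑ˡ m j n = refl

-- Both constructions are block matrices that differ only in the constant block from left to right,
-- so their common properties are proved once.
record Blocks {m n : ℕ} (P : BRel m) (Q : BRel n) (cross : Bool) (R : BRel (m ℕ.+ n)) : Set where
  field
    ll : ∀ i j → R (i ↑ˡ n) (j ↑ˡ n) ≡ P i j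
    rr : ∀ i j → R (m ↑ʳ i) (m ↑ʳ j) ≡ Q i j
    lr : ∀ i j → R (i ↑ˡ n) (m ↑ʳ j) ≡ cross
    rl : ∀ i j → R (m ↑ʳ i) (j ↑ˡ n) ≡ false

union-blocks : ∀ {m n} (P : BRel m) (Q : BRel n) → Blocks P Q false (disjointUnion P Q)
union-blocks P Q = record { ll = union-ll P Q ; rr = union-rr P Q ; lr = union-lr P Q ; rl = union-rl P Q }

ordinal-blocks : ∀ {m n} (P : BRel m) (Q : BRel n) → Blocks P Q true (ordinalSum P Q)
ordinal-blocks P Q = record { ll = ordinal-ll P Q ; rr = ordinal-rr P Q ; lr = ordinal-lr P Q ; rl = ordinal-rl P Q }

module _ {m n : ℕ} {P : BRel m} {Q : BRel n} {cross : Bool} {R : BRel (m ℕ.+ n)} (B : Blocks P Q cross R) where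
  open Blocks B

  blocks-elim : (K : Fin (m ℕ.+ n) → Fin (m ℕ.+ n) → Set) →
    (∀ i j → T (P i j) → K (i ↑ˡ n) (j ↑ˡ n)) → (∀ i j → T (Q i j) → K (m ↑ʳ i) (m ↑ʳ j)) →
    (T cross → ∀ i j → K (i ↑ˡ n) (m ↑ʳ j)) → ∀ i j → T (R i j) → K i j
  blocks-elim K kl kr kc = split-elim m (λ i → ∀ j → T (R i j) → K i j)
    (λ i → split-elim m (λ j → T (R (i ↑ˡ n) j) → K (i ↑ˡ n) j)
      (λ j t → kl i j (subst T (ll i j) t)) (λ j t → kc (subst T (lr i j) t) i j))
    (λ i → split-elim m (λ j → T (R (m ↑ʳ i) j) → K (m ↑ʳ i) j)
      (λ j t → contradiction (subst T (rl i j) t) id) (λ j t → kr i j (subst T (rr i j) t)))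

  blocks-poset : IsPoset P → IsPoset Q → IsPoset R
  blocks-poset p q = record
    { refl = split-elim m (λ i → T (R i i)) (λ i → subst T (sym (ll i i)) (IsPoset.refl p i))
        (λ j → subst T (sym (rr j j)) (IsPoset.refl q j))
    ; antisym = λ i j t t′ → blocks-elim (λ i j → T (R j i) → i ≡ j)
        (λ i j t t′ → cong (_↑ˡ n) (IsPoset.antisym p i j t (subst T (ll j i) t′)))
        (λ i j t t′ → cong (m ↑ʳ_) (IsPoset.antisym q i j t (subst T (rr j i) t′)))
        (λ _ i j t′ → contradiction (subst T (rl j i) t′) id) i j t t′
    ; trans = λ i j k t t′ → blocks-elim (λ i j → ∀ k → T (R j k) → T (R i k))
        (λ i j t → split-elim m (λ k → T (R (j ↑ˡ n) k) → T (R (i ↑ˡ n) k))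
          (λ k t′ → subst T (sym (ll i k)) (IsPoset.trans p i j k t (subst T (ll j k) t′)))
          (λ k t′ → subst T (trans (lr j k) (sym (lr i k))) t′))
        (λ i j t → split-elim m (λ k → T (R (m ↑ʳ j) k) → T (R (m ↑ʳ i) k))
          (λ k t′ → contradiction (subst T (rl j k) t′) id)
          (λ k t′ → subst T (sym (rr i k)) (IsPoset.trans q i j k t (subst T (rr j k) t′))))
        (λ c i j → split-elim m (λ k → T (R (m ↑ʳ j) k) → T (R (i ↑ˡ n) k))
          (λ k t′ → contradiction (subst T (rl j k) t′) id)
          (λ k _ → subst T (sym (lr i k)) c)) i j t k t′ }

  order-append : ∀ x y → OrderPolytope P x → OrderPolytope Q y → (T cross → ∀ i j → x i ≤ y j) →
    OrderPolytope R (append x y)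
  order-append x y (nonneg , bound , mono) (nonneg′ , bound′ , mono′) crossing =
    split-elim m (λ i → 0ℚ ≤ z i) (λ i → subst (0ℚ ≤_) (zl i) (nonneg i)) (λ j → subst (0ℚ ≤_) (zr j) (nonneg′ j)) ,
    split-elim m (λ i → z i ≤ 1ℚ) (λ i → subst (_≤ 1ℚ) (zl i) (bound i)) (λ j → subst (_≤ 1ℚ) (zr j) (bound′ j)) ,
    blocks-elim (λ i j → z i ≤ z j)
      (λ i j t → subst (_≤ z (j ↑ˡ n)) (zl i) (subst (x i ≤_) (zl j) (mono i j t)))
      (λ i j t → subst (_≤ z (m ↑ʳ j)) (zr i) (subst (y i ≤_) (zr j) (mono′ i j t)))
      (λ c i j → subst (_≤ z (m ↑ʳ j)) (zl i) (subst (x i ≤_) (zr j) (crossing c i j)))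
    where
    z : Point (m ℕ.+ n)
    z = append x y
    zl : ∀ i → x i ≡ z (i ↑ˡ n)
    zl i = sym (append-l x y i)
    zr : ∀ j → y j ≡ z (m ↑ʳ j)
    zr j = sym (append-r x y j)

  order-left : ∀ z → OrderPolytope R z → OrderPolytope P (left m z)
  order-left z (nonneg , bound , mono) = (λ i → nonneg (i ↑ˡ n)) , (λ i → bound (i ↑ˡ n)) ,
    λ i j t → mono (i ↑ˡ n) (j ↑ˡ n) (subst T (sym (ll i j)) t)

  order-right : ∀ z → OrderPolytope R z → OrderPolytope Q (right m z)
  order-right z (nonneg , bound , mono) = (λ j → nonneg (m ↑ʳ j)) , (λ j → bound (m ↑ʳ j)) ,
    λ i j t → mono (m ↑ʳ i) (m ↑ʳ j) (subst T (sym (rr i j)) t)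

  chain-left : ∀ C → IsChain R C → IsChain P (left m C)
  chain-left C chain i j Ci Cj with chain (i ↑ˡ n) (j ↑ˡ n) Ci Cj
  ... | inj₁ t = inj₁ (subst T (ll i j) t)
  ... | inj₂ t = inj₂ (subst T (ll j i) t)

  chain-right : ∀ C → IsChain R C → IsChain Q (right m C)
  chain-right C chain i j Ci Cj with chain (m ↑ʳ i) (m ↑ʳ j) Ci Cj
  ... | inj₁ t = inj₁ (subst T (rr i j) t)
  ... | inj₂ t = inj₂ (subst T (rr j i) t)

  chain-append : ∀ C D → IsChain P C → IsChain Q D → (∀ i j → C i ≡ true → D j ≡ true → T cross) → IsChain R (append C D)
  chain-append C D chainC chainD crossing = split-elim m (λ i → ∀ j → E i ≡ true → E j ≡ true → Comparable R i j)
    (λ i → split-elim m (λ j → E (i ↑ˡ n) ≡ true → E j ≡ true → Comparable R (i ↑ˡ n) j)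
      (λ j p q → case-l (chainC i j (El i p) (El j q)))
      (λ j p q → inj₁ (subst T (sym (lr i j)) (crossing i j (El i p) (Er j q)))))
    (λ i → split-elim m (λ j → E (m ↑ʳ i) ≡ true → E j ≡ true → Comparable R (m ↑ʳ i) j)
      (λ j p q → inj₂ (subst T (sym (lr j i)) (crossing j i (El j q) (Er i p))))
      (λ j p q → case-r (chainD i j (Er i p) (Er j q))))
    where
    E : Fin (m ℕ.+ n) → Bool
    E = append C D
    El : ∀ i → E (i ↑ˡ n) ≡ true → C i ≡ true
    El i = trans (sym (append-l C D i))
    Er : ∀ j → E (m ↑ʳ j) ≡ true → D j ≡ true
    Er j = trans (sym (append-r C D j))
    case-l : ∀ {i j} → Comparable P i j → Comparable R (i ↑ˡ n) (j ↑ˡ n)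
    case-l {i} {j} (inj₁ t) = inj₁ (subst T (sym (ll i j)) t)
    case-l {i} {j} (inj₂ t) = inj₂ (subst T (sym (ll j i)) t)
    case-r : ∀ {i j} → Comparable Q i j → Comparable R (m ↑ʳ i) (m ↑ʳ j)
    case-r {i} {j} (inj₁ t) = inj₁ (subst T (sym (rr i j)) t)
    case-r {i} {j} (inj₂ t) = inj₂ (subst T (sym (rr j i)) t)

  chain-dot : ∀ (C : Fin m → Bool) (D : Fin n → Bool) (z : Point (m ℕ.+ n)) →
    dot (ind (append C D)) z ≡ dot (ind C) (left m z) + dot (ind D) (right m z)
  chain-dot C D z = trans (dot-split m (ind (append C D)) z)
    (cong₂ _+_ (dot-congˡ (left m z) (λ i → cong bit (append-l C D i))) (dot-congˡ (right m z) (λ j → cong bit (append-r C D j))))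

  no-one : ∀ {k} → Fin k → Bool
  no-one _ = false

  chain-mem-left : ∀ z → ChainPolytope R z → ChainPolytope P (left m z)
  chain-mem-left z z∈ = chainPolytope-intro P (left m z) (λ i → proj₁ z∈ (i ↑ˡ n)) λ C chain →
    subst (_≤ 1ℚ) (trans (chain-dot C no-one z) (trans (cong (dot (ind C) (left m z) +_) (dot-0ˡ (right m z) (λ _ → refl)))
      (ℚ.+-identityʳ (dot (ind C) (left m z)))))
      (chain-sum {R = R} z∈ (append C no-one) (chain-append C no-one chain (λ _ _ ()) (λ _ _ _ ())))

  chain-mem-right : ∀ z → ChainPolytope R z → ChainPolytope Q (right m z)
  chain-mem-right z z∈ = chainPolytope-intro Q (right m z) (λ j → proj₁ z∈ (m ↑ʳ j)) λ D chain →
    subst (_≤ 1ℚ) (trans (chain-dot no-one D z) (trans (cong (_+ dot (ind D) (right m z)) (dot-0ˡ (left m z) (λ _ → refl)))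
      (ℚ.+-identityˡ (dot (ind D) (right m z)))))
      (chain-sum {R = R} z∈ (append no-one D) (chain-append no-one D (λ _ _ ()) chain (λ _ _ ())))

  append-nonneg : ∀ {x : Point m} {y : Point n} → (∀ i → 0ℚ ≤ x i) → (∀ j → 0ℚ ≤ y j) → ∀ k → 0ℚ ≤ append x y k
  append-nonneg {x} {y} p q = split-elim m (λ k → 0ℚ ≤ append x y k)
    (λ i → subst (0ℚ ≤_) (sym (append-l x y i)) (p i)) (λ j → subst (0ℚ ≤_) (sym (append-r x y j)) (q j))

module _ {m n : ℕ} (P : BRel m) (Q : BRel n) where
  private
    U = disjointUnion P Q
    B = union-blocks P Q

  order-product : Product (OrderPolytope P) (OrderPolytope Q) (OrderPolytope U)
  order-product = record
    { pair  = λ x y x∈ y∈ → order-append B x y x∈ y∈ (λ ())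
    ; parts = λ z z∈ → order-left B z z∈ , order-right B z z∈ }

  chain-product : Product (ChainPolytope P) (ChainPolytope Q) (ChainPolytope U)
  chain-product = record
    { pair  = λ x y x∈ y∈ → chainPolytope-intro U (append x y) (append-nonneg B (proj₁ x∈) (proj₁ y∈)) λ C chain →
        subst (_≤ 1ℚ) (sym (dot-append (ind C) x y))
          (one-sided C chain x y x∈ y∈ (Fin.any? (λ i → C (i ↑ˡ n) Bool.≟ true)))
    ; parts = λ z z∈ → chain-mem-left B z z∈ , chain-mem-right B z z∈ }
    where
    -- A chain of a disjoint union lies within one summand, so one of the two terms vanishes.
    one-sided : ∀ C → IsChain U C → ∀ x y → ChainPolytope P x → ChainPolytope Q y →
      Dec (Σ (Fin m) λ i → C (i ↑ˡ n) ≡ true) → dot (left m (ind C)) x + dot (right m (ind C)) y ≤ 1ℚ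
    one-sided C chain x y x∈ y∈ (no none-left) = subst (_≤ 1ℚ)
      (sym (trans (cong (_+ dot (right m (ind C)) y) (dot-0ˡ x (λ i → cong bit (Bool.¬-not (λ e → none-left (i , e))))))
        (ℚ.+-identityˡ (dot (right m (ind C)) y))))
      (chain-sum {R = Q} y∈ (right m C) (chain-right B C chain))
    one-sided C chain x y x∈ y∈ (yes (i , Ci)) = subst (_≤ 1ℚ)
      (sym (trans (cong (dot (left m (ind C)) x +_) (dot-0ˡ y (λ j → cong bit (Bool.¬-not (λ Cj → incomparable j (chain (i ↑ˡ n) (m ↑ʳ j) Ci Cj))))))
        (ℚ.+-identityʳ (dot (left m (ind C)) x))))
      (chain-sum {R = P} x∈ (left m C) (chain-left B C chain))
      where
      incomparable : ∀ j → ¬ Comparable U (i ↑ˡ n) (m ↑ʳ j)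
      incomparable j (inj₁ t) = subst T (Blocks.lr B i j) t
      incomparable j (inj₂ t) = subst T (Blocks.rl B j i) t

-- Wedge decompositions for ordinal sums

-- It yields the weight α of the left part in a wedge decomposition. Starting from 0 makes the
-- weight nonnegative also when there is nothing to maximise over.
supremum : ∀ {A : Set} (p : A → Set) → (∀ a → Dec (p a)) → (s : A → ℚ) (as : List A) →
  Σ ℚ λ α → 0ℚ ≤ α × (∀ {a} → a ∈ as → p a → s a ≤ α) × (∀ b → 0ℚ ≤ b → (∀ a → p a → s a ≤ b) → α ≤ b)
supremum p p? s [] = 0ℚ , ℚ.≤-refl , (λ ()) , λ _ 0≤b _ → 0≤b
supremum p p? s (a ∷ as) = extend (supremum p p? s as) (p? a)
  where
  extend : _ → Dec (p a) → _
  extend (α , 0≤α , upper , least) (no ¬pa) = α , 0≤α ,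
    (λ { (here refl) pa → contradiction pa ¬pa ; (there a∈) → upper a∈ }) , least
  extend (α , 0≤α , upper , least) (yes pa) = larger (ℚ.≤-total α (s a))
    where
    larger : α ≤ s a ⊎ s a ≤ α → _
    larger (inj₁ α≤) = s a , ℚ.≤-trans 0≤α α≤ ,
      (λ { (here refl) _ → ℚ.≤-refl ; (there a∈) pb → ℚ.≤-trans (upper a∈ pb) α≤ }) , λ b _ above → above a pa
    larger (inj₂ ≤α) = α , 0≤α , (λ { (here refl) _ → ≤α ; (there a∈) → upper a∈ }) , least

unscale : ∀ α b a → b * α ≡ 1ℚ → α * (b * a) ≡ a
unscale α b a bα≡1 = trans (lem α b a) (trans (cong (_* a) bα≡1) (ℚ.*-identityˡ a))
  where
  lem : ∀ α b a → α * (b * a) ≡ b * α * a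
  lem = solve-∀ ringℚ

order-scale : ∀ {n} (R : BRel n) (x : Point n) α → 0ℚ ≤ α → (∀ i → 0ℚ ≤ x i) → (∀ i → x i ≤ α) →
  (∀ i j → T (R i j) → x i ≤ x j) → Σ (Point n) λ x′ → OrderPolytope R x′ × ∀ i → x i ≡ α * x′ i
order-scale {n} R x α 0≤α nonneg bound mono = cases (α ℚ.≟ 0ℚ)
  where
  cases : Dec (α ≡ 0ℚ) → Σ (Point n) λ x′ → OrderPolytope R x′ × ∀ i → x i ≡ α * x′ i
  cases (yes α≡0) = origin , ((λ _ → ℚ.≤-refl) , (λ _ → 0≤1) , λ _ _ _ → ℚ.≤-refl) ,
    λ i → trans (ℚ.≤-antisym (subst (x i ≤_) α≡0 (bound i)) (nonneg i)) (sym (ℚ.*-zeroʳ α))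
  cases (no α≢0) = (λ i → b * x i) ,
    ((λ i → 0≤* 0≤b (nonneg i)) , (λ i → subst (b * x i ≤_) bα≡1 (*-monoˡ 0≤b (bound i))) ,
      λ i j Rij → *-monoˡ 0≤b (mono i j Rij)) ,
    λ i → sym (unscale α b (x i) bα≡1)
    where
    b = proj₁ (inverse α≢0)
    bα≡1 = proj₂ (inverse α≢0)
    0≤b : 0ℚ ≤ b
    0≤b = 0≤1/ {α} {b} (<-of-≤≢ 0≤α (α≢0 ∘ sym)) bα≡1

chain-scale : ∀ {n} {R : BRel n} → IsPoset R → (x : Point n) → ∀ α → 0ℚ ≤ α → (∀ i → 0ℚ ≤ x i) →
  (∀ C → IsChain R C → dot (ind C) x ≤ α) → Σ (Point n) λ x′ → ChainPolytope R x′ × ∀ i → x i ≡ α * x′ i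
chain-scale {n} {R} P x α 0≤α nonneg sums = cases (α ℚ.≟ 0ℚ)
  where
  singleton : Fin n → Fin n → Bool
  singleton i j = does (i Fin.≟ j)
  singleton-chain : ∀ i → IsChain R (singleton i)
  singleton-chain i j k ij ik with true-does (i Fin.≟ j) ij | true-does (i Fin.≟ k) ik
  ... | refl | refl = inj₁ (IsPoset.refl P i)
  singleton-sum : ∀ i → dot (ind (singleton i)) x ≡ x i
  singleton-sum i = trans (dot-congˡ x λ j → agree j (i Fin.≟ j)) (dot-unitˡ i x)
    where
    agree : ∀ j → (d : Dec (i ≡ j)) → bit (does d) ≡ unit i j
    agree j (yes refl) = sym (unit-diag i)
    agree j (no neq)   = sym (unit-off neq)
  cases : Dec (α ≡ 0ℚ) → Σ (Point n) λ x′ → ChainPolytope R x′ × ∀ i → x i ≡ α * x′ i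
  -- With bound 0 the singleton chains force every coordinate to vanish, and any point of the
  -- polytope can be scaled by 0.
  cases (yes α≡0) = origin , chain-origin R , λ i → trans (ℚ.≤-antisym
    (subst (_≤ 0ℚ) (singleton-sum i) (subst (dot (ind (singleton i)) x ≤_) α≡0 (sums (singleton i) (singleton-chain i)))) (nonneg i))
    (sym (ℚ.*-zeroʳ α))
  cases (no α≢0) = (λ i → b * x i) ,
    chainPolytope-intro R (λ i → b * x i) (λ i → 0≤* 0≤b (nonneg i))
      (λ C chain → subst (_≤ 1ℚ) (sym (dot-*ʳ (ind C) x b)) (subst (b * dot (ind C) x ≤_) bα≡1 (*-monoˡ 0≤b (sums C chain)))) ,
    λ i → sym (unscale α b (x i) bα≡1)
    where
    b = proj₁ (inverse α≢0)
    bα≡1 = proj₂ (inverse α≢0)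
    0≤b : 0ℚ ≤ b
    0≤b = 0≤1/ {α} {b} (<-of-≤≢ 0≤α (α≢0 ∘ sym)) bα≡1

module _ {m n : ℕ} {P : BRel m} {Q : BRel n} (p : IsPoset P) (q : IsPoset Q) where
  private
    R = ordinalSum P Q
    B = ordinal-blocks P Q

  -- The weight α is the largest sum over a chain of `P`. A chain of `P` and a chain of `Q` form a
  -- chain of the ordinal sum, so every chain of `Q` has sum at most 1 - α.
  chain-wedge : Wedge (ChainPolytope P) (ChainPolytope Q) (ChainPolytope R)
  chain-wedge = record
    { origin-l = chain-origin P ; origin-r = chain-origin Q
    ; inl = λ x x∈ → chainPolytope-intro R (append x origin) (append-nonneg B (proj₁ x∈) (λ _ → ℚ.≤-refl))
        λ C chain → subst (_≤ 1ℚ) (sym (dot-inl (ind C) x)) (chain-sum {R = P} x∈ (left m C) (chain-left B C chain))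
    ; inr = λ y y∈ → chainPolytope-intro R (append origin y) (append-nonneg B (λ _ → ℚ.≤-refl) (proj₁ y∈))
        λ C chain → subst (_≤ 1ℚ) (sym (dot-inr {m} (ind C) y)) (chain-sum {R = Q} y∈ (right m C) (chain-right B C chain))
    ; decompose = decomposition }
    where
    chain? : ∀ (v : Vec Bool m) → Dec (IsChain P (lookup v))
    chain? v = Fin.all? λ i → Fin.all? λ j →
      lookup v i Bool.≟ true →-dec (lookup v j Bool.≟ true →-dec comparable? P i j)
    decomposition : ∀ z → ChainPolytope R z → _
    decomposition z z∈ = from-sup (supremum (λ v → IsChain P (lookup v)) chain? (λ v → dot (ind (lookup v)) x) (subsets m))
      where
      x = left m z
      y = right m z
      from-sup : _ → _
      from-sup (α , 0≤α , upper , least) = assemble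
        (chain-scale p x α 0≤α (λ i → proj₁ z∈ (i ↑ˡ n)) sums-P)
        (chain-scale q y (1ℚ - α) (≤-sub α≤1) (λ j → proj₁ z∈ (m ↑ʳ j)) sums-Q)
        where
        sums-P : ∀ C → IsChain P C → dot (ind C) x ≤ α
        sums-P C chain = subst (_≤ α) (dot-congˡ x (λ i → cong bit (Vec.lookup∘tabulate C i)))
          (upper (∈-subsets (tabulate C)) λ i j Ci Cj → chain i j
            (trans (sym (Vec.lookup∘tabulate C i)) Ci) (trans (sym (Vec.lookup∘tabulate C j)) Cj))
        α≤1 : α ≤ 1ℚ
        α≤1 = least 1ℚ 0≤1 λ v chain → chain-sum {R = P} (chain-mem-left B z z∈) (lookup v) chain
        sums-Q : ∀ D → IsChain Q D → dot (ind D) y ≤ 1ℚ - α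
        sums-Q D chainD = ≤-add (subst (0ℚ ≤_) (lem (dot (ind D) y) α) (≤-sub
          (least (1ℚ - dot (ind D) y) (≤-sub (chain-sum {R = Q} (chain-mem-right B z z∈) D chainD)) λ v chain →
            ≤-add (subst (0ℚ ≤_) (lem₂ (dot (ind (lookup v)) x) (dot (ind D) y)) (≤-sub
              (subst (_≤ 1ℚ) (chain-dot B (lookup v) D z)
                (chain-sum {R = R} z∈ (append (lookup v) D) (chain-append B (lookup v) D chain chainD (λ _ _ _ _ → tt)))))))))
          where
          lem : ∀ d a → 1ℚ - d - a ≡ 1ℚ - a - d
          lem = solve-∀ ringℚ
          lem₂ : ∀ c d → 1ℚ - (c + d) ≡ 1ℚ - d - c
          lem₂ = solve-∀ ringℚ
        assemble : _ → _ → _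
        assemble (x′ , x′∈ , x≡) (y′ , y′∈ , y≡) = α , 1ℚ - α , x′ , y′ ,
          (0≤α , ≤-sub α≤1 , ℚ.≤-reflexive (add-sub α 1ℚ)) , (x′∈ , y′∈) , x≡ , y≡

  reflectRight : Point (m ℕ.+ n) → Point (m ℕ.+ n)
  reflectRight z = append (left m z) (complement (right m z))

  reflect-l : ∀ z i → reflectRight z (i ↑ˡ n) ≡ z (i ↑ˡ n)
  reflect-l z i = append-l (left m z) (complement (right m z)) i

  reflect-r : ∀ z j → reflectRight z (m ↑ʳ j) ≡ 1ℚ - z (m ↑ʳ j)
  reflect-r z j = append-r (left m z) (complement (right m z)) j

  reflect-involutive : ∀ z k → reflectRight (reflectRight z) k ≡ z k
  reflect-involutive z = split-elim m (λ k → reflectRight (reflectRight z) k ≡ z k)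
    (λ i → trans (reflect-l (reflectRight z) i) (reflect-l z i))
    (λ j → trans (reflect-r (reflectRight z) j) (trans (cong (λ a → 1ℚ - a) (reflect-r z j)) (complement-involutive (z (m ↑ʳ j)))))

  reflect-affine : ∀ k → AffineForm (λ z → reflectRight z k)
  reflect-affine = split-elim m (λ k → AffineForm (λ z → reflectRight z k))
    (λ i → affine-cong (λ z → reflect-l z i) (coord-affine (i ↑ˡ n)))
    (λ j → affine-cong (λ z → reflect-r z j) (complement-affine (coord-affine (m ↑ʳ j))))

  -- Reflecting the upper part moves the common vertex (0, 1) of O(P) and O(Q) to the origin.
  ReflectedOrder : PointSet (m ℕ.+ n)
  ReflectedOrder z = OrderPolytope R (reflectRight z)

  reflect-equiv : AffineEquiv (OrderPolytope R) ReflectedOrder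
  reflect-equiv = record
    { to = reflectRight ; from = reflectRight ; to-affine = reflect-affine ; from-affine = reflect-affine
    ; to-mem = λ z z∈ → OrderPolytope-resp R (λ k → sym (reflect-involutive z k)) z∈
    ; from-mem = λ _ z∈ → z∈
    ; from-to = λ z _ → reflect-involutive z ; to-from = λ z _ → reflect-involutive z }

  -- The weight α is the largest coordinate of the lower part. Every coordinate of the upper part is
  -- at least α, hence at most 1 - α after the reflection.
  order-wedge : Wedge (OrderPolytope P) (OrderPolytope (dual Q)) ReflectedOrder
  order-wedge = record
    { origin-l = origin∈ P ; origin-r = origin∈ (dual Q)
    ; inl = λ x x∈ → OrderPolytope-resp R (reflected x origin)
        (order-append B x (complement origin) x∈ (complement-mem (dual Q) origin (origin∈ (dual Q)))
          (λ _ i _ → proj₁ (proj₂ x∈) i))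
    ; inr = λ y y∈ → OrderPolytope-resp R (reflected origin y)
        (order-append B origin (complement y) (origin∈ P) (complement-mem (dual Q) y y∈)
          (λ _ _ j → ≤-sub (proj₁ (proj₂ y∈) j)))
    ; decompose = decomposition }
    where
    origin∈ : ∀ {k} (S : BRel k) → OrderPolytope S origin
    origin∈ S = (λ _ → ℚ.≤-refl) , (λ _ → 0≤1) , λ _ _ _ → ℚ.≤-refl
    reflected : ∀ (x : Point m) (y : Point n) k → append x (complement y) k ≡ reflectRight (append x y) k
    reflected x y = split-elim m (λ k → append x (complement y) k ≡ reflectRight (append x y) k)
      (λ i → trans (append-l x (complement y) i) (sym (trans (reflect-l (append x y) i) (append-l x y i))))
      (λ j → trans (append-r x (complement y) j)
        (sym (trans (reflect-r (append x y) j) (cong (λ a → 1ℚ - a) (append-r x y j)))))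
    decomposition : ∀ z → ReflectedOrder z → _
    decomposition z z∈ = from-sup (supremum (λ (_ : Fin m) → ⊤) (λ _ → yes tt) x (allFin m))
      where
      x = left m z
      y = right m z
      x∈ : OrderPolytope P x
      x∈ = OrderPolytope-resp P (reflect-l z) (order-left B (reflectRight z) z∈)
      1-y∈ : OrderPolytope Q (complement y)
      1-y∈ = OrderPolytope-resp Q (reflect-r z) (order-right B (reflectRight z) z∈)
      y∈ : OrderPolytope (dual Q) y
      y∈ = OrderPolytope-resp (dual Q) (λ j → complement-involutive (y j)) (complement-mem Q (complement y) 1-y∈)
      x≤1-y : ∀ i j → x i ≤ 1ℚ - y j
      x≤1-y i j = subst (_≤ 1ℚ - y j) (reflect-l z i) (subst (reflectRight z (i ↑ˡ n) ≤_) (reflect-r z j)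
        (proj₂ (proj₂ z∈) (i ↑ˡ n) (m ↑ʳ j) (subst T (sym (ordinal-lr P Q i j)) tt)))
      from-sup : _ → _
      from-sup (α , 0≤α , upper , least) = assemble
        (order-scale P x α 0≤α (proj₁ x∈) (λ i → upper (∈.∈-allFin i) tt) (proj₂ (proj₂ x∈)))
        (order-scale (dual Q) y (1ℚ - α) (≤-sub α≤1) (proj₁ y∈) y≤ (proj₂ (proj₂ y∈)))
        where
        α≤1 : α ≤ 1ℚ
        α≤1 = least 1ℚ 0≤1 λ i _ → proj₁ (proj₂ x∈) i
        y≤ : ∀ j → y j ≤ 1ℚ - α
        y≤ j = ≤-add (subst (0ℚ ≤_) (lem (y j) α) (≤-sub (least (1ℚ - y j) (proj₁ 1-y∈ j) λ i _ → x≤1-y i j)))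
          where
          lem : ∀ d a → 1ℚ - d - a ≡ 1ℚ - a - d
          lem = solve-∀ ringℚ
        assemble : _ → _ → _
        assemble (x′ , x′∈ , x≡) (y′ , y′∈ , y≡) = α , 1ℚ - α , x′ , y′ ,
          (0≤α , ≤-sub α≤1 , ℚ.≤-reflexive (add-sub α 1ℚ)) , (x′∈ , y′∈) , x≡ , y≡

dual-equiv : ∀ {n} (R : BRel n) → AffineEquiv (OrderPolytope (dual R)) (OrderPolytope R)
dual-equiv R = record
  { to = complement ; from = complement
  ; to-affine = λ i → complement-affine (coord-affine i) ; from-affine = λ i → complement-affine (coord-affine i)
  ; to-mem = complement-mem (dual R) ; from-mem = complement-mem R
  ; from-to = λ x _ i → complement-involutive (x i) ; to-from = λ x _ i → complement-involutive (x i) }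

-- After the reflection the upper part is the order polytope of `dual Q`, and its embedding into the
-- chain polytope of `Q` is the given one preceded by the complement.
ordinalSum-embedding : ∀ {m n} {P : BRel m} {Q : BRel n} → IsPoset P → IsPoset Q →
  Embedding (OrderPolytope P) (ChainPolytope P) → Embedding (OrderPolytope Q) (ChainPolytope Q) →
  Embedding (OrderPolytope (ordinalSum P Q)) (ChainPolytope (ordinalSum P Q))
ordinalSum-embedding {P = P} {Q} p q e f = transport (reflect-equiv p q) ⨾
  WedgeEmbedding.wedge-embedding p (dual-poset q) {R₁′ = P} {Q} {ReflectedOrder p q} {ordinalSum P Q}
    (order-wedge p q) (chain-wedge p q)
    (avoidingCoords p P e) (avoidingCoords (dual-poset q) Q (transport (dual-equiv Q) ⨾ f))

-- Relabelling

-- Pigeonhole: if `j` were missed, punching it out would give an injection into a smaller finite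
-- set.
section : ∀ {n} (σ : Fin n → Fin n) → (∀ i j → σ i ≡ σ j → i ≡ j) → ∀ j → Σ (Fin n) λ i → σ i ≡ j
section {suc n} σ inj j with Fin.any? (λ i → σ i Fin.≟ j)
... | yes hit = hit
... | no miss = contradiction (Fin.injective⇒≤ {f = λ i → punchOut (avoid i)}
    (λ {i} {k} eq → inj i k (Fin.punchOut-injective (avoid i) (avoid k) eq))) ℕ.1+n≰n
  where
  avoid : ∀ i → j ≢ σ i
  avoid i eq = miss (i , sym eq)

module _ {n : ℕ} {R S : BRel n} (σ : Fin n → Fin n) (inj : ∀ i j → σ i ≡ σ j → i ≡ j)
    (rel : ∀ i j → S (σ i) (σ j) ≡ R i j) where
  private
    τ : Fin n → Fin n
    τ j = proj₁ (section σ inj j)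
    στ : ∀ j → σ (τ j) ≡ j
    στ j = proj₂ (section σ inj j)
    τσ : ∀ i → τ (σ i) ≡ i
    τσ i = inj (τ (σ i)) i (στ (σ i))
    S-via : ∀ i j → S i j ≡ R (τ i) (τ j)
    S-via i j = trans (sym (cong₂ S (στ i) (στ j))) (rel (τ i) (τ j))

  -- Double counting with unit vectors: every index is hit by `σ` exactly once.
  sum-relabel : ∀ f → sumℚ (λ i → f (σ i)) ≡ sumℚ f
  sum-relabel f = begin
    sumℚ (λ i → f (σ i))                        ≡⟨ sum-cong (λ i → sym (dot-unitʳ f (σ i))) ⟩
    sumℚ (λ i → sumℚ (λ j → f j * unit (σ i) j)) ≡⟨ sum-swap (λ i j → f j * unit (σ i) j) ⟩
    sumℚ (λ j → sumℚ (λ i → f j * unit (σ i) j)) ≡⟨ sum-cong (λ j → trans (sum-*ˡ (f j) (λ i → unit (σ i) j))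
                                                     (trans (cong (f j *_) (hits j)) (ℚ.*-identityʳ (f j)))) ⟩
    sumℚ f                                       ∎
    where
    open ≡-Reasoning
    hits : ∀ j → sumℚ (λ i → unit (σ i) j) ≡ 1ℚ
    hits j = trans (sum-single (λ i → unit (σ i) j) (τ j)
        (λ i i≢τj → unit-off (λ eq → i≢τj (trans (sym (τσ i)) (cong τ eq)))))
      (trans (cong (λ k → unit k j) (στ j)) (unit-diag j))

  relabel-poset : IsPoset R → IsPoset S
  relabel-poset P = record
    { refl = λ i → subst T (sym (S-via i i)) (IsPoset.refl P (τ i))
    ; antisym = λ i j t t′ → trans (sym (στ i)) (trans (cong σ (IsPoset.antisym P (τ i) (τ j)
        (subst T (S-via i j) t) (subst T (S-via j i) t′))) (στ j))
    ; trans = λ i j k t t′ → subst T (sym (S-via i k)) (IsPoset.trans P (τ i) (τ j) (τ k)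
        (subst T (S-via i j) t) (subst T (S-via j k) t′)) }

  order-relabel : AffineEquiv (OrderPolytope S) (OrderPolytope R)
  order-relabel = record
    { to = _∘ σ ; from = _∘ τ ; to-affine = coord-affine ∘ σ ; from-affine = coord-affine ∘ τ
    ; to-mem = λ x (nonneg , bound , mono) → nonneg ∘ σ , bound ∘ σ ,
        λ i j t → mono (σ i) (σ j) (subst T (sym (rel i j)) t)
    ; from-mem = λ y (nonneg , bound , mono) → nonneg ∘ τ , bound ∘ τ ,
        λ i j t → mono (τ i) (τ j) (subst T (S-via i j) t)
    ; from-to = λ x _ i → cong x (στ i) ; to-from = λ y _ i → cong y (τσ i) }

  chain-relabel : AffineEquiv (ChainPolytope R) (ChainPolytope S)
  chain-relabel = record
    { to = _∘ τ ; from = _∘ σ ; to-affine = coord-affine ∘ τ ; from-affine = coord-affine ∘ σ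
    ; to-mem = λ y y∈ → chainPolytope-intro S (y ∘ τ) (proj₁ y∈ ∘ τ) λ C chain → subst (_≤ 1ℚ)
        (trans (sum-cong (λ i → cong (λ k → bit (C (σ i)) * y k) (sym (τσ i)))) (sum-relabel (λ j → bit (C j) * y (τ j))))
        (chain-sum {R = R} y∈ (C ∘ σ) (λ i j Ci Cj → move (rel i j) (rel j i) (chain (σ i) (σ j) Ci Cj)))
    ; from-mem = λ x x∈ → chainPolytope-intro R (x ∘ σ) (proj₁ x∈ ∘ σ) λ C chain → subst (_≤ 1ℚ)
        (trans (sym (sum-relabel (λ j → bit (C (τ j)) * x j))) (sum-cong (λ i → cong (λ k → bit (C k) * x (σ i)) (τσ i))))
        (chain-sum {R = S} x∈ (C ∘ τ) (λ i j Ci Cj → move (sym (S-via i j)) (sym (S-via j i)) (chain (τ i) (τ j) Ci Cj)))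
    ; from-to = λ y _ i → cong y (τσ i) ; to-from = λ x _ i → cong x (στ i) }
    where
    move : ∀ {a b a′ b′} → a ≡ a′ → b ≡ b′ → T a ⊎ T b → T a′ ⊎ T b′
    move refl refl t = t

-- Induction over the family

InF⇒poset : ∀ {n} {R : BRel n} → InF R → IsPoset R
InF⇒poset (xfree P _) = P
InF⇒poset (ordsum {P = P} {Q} p q) = blocks-poset (ordinal-blocks P Q) (InF⇒poset p) (InF⇒poset q)
InF⇒poset (disj {P = P} {Q} p q) = blocks-poset (union-blocks P Q) (InF⇒poset p) (InF⇒poset q)
InF⇒poset (iso {R = R} {S} r (σ , inj , rel)) = relabel-poset {R = R} {S} σ inj rel (InF⇒poset r)

InF⇒embedding : ∀ {n} {R : BRel n} → InF R → Embedding (OrderPolytope R) (ChainPolytope R)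
InF⇒embedding (xfree P X-free) = transport (HibiLi.equivalence P X-free)
InF⇒embedding (ordsum p q) =
  ordinalSum-embedding (InF⇒poset p) (InF⇒poset q) (InF⇒embedding p) (InF⇒embedding q)
InF⇒embedding (disj {P = P} {Q} p q) = product-embedding (order-product P Q) (chain-product P Q)
  (order-bases P) (order-bases Q) (InF⇒embedding p) (InF⇒embedding q)
InF⇒embedding (iso {R = R} {S} r (σ , inj , rel)) =
  (transport (order-relabel {R = R} {S} σ inj rel) ⨾ InF⇒embedding r) ⨾ transport (chain-relabel {R = R} {S} σ inj rel)

theorem6p2 : ∀ (n : ℕ) (R : BRel n) → InF R →
    FPolyLe (OrderPolytope R) (ChainPolytope R)
theorem6p2 n R r = Embedding⇒FPolyLe (order-bases R) (InF⇒embedding r)
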